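{- Let $A=(a_{ij})$ and $B=(b_{ij})$, $i,j=0,1,2,3,\dots$, be the infinite matrices with entries in $\mathbb{Z}[[q]]$ given by $a_{ij}=q^{(4i+1)(4j+1)}$ for all $i,j\ge 0$; $b_{ij}=-q^{(4i-1)(4j-1)}$ and $b_{0j}=b_{i0}=0$ for all $i,j>0$; and $b_{00}=\sum_{n=0}^{\infty}q^{(2n+1)^2}$. Then there exists an admissible matrix $X$, invertible (with admissible two-sided inverse), such that $XB=AX$. In particular, for every integer $k\ge 1$, $\operatorname{tr}[A^k]=\operatorname{tr}[B^k]$ in $\mathbb{Z}[[q]]$; equivalently, for all positive integers $n$ and $k$, $$c_k^{1(4)}(n)=r_k^{1(2)}(n)+(-1)^k\,c_k^{3(4)}(n),$$ where $$r_k^{1(2)}(n)=\bigl|\{(x_1,\dots,x_k): x_i \text{ positive integers},\ x_i\equiv 1 \ (\mathrm{mod}\ 2),\ x_1^2+x_2^2+\cdots+x_k^2=n\}\bigr|$$ and, for $a\in\{1,3\}$, $$c_k^{a(4)}(n)=\bigl|\{(x_1,\dots,x_k): x_i \text{ positive integers},\ x_i\equiv a \ (\mathrm{mod}\ 4),\ x_1x_2+x_2x_3+\cdots+x_{k-1}x_k+x_kx_1=n\}\bigr|.$$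
   Context: All matrices are infinite, indexed by $i,j\in\{0,1,2,\dots\}$, with entries formal power series in $q$ (here in $\mathbb{Z}[[q]]$). For a power series $f$, $\deg(f)$ denotes the lowest exponent of $q$ occurring in $f$ (its order), with $\deg(0)=\infty$. A matrix $M=(m_{ij})$ is admissible if for every $n\in\mathbb{N}$ there is $k\in\mathbb{N}$ such that $|i-j|>k$ implies $\deg(m_{ij})>n$. The product of two admissible matrices is well defined (entrywise sums converge $q$-adically) and admissible, multiplication of admissible matrices is associative, and the identity matrix $I$ is admissible. A matrix $M$ is called admitted if for every $n\in\mathbb{N}$ there is $k\in\mathbb{N}$ such that $\max(i,j)>k$ implies $\deg(m_{ij})>n$; for such $M$ the trace $\operatorname{tr}[M]=\sum_{i\ge 0}m_{ii}$ is a well-defined power series. The matrices $A$ and $B$ of the claim, and all their powers $A^k,B^k$ with $k\ge1$, are admitted. The sum $x_1x_2+x_2x_3+\cdots+x_kx_1$ is the cyclic sum $\sum_{i=1}^k x_ix_{i+1}$ with $x_{k+1}=x_1$; thus for $k=1$ it is $x_1^2$ and for $k=2$ it is $x_1x_2+x_2x_1=2x_1x_2$. -}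

module Defs where

open import Data.Nat.Base as ℕ
  using (ℕ; zero; suc; _≤_; _<_; _≥_; _>_; z≤n; s≤s; _∸_; _⊔_; ∣_-_∣; _%_)
import Data.Nat.Properties as ℕₚ
open import Data.Integer.Base as ℤ using (ℤ; 0ℤ; 1ℤ)
import Data.Integer.Properties as ℤₚ
open import Data.Fin.Base using (Fin; toℕ)
open import Data.Fin.Properties using (toℕ≤pred[n])
open import Data.List.Base using (List; []; _∷_; length; upTo; filter; cartesianProductWith)
open import Data.List.Membership.Propositional using (_∈_)
open import Data.List.Membership.Propositional.Properties
  using (∈-filter⁺; ∈-filter⁻; ∈-upTo⁺; ∈-cartesianProductWith⁺)
open import Data.List.Relation.Unary.Any using (here)
open import Data.List.Relation.Unary.All using () renaming ([] to []ᴸ)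
open import Data.List.Relation.Unary.AllPairs using ([]; _∷_)
open import Data.List.Relation.Unary.Unique.Propositional using (Unique)
import Data.List.Relation.Unary.Unique.Propositional.Properties as Uniqueₚ
open import Data.Vec.Base as Vec using (Vec; []; _∷_; _∷ʳ_; zipWith)
open import Data.Vec.Properties using (∷-injective)
open import Data.Vec.Relation.Unary.All as All using (All; []; _∷_)
open import Data.Bool.Base using (if_then_else_)
open import Data.Product.Base using (_×_; _,_; proj₁; proj₂; ∃-syntax)
open import Data.Sum.Base using (_⊎_; inj₁; inj₂)
open import Function.Base using (_∘_; _$_)
open import Function.Bundles using (_⇔_; mk⇔)
open import Relation.Nullary using (does; yes; no; contradiction)
open import Relation.Nullary.Decidable using (_×-dec_; dec-false)
open import Relation.Unary using (Pred; Decidable)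
open import Relation.Binary.PropositionalEquality
  using (_≡_; refl; sym; trans; cong; subst)
open import Level using (0ℓ)

open import Algebra.Properties.Semiring.Sum ℤₚ.+-*-semiring public
  using (sum; sum-syntax; sum-cong-≗; sum-replicate-zero)

-- ℤ[[q]]: f n is the coefficient of qⁿ.
PowerSeries : Set
PowerSeries = ℕ → ℤ

infix 4 _≈_
_≈_ : PowerSeries → PowerSeries → Set
f ≈ g = ∀ n → f n ≡ g n

0# 1# : PowerSeries
0# _ = 0ℤ

q^_ : ℕ → PowerSeries
(q^ e) n = if does (n ℕₚ.≟ e) then 1ℤ else 0ℤ

1# = q^ 0

-_ : PowerSeries → PowerSeries
(- f) n = ℤ.- f n

infixl 7 _*_
_*_ : PowerSeries → PowerSeries → PowerSeries
(f * g) n = ∑[ i < suc n ] (f (toℕ i) ℤ.* g (n ∸ toℕ i))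

-- The order of a power series, in ℕ ∪ {∞}, is not computable; only the
-- relation "deg(f) > n" is ever used: no exponent ≤ n occurs in f.
infix 4 deg_>_
deg_>_ : PowerSeries → ℕ → Set
deg f > n = ∀ m → m ≤ n → f m ≡ 0ℤ

-- A sequence of power series tending q-adically to 0, with explicit modulus.
Summable : (ℕ → PowerSeries) → Set
Summable f = ∀ n → ∃[ L ] (∀ l → l ≥ L → deg f l > n)

-- The coefficient of qⁿ is that of any sufficiently long partial sum.
Σ∞ : (f : ℕ → PowerSeries) → Summable f → PowerSeries
Σ∞ f s n = ∑[ l < proj₁ (s n) ] f (toℕ l) n

∑-zero : ∀ {n} (t : Fin n → ℤ) → (∀ i → t i ≡ 0ℤ) → sum t ≡ 0ℤ
∑-zero {n} t t≡0 = trans (sum-cong-≗ t≡0) (sum-replicate-zero n)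

deg-0# : ∀ n → deg 0# > n
deg-0# n m _ = refl

deg-q^ : ∀ {e n} → e > n → deg (q^ e) > n
deg-q^ {e} e>n m m≤n
  rewrite dec-false (m ℕₚ.≟ e) (ℕₚ.<⇒≢ (ℕₚ.≤-<-trans m≤n e>n)) = refl

deg-neg : ∀ {f n} → deg f > n → deg (- f) > n
deg-neg d m m≤n = cong ℤ.-_ (d m m≤n)

deg-*ˡ : ∀ {f n} g → deg f > n → deg (f * g) > n
deg-*ˡ g d m m≤n = ∑-zero {suc m} _ λ i →
  cong (ℤ._* g (m ∸ toℕ i)) (d (toℕ i) (ℕₚ.≤-trans (toℕ≤pred[n] i) m≤n))

deg-*ʳ : ∀ {g n} f → deg g > n → deg (f * g) > n
deg-*ʳ f d m m≤n = ∑-zero {suc m} _ λ i →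
  trans (cong (f (toℕ i) ℤ.*_) (d (m ∸ toℕ i) (ℕₚ.≤-trans (ℕₚ.m∸n≤m m (toℕ i)) m≤n)))
        (ℤₚ.*-zeroʳ (f (toℕ i)))

deg-Σ∞ : ∀ {f n} (s : Summable f) → (∀ l → deg f l > n) → deg (Σ∞ f s) > n
deg-Σ∞ s d m m≤n = ∑-zero {proj₁ (s m)} _ λ l → d (toℕ l) m m≤n

∑-stable : ∀ L L′ (t : ℕ → ℤ) → (∀ l → l ≥ L → t l ≡ 0ℤ) → (∀ l → l ≥ L′ → t l ≡ 0ℤ) →
           ∑[ l < L ] t (toℕ l) ≡ ∑[ l < L′ ] t (toℕ l)
∑-stable zero    L′       t z z′ = sym (∑-zero {L′} _ λ l → z (toℕ l) z≤n)
∑-stable (suc L) zero     t z z′ = ∑-zero {suc L} _ λ l → z′ (toℕ l) z≤n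
∑-stable (suc L) (suc L′) t z z′ = cong (ℤ._+_ (t 0)) $
  ∑-stable L L′ (t ∘ suc) (λ l p → z (suc l) (s≤s p)) (λ l p → z′ (suc l) (s≤s p))

-- In particular Σ∞ does not depend on the chosen modulus.
Σ∞-partial : ∀ f (s : Summable f) n L → (∀ l → l ≥ L → f l n ≡ 0ℤ) →
             Σ∞ f s n ≡ ∑[ l < L ] f (toℕ l) n
Σ∞-partial f s n L z =
  ∑-stable (proj₁ (s n)) L (λ l → f l n) (λ l p → proj₂ (s n) l p n ℕₚ.≤-refl) z

Matrix : Set
Matrix = ℕ → ℕ → PowerSeries

Admissible : Matrix → Set
Admissible M = ∀ n → ∃[ k ] (∀ i j → ∣ i - j ∣ > k → deg (M i j) > n)

Admitted : Matrix → Set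
Admitted M = ∀ n → ∃[ k ] (∀ i j → i ⊔ j > k → deg (M i j) > n)

private

  far : ∀ a b {x y z} → z > a ℕ.+ b → z ≤ x ℕ.+ y → x > a ⊎ y > b
  far a b {x} {y} z> z≤ with x ℕₚ.≤? a | y ℕₚ.≤? b
  ... | no x≰a | _ = inj₁ (ℕₚ.≰⇒> x≰a)
  ... | yes _ | no y≰b = inj₂ (ℕₚ.≰⇒> y≰b)
  ... | yes x≤a | yes y≤b =
    contradiction (ℕₚ.<-≤-trans z> (ℕₚ.≤-trans z≤ (ℕₚ.+-mono-≤ x≤a y≤b))) (ℕₚ.<-irrefl refl)

  gap : ∀ i k l → l ≥ suc (i ℕ.+ k) → ∣ i - l ∣ > k
  gap i k l l≥ = ℕₚ.<-≤-trans
    (ℕₚ.m+n≤o⇒m≤o∸n (suc k) (subst (_≤ l) (cong suc (ℕₚ.+-comm i k)) l≥))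
    (subst (l ∸ i ≤_) (ℕₚ.∣-∣-comm l i) (ℕₚ.m∸n≤∣m-n∣ l i))

admitted⇒admissible : ∀ {M} → Admitted M → Admissible M
admitted⇒admissible adm n =
  proj₁ (adm n) , λ i j i-j> → proj₂ (adm n) i j (ℕₚ.<-≤-trans i-j> (ℕₚ.∣m-n∣≤m⊔n i j))

record AdmissibleMatrix : Set where
  constructor mkAdmissible
  field
    entry      : Matrix
    admissible : Admissible entry

open AdmissibleMatrix public

infix 4 _≋_
_≋_ : AdmissibleMatrix → AdmissibleMatrix → Set
M ≋ N = ∀ i j → entry M i j ≈ entry N i j

I : AdmissibleMatrix
I = mkAdmissible e λ n → 0 , off-diagonal n
  where
  e : Matrix
  e i j = if does (i ℕₚ.≟ j) then 1# else 0#

  off-diagonal : ∀ n i j → ∣ i - j ∣ > 0 → deg (e i j) > n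
  off-diagonal n i j i-j>0
    rewrite dec-false (i ℕₚ.≟ j) (λ i≡j → ℕₚ.<⇒≢ i-j>0 (sym (ℕₚ.m≡n⇒∣m-n∣≡0 i≡j))) = deg-0# n

product-summable : (M N : AdmissibleMatrix) (i j : ℕ) →
                   Summable (λ l → entry M i l * entry N l j)
product-summable M N i j n =
  suc (i ℕ.+ k) , λ l l≥ → deg-*ˡ (entry N l j) (d i l (gap i k l l≥))
  where
  k = proj₁ (admissible M n)
  d = proj₂ (admissible M n)

infixl 7 _·_
_·_ : AdmissibleMatrix → AdmissibleMatrix → AdmissibleMatrix
M · N = mkAdmissible e e-admissible
  where
  e : Matrix
  e i j = Σ∞ (λ l → entry M i l * entry N l j) (product-summable M N i j)

  e-admissible : Admissible e
  e-admissible n = k₁ ℕ.+ k₂ , λ i j i-j> →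
    deg-Σ∞ (product-summable M N i j) λ l →
      cases i j l (far k₁ k₂ i-j> (ℕₚ.∣-∣-triangle i l j))
    where
    k₁ = proj₁ (admissible M n)
    k₂ = proj₁ (admissible N n)

    cases : ∀ i j l → ∣ i - l ∣ > k₁ ⊎ ∣ l - j ∣ > k₂ →
            deg (entry M i l * entry N l j) > n
    cases i j l (inj₁ p) = deg-*ˡ (entry N l j) (proj₂ (admissible M n) i l p)
    cases i j l (inj₂ p) = deg-*ʳ (entry M i l) (proj₂ (admissible N n) l j p)

Invertible : AdmissibleMatrix → Set
Invertible X = ∃[ Y ] (X · Y ≋ I × Y · X ≋ I)

infixr 8 _^ᴹ_
_^ᴹ_ : AdmissibleMatrix → ℕ → AdmissibleMatrix
M ^ᴹ zero  = I
M ^ᴹ suc k = M · (M ^ᴹ k)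

·-admitted : ∀ M N → Admitted (entry M) → Admitted (entry (M · N))
·-admitted M N adm n = k₁ ℕ.+ k₂ , λ i j i⊔j> →
  deg-Σ∞ (product-summable M N i j) λ l →
    cases i j l (far k₁ k₂ i⊔j> (bound i j l))
  where
  k₁ = proj₁ (adm n)
  k₂ = proj₁ (admissible N n)

  bound : ∀ i j l → i ⊔ j ≤ (i ⊔ l) ℕ.+ ∣ l - j ∣
  bound i j l = ℕₚ.⊔-lub
    (ℕₚ.≤-trans (ℕₚ.m≤m⊔n i l) (ℕₚ.m≤m+n _ _))
    (ℕₚ.≤-trans (ℕₚ.m≤n+∣n-m∣ j l) (ℕₚ.+-monoˡ-≤ ∣ l - j ∣ (ℕₚ.m≤n⊔m i l)))

  cases : ∀ i j l → i ⊔ l > k₁ ⊎ ∣ l - j ∣ > k₂ → deg (entry M i l * entry N l j) > n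
  cases i j l (inj₁ p) = deg-*ˡ (entry N l j) (proj₂ (adm n) i l p)
  cases i j l (inj₂ p) = deg-*ʳ (entry M i l) (proj₂ (admissible N n) l j p)

^ᴹ-admitted : ∀ M → Admitted (entry M) → ∀ k → k ≥ 1 → Admitted (entry (M ^ᴹ k))
^ᴹ-admitted M adm (suc k) _ = ·-admitted M (M ^ᴹ k) adm

diagonal-summable : ∀ M → Admitted M → Summable (λ i → M i i)
diagonal-summable M adm n =
  suc (proj₁ (adm n)) , λ l l>k → proj₂ (adm n) l l (ℕₚ.<-≤-trans l>k (ℕₚ.m≤m⊔n l l))

tr : (M : AdmissibleMatrix) → Admitted (entry M) → PowerSeries
tr M adm = Σ∞ (λ i → entry M i i) (diagonal-summable (entry M) adm)

private

  ⊔≤* : ∀ {x y i j} → suc x ≥ i → suc y ≥ j → i ⊔ j ≤ suc x ℕ.* suc y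
  ⊔≤* {x} {y} p q = ℕₚ.⊔-lub
    (ℕₚ.≤-trans p (ℕₚ.m≤m*n (suc x) (suc y)))
    (ℕₚ.≤-trans q (ℕₚ.m≤n*m (suc y) (suc x)))

  4i+1≥i : ∀ i → 4 ℕ.* i ℕ.+ 1 ≥ i
  4i+1≥i i = ℕₚ.≤-trans (ℕₚ.m≤n*m i 4) (ℕₚ.m≤m+n _ 1)

  4[1+i]∸1≥1+i : ∀ i → 4 ℕ.* suc i ∸ 1 ≥ suc i
  4[1+i]∸1≥1+i i = ℕₚ.≤-trans (s≤s (ℕₚ.m≤m+n i _)) (ℕₚ.m≤n+m _ i)

  ⊔≤*′ : ∀ {x y i j} → x ≥ i → y ≥ j → x ≥ 1 → y ≥ 1 → i ⊔ j ≤ x ℕ.* y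
  ⊔≤*′ {suc _} {suc _} p q _ _ = ⊔≤* p q

a : Matrix
a i j = q^ ((4 ℕ.* i ℕ.+ 1) ℕ.* (4 ℕ.* j ℕ.+ 1))

odd-squares-summable : Summable (λ n → q^ ((2 ℕ.* n ℕ.+ 1) ℕ.^ 2))
odd-squares-summable n = n , λ l l≥n → deg-q^ (ℕₚ.≤-<-trans l≥n (l<[2l+1]² l))
  where
  l<2l+1 : ∀ l → l < 2 ℕ.* l ℕ.+ 1
  l<2l+1 l = subst (l <_) (ℕₚ.+-comm 1 (2 ℕ.* l)) (s≤s (ℕₚ.m≤n*m l 2))

  square : ∀ {x y} → x < y → x < y ℕ.^ 2
  square {y = suc y} x<y = ℕₚ.<-≤-trans x<y (ℕₚ.m≤m*n (suc y) (suc y ℕ.* 1))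

  l<[2l+1]² : ∀ l → l < (2 ℕ.* l ℕ.+ 1) ℕ.^ 2
  l<[2l+1]² l = square (l<2l+1 l)

-- The truncated subtraction is exact, as 4 * suc i ≥ 1.
b : Matrix
b zero    zero    = Σ∞ (λ n → q^ ((2 ℕ.* n ℕ.+ 1) ℕ.^ 2)) odd-squares-summable
b zero    (suc j) = 0#
b (suc i) zero    = 0#
b (suc i) (suc j) = - (q^ ((4 ℕ.* suc i ∸ 1) ℕ.* (4 ℕ.* suc j ∸ 1)))

a-admitted : Admitted a
a-admitted n = n , λ i j i⊔j>n → deg-q^ $ ℕₚ.<-≤-trans i⊔j>n $
  ⊔≤*′ (4i+1≥i i) (4i+1≥i j) (ℕₚ.m≤n+m 1 _) (ℕₚ.m≤n+m 1 _)

b-admitted : Admitted b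
b-admitted n = n , bound
  where
  bound : ∀ i j → i ⊔ j > n → deg (b i j) > n
  bound zero    (suc j) _ = deg-0# n
  bound (suc i) zero    _ = deg-0# n
  bound (suc i) (suc j) p = deg-neg $ deg-q^ $ ℕₚ.<-≤-trans p $
    ⊔≤*′ (4[1+i]∸1≥1+i i) (4[1+i]∸1≥1+i j)
         (ℕₚ.≤-trans (s≤s z≤n) (4[1+i]∸1≥1+i i)) (ℕₚ.≤-trans (s≤s z≤n) (4[1+i]∸1≥1+i j))

A B : AdmissibleMatrix
A = mkAdmissible a (admitted⇒admissible a-admitted)
B = mkAdmissible b (admitted⇒admissible b-admitted)

-- A finite subset of X, enumerated without repetition.
record Finite {X : Set} (P : Pred X 0ℓ) : Set where
  field
    elements : List X
    unique   : Unique elements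
    complete : ∀ {x} → x ∈ elements ⇔ P x

  cardinality : ℕ
  cardinality = length elements

open Finite public using (cardinality)

-- Pairs x₁,…,xₖ with its rotation x₂,…,xₖ,x₁; for k = 1 this gives x₁².
cyclicSum : ∀ {k} → Vec ℕ k → ℕ
cyclicSum []       = 0
cyclicSum (x ∷ xs) = Vec.sum (zipWith ℕ._*_ (x ∷ xs) (xs ∷ʳ x))

sumOfSquares : ∀ {k} → Vec ℕ k → ℕ
sumOfSquares xs = Vec.sum (Vec.map (ℕ._^ 2) xs)

RSet : (k n : ℕ) → Pred (Vec ℕ k) 0ℓ
RSet k n xs = All (λ x → x > 0 × x % 2 ≡ 1) xs × sumOfSquares xs ≡ n

CSet : (residue k n : ℕ) → Pred (Vec ℕ k) 0ℓ
CSet residue k n xs = All (λ x → x > 0 × x % 4 ≡ residue) xs × cyclicSum xs ≡ n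

private

  box : ∀ k → ℕ → List (Vec ℕ k)
  box zero    n = [] ∷ []
  box (suc k) n = cartesianProductWith _∷_ (upTo n) (box k n)

  box-unique : ∀ k n → Unique (box k n)
  box-unique zero    n = []ᴸ ∷ []
  box-unique (suc k) n =
    Uniqueₚ.cartesianProductWith⁺ _∷_ ∷-injective (Uniqueₚ.upTo⁺ n) (box-unique k n)

  ∈-box : ∀ {k n} {xs : Vec ℕ k} → All (_< n) xs → xs ∈ box k n
  ∈-box []       = here refl
  ∈-box (p ∷ ps) = ∈-cartesianProductWith⁺ _∷_ (∈-upTo⁺ p) (∈-box ps)

  bounded⇒finite : ∀ {k n} {P : Pred (Vec ℕ k) 0ℓ} → Decidable P →
                   (∀ {xs} → P xs → All (_≤ n) xs) → Finite P
  bounded⇒finite {k} {n} {P} P? bounded = record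
    { elements = filter P? (box k (suc n))
    ; unique   = Uniqueₚ.filter⁺ P? (box-unique k (suc n))
    ; complete = mk⇔
        (λ x∈ → proj₂ (∈-filter⁻ P? {xs = box k (suc n)} x∈))
        (λ p → ∈-filter⁺ P? (∈-box (All.map s≤s (bounded p))) p)
    }

  ≤-sum-zipWith : ∀ {k} (xs ys : Vec ℕ k) → All (_> 0) ys →
                  All (_≤ Vec.sum (zipWith ℕ._*_ xs ys)) xs
  ≤-sum-zipWith []       []           []       = []
  ≤-sum-zipWith (x ∷ xs) (suc y ∷ ys) (_ ∷ ps) =
    ℕₚ.≤-trans (ℕₚ.m≤m*n x (suc y)) (ℕₚ.m≤m+n _ _) ∷
    All.map (λ p → ℕₚ.≤-trans p (ℕₚ.m≤n+m _ (x ℕ.* suc y))) (≤-sum-zipWith xs ys ps)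

  ≤-sumOfSquares : ∀ {k} (xs : Vec ℕ k) → All (_≤ sumOfSquares xs) xs
  ≤-sumOfSquares []       = []
  ≤-sumOfSquares (x ∷ xs) =
    ℕₚ.≤-trans (x≤x² x) (ℕₚ.m≤m+n _ _) ∷
    All.map (λ p → ℕₚ.≤-trans p (ℕₚ.m≤n+m _ (x ℕ.^ 2))) (≤-sumOfSquares xs)
    where
    x≤x² : ∀ x → x ≤ x ℕ.^ 2
    x≤x² zero    = z≤n
    x≤x² (suc x) = ℕₚ.m≤m*n (suc x) (suc x ℕ.* 1)

  All-∷ʳ : ∀ {k} {P : Pred ℕ 0ℓ} {x} {xs : Vec ℕ k} → All P xs → P x → All P (xs ∷ʳ x)
  All-∷ʳ []       q = q ∷ []
  All-∷ʳ (p ∷ ps) q = p ∷ All-∷ʳ ps q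

  ≤-cyclicSum : ∀ {k} (xs : Vec ℕ k) → All (_> 0) xs → All (_≤ cyclicSum xs) xs
  ≤-cyclicSum []       []       = []
  ≤-cyclicSum (x ∷ xs) (p ∷ ps) = ≤-sum-zipWith (x ∷ xs) (xs ∷ʳ x) (All-∷ʳ ps p)

RSet-finite : ∀ k n → Finite (RSet k n)
RSet-finite k n = bounded⇒finite {n = n}
  (λ xs → All.all? (λ x → (0 ℕₚ.<? x) ×-dec (x % 2 ℕₚ.≟ 1)) xs ×-dec (sumOfSquares xs ℕₚ.≟ n))
  λ { {xs} (_ , refl) → ≤-sumOfSquares xs }

CSet-finite : ∀ residue k n → Finite (CSet residue k n)
CSet-finite residue k n = bounded⇒finite {n = n}
  (λ xs → All.all? (λ x → (0 ℕₚ.<? x) ×-dec (x % 4 ℕₚ.≟ residue)) xs ×-dec (cyclicSum xs ℕₚ.≟ n))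
  λ { {xs} (ps , refl) → ≤-cyclicSum xs (All.map proj₁ ps) }

r : (k n : ℕ) → ℕ
r k n = cardinality (RSet-finite k n)

c : (residue k n : ℕ) → ℕ
c residue k n = cardinality (CSet-finite residue k n)

{-# OPTIONS --safe #-}

-- Let Q = q¹⁶, let E be the bidiagonal matrix with columns
-- (1 − Q^{l+1}) e_{l+1} − q⁴(1 − q⁸Q^l) e_l, let B⁺ be B without its first row
-- and column, and let M = D⁻¹B⁺D with D = diag(q^{8i}). An identity between
-- monomials gives A E = E M. Since A is symmetric, Eᵀ A = Mᵀ Eᵀ, so A
-- preserves the one-dimensional kernel of Eᵀ and has an eigenvector v there,
-- and G = EᵀE satisfies G M = Mᵀ G = D²M D⁻² G, so M commutes with D⁻²G.
-- The matrix D⁻²G is tridiagonal with widely separated diagonal orders, so a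
-- q-adic contraction produces its eigenvectors T, which are then eigenvectors
-- of M. Hence [v | ET] diagonalises A and 1 ⊕ DTD⁻¹ diagonalises θ ⊕ B⁺ with
-- the same eigenvalues. Both are congruent to I modulo q, hence invertible,
-- which makes A similar to θ ⊕ B⁺. Comparing traces gives θ = b₀₀.
module Submission where

open import Defs
open import Data.Nat.Base as ℕ using (ℕ; zero; suc; _≥_; _≤_; _<_; _>_; z≤n; s≤s; _∸_; _⊔_; ∣_-_∣; _%_; _/_)
import Data.Nat.Properties as ℕₚ
open import Data.Nat.DivMod using ([m+kn]%n≡m%n; m≡m%n+[m/n]*n)
import Data.Nat.Tactic.RingSolver as ℕSolver
open import Data.Integer.Base as ℤ using (ℤ; +_; -1ℤ; _+_; _^_; 0ℤ; 1ℤ) renaming (_*_ to _*ℤ_)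
import Data.Integer.Properties as ℤₚ
import Data.Integer.Tactic.RingSolver as ℤSolver
open import Data.Fin.Base using (toℕ)
open import Data.Fin.Properties using (toℕ≤pred[n])
open import Data.Bool.Base using (true; false; if_then_else_)
open import Data.Maybe.Base as Maybe using (Maybe)
open import Data.Product.Base using (_×_; _,_; proj₁; proj₂; ∃-syntax)
open import Data.Sum.Base using (_⊎_; inj₁; inj₂)
open import Data.Vec.Base as Vec using (Vec; []; _∷_; _∷ʳ_; zipWith)
import Data.Vec.Properties as Vecₚ
open import Data.Vec.Relation.Unary.All as All using (All; []; _∷_)
open import Data.List.Base as List using (List; []; _∷_; length; upTo; applyUpTo; filter; cartesianProductWith)
import Data.List.Properties as Listₚ
open import Data.List.Membership.Propositional using (_∈_)
open import Data.List.Membership.Propositional.Properties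
  using (∈-filter⁺; ∈-filter⁻; ∈-map⁺; ∈-map⁻; ∈-upTo⁺; ∈-cartesianProductWith⁺)
open import Data.List.Membership.Propositional.Properties.WithK using (unique∧set⇒bag)
open import Data.List.Relation.Unary.Any using (here)
open import Data.List.Relation.Unary.All using () renaming ([] to []ᴸ)
open import Data.List.Relation.Unary.AllPairs using ([]; _∷_)
open import Data.List.Relation.Unary.Unique.Propositional using (Unique)
import Data.List.Relation.Unary.Unique.Propositional.Properties as Uniqueₚ
open import Data.List.Relation.Binary.BagAndSetEquality using (∼bag⇒↭)
open import Data.List.Relation.Binary.Permutation.Propositional.Properties using (↭-length)
open import Function.Base using (_∘_; _$_)
open import Function.Bundles using (mk⇔; module Equivalence)
open import Relation.Nullary using (does; yes; no; contradiction)
open import Relation.Nullary.Decidable using (dec-false; dec-true)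
open import Relation.Nullary.Decidable.Core using (dec⇒maybe)
open import Relation.Unary using (Pred; Decidable)
open import Relation.Binary.Bundles using (Setoid)
open import Relation.Binary.Definitions using (Tri; tri<; tri≈; tri>)
import Relation.Binary.Reasoning.Setoid as SetoidReasoning
open import Relation.Binary.PropositionalEquality
  using (_≡_; _≢_; refl; sym; trans; cong; cong₂; subst; module ≡-Reasoning)
open import Algebra.Bundles using (CommutativeRing)
open import Algebra.Structures (_≈_) using (IsCommutativeRing)
import Algebra.Solver.Ring
import Algebra.Solver.Ring.AlmostCommutativeRing as ACR
open import Level using (0ℓ)

-- The ring ℤ[[q]]

-- From A E = E M and M = D⁻¹B⁺D, the matrix E D⁻¹ would intertwine A with B⁺ at once; the obstacle
-- is that D⁻¹ contains negative powers of q. This forces the detour through eigenvectors: away from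
-- the corner the similarity has the form E (T D T⁻¹) D⁻¹, where T D T⁻¹ commutes with M and absorbs
-- the denominators. All entries of M are nonzero, and the commuting tridiagonal matrix is what
-- makes its eigenvectors accessible; E carries them to A, so the eigenvalues agree without ever
-- being computed. The shape of E comes from the exponent (4i+1)(4j+1): raising i by one multiplies
-- the entry by q⁴Q^j, raising j by one multiplies it by q⁴Q^i. Multiplication by Q in one index is
-- thus a shift in the other, and a two-term difference with coefficients affine in Q^j turns into
-- one of the same kind in i. Nothing is divided in ℤ[[q]]: powers of q are cancelled from both
-- sides of an equation, and units 1 + O(q) are inverted by solving a fixed-point equation.

infixl 6 _⊕_
infixl 7 _⊗_
infix 8 ⊖_

-- Opaque copies of the operations, so that unification does not unfold them.
opaque

  _⊕_ _⊗_ : PowerSeries → PowerSeries → PowerSeries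
  (f ⊕ g) n = f n ℤ.+ g n
  f ⊗ g = f * g

  ⊖_ : PowerSeries → PowerSeries
  ⊖ f = - f

  mono : ℕ → PowerSeries
  mono e = q^ e

infix 4 _≈[_]_
-- Congruence modulo qⁿ. The bound is strict, so that n = 0 is vacuous and every induction on the
-- precision starts for free.
_≈[_]_ : PowerSeries → ℕ → PowerSeries → Set
f ≈[ n ] g = ∀ m → m < n → f m ≡ g m

-- The sum defining a coefficient unfolds from its first term; commutativity also needs to split off
-- the last one.
*-suc : ∀ f g n → (f * g) (suc n) ≡ (f * (g ∘ suc)) n ℤ.+ f (suc n) ℤ.* g 0
*-suc f g zero = lemma (f 0) (g 0) (f 1) (g 1)
  where
  lemma : ∀ f₀ g₀ f₁ g₁ → f₀ ℤ.* g₁ ℤ.+ (f₁ ℤ.* g₀ ℤ.+ 0ℤ) ≡ (f₀ ℤ.* g₁ ℤ.+ 0ℤ) ℤ.+ f₁ ℤ.* g₀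
  lemma = ℤSolver.solve-∀
*-suc f g (suc n) = trans (cong (ℤ._+_ (f 0 ℤ.* g (suc (suc n)))) (*-suc (f ∘ suc) g n))
  (sym (ℤₚ.+-assoc (f 0 ℤ.* g (suc (suc n))) (((f ∘ suc) * (g ∘ suc)) n) (f (suc (suc n)) ℤ.* g 0)))

*-comm : ∀ f g → f * g ≈ g * f
*-comm f g zero = cong (ℤ._+ 0ℤ) (ℤₚ.*-comm (f 0) (g 0))
*-comm f g (suc n) = begin
  f 0 ℤ.* g (suc n) ℤ.+ ((f ∘ suc) * g) n  ≡⟨ ℤₚ.+-comm (f 0 ℤ.* g (suc n)) _ ⟩
  ((f ∘ suc) * g) n ℤ.+ f 0 ℤ.* g (suc n)  ≡⟨ cong₂ ℤ._+_ (*-comm (f ∘ suc) g n) (ℤₚ.*-comm (f 0) (g (suc n))) ⟩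
  (g * (f ∘ suc)) n ℤ.+ g (suc n) ℤ.* f 0  ≡⟨ *-suc g f n ⟨
  (g * f) (suc n)                          ∎
  where open ≡-Reasoning

*-distribʳ : ∀ f g h n → ((λ m → f m ℤ.+ g m) * h) n ≡ (f * h) n ℤ.+ (g * h) n
*-distribʳ f g h zero = lemma (f 0) (g 0) (h 0)
  where
  lemma : ∀ x y z → (x ℤ.+ y) ℤ.* z ℤ.+ 0ℤ ≡ (x ℤ.* z ℤ.+ 0ℤ) ℤ.+ (y ℤ.* z ℤ.+ 0ℤ)
  lemma = ℤSolver.solve-∀
*-distribʳ f g h (suc n) =
  trans (cong (ℤ._+_ ((f 0 ℤ.+ g 0) ℤ.* h (suc n))) (*-distribʳ (f ∘ suc) (g ∘ suc) h n))
        (lemma (f 0) (g 0) (h (suc n)) _ _)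
  where
  lemma : ∀ x y z u v → (x ℤ.+ y) ℤ.* z ℤ.+ (u ℤ.+ v) ≡ (x ℤ.* z ℤ.+ u) ℤ.+ (y ℤ.* z ℤ.+ v)
  lemma = ℤSolver.solve-∀

*-scaleˡ : ∀ x f g n → ((λ m → x ℤ.* f m) * g) n ≡ x ℤ.* (f * g) n
*-scaleˡ x f g zero = lemma x (f 0) (g 0)
  where
  lemma : ∀ x y z → (x ℤ.* y) ℤ.* z ℤ.+ 0ℤ ≡ x ℤ.* (y ℤ.* z ℤ.+ 0ℤ)
  lemma = ℤSolver.solve-∀
*-scaleˡ x f g (suc n) =
  trans (cong (ℤ._+_ (x ℤ.* f 0 ℤ.* g (suc n))) (*-scaleˡ x (f ∘ suc) g n))
        (lemma x (f 0) (g (suc n)) _)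
  where
  lemma : ∀ x y z u → (x ℤ.* y) ℤ.* z ℤ.+ x ℤ.* u ≡ x ℤ.* (y ℤ.* z ℤ.+ u)
  lemma = ℤSolver.solve-∀

*-cong[] : ∀ {n f f′ g g′} → f ≈[ n ] f′ → g ≈[ n ] g′ → f * g ≈[ n ] f′ * g′
*-cong[] p q m m<n = sum-cong-≗ {suc m} λ i → cong₂ ℤ._*_
  (p (toℕ i) (ℕₚ.≤-<-trans (toℕ≤pred[n] i) m<n))
  (q (m ∸ toℕ i) (ℕₚ.≤-<-trans (ℕₚ.m∸n≤m m (toℕ i)) m<n))

≈⇒≈[] : ∀ {f g} n → f ≈ g → f ≈[ n ] g
≈⇒≈[] _ p m _ = p m

≈[]⇒≈ : ∀ {f g} → (∀ n → f ≈[ n ] g) → f ≈ g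
≈[]⇒≈ p m = p (suc m) m ℕₚ.≤-refl

*-cong : ∀ {f f′ g g′} → f ≈ f′ → g ≈ g′ → f * g ≈ f′ * g′
*-cong p q = ≈[]⇒≈ λ n → *-cong[] (≈⇒≈[] n p) (≈⇒≈[] n q)

*-assoc : ∀ f g h → (f * g) * h ≈ f * (g * h)
*-assoc f g h zero = lemma (f 0) (g 0) (h 0)
  where
  lemma : ∀ x y z → (x ℤ.* y ℤ.+ 0ℤ) ℤ.* z ℤ.+ 0ℤ ≡ x ℤ.* (y ℤ.* z ℤ.+ 0ℤ) ℤ.+ 0ℤ
  lemma = ℤSolver.solve-∀
*-assoc f g h (suc n) = begin
  (f * g) 0 ℤ.* h (suc n) ℤ.+ ((λ m → f 0 ℤ.* g (suc m) ℤ.+ ((f ∘ suc) * g) m) * h) n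
    ≡⟨ cong (ℤ._+_ ((f * g) 0 ℤ.* h (suc n))) (trans (*-distribʳ (λ m → f 0 ℤ.* g (suc m)) ((f ∘ suc) * g) h n)
         (cong₂ ℤ._+_ (*-scaleˡ (f 0) (g ∘ suc) h n) (*-assoc (f ∘ suc) g h n))) ⟩
  (f * g) 0 ℤ.* h (suc n) ℤ.+ (f 0 ℤ.* ((g ∘ suc) * h) n ℤ.+ ((f ∘ suc) * (g * h)) n)
    ≡⟨ lemma (f 0) (g 0) (h (suc n)) _ _ ⟩
  f 0 ℤ.* (g * h) (suc n) ℤ.+ ((f ∘ suc) * (g * h)) n ∎
  where
  open ≡-Reasoning
  lemma : ∀ x y z u v → (x ℤ.* y ℤ.+ 0ℤ) ℤ.* z ℤ.+ (x ℤ.* u ℤ.+ v) ≡ x ℤ.* (y ℤ.* z ℤ.+ u) ℤ.+ v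
  lemma = ℤSolver.solve-∀

0*-zero : ∀ f n → (0# * f) n ≡ 0ℤ
0*-zero f zero = refl
0*-zero f (suc n) = trans (ℤₚ.+-identityˡ _) (0*-zero f n)

*-identityˡ : ∀ f → 1# * f ≈ f
*-identityˡ f zero = trans (ℤₚ.+-identityʳ _) (ℤₚ.*-identityˡ (f 0))
*-identityˡ f (suc n) = trans (cong₂ ℤ._+_ (ℤₚ.*-identityˡ (f (suc n))) (0*-zero f n)) (ℤₚ.+-identityʳ _)

q^-* : ∀ d e → q^ d * q^ e ≈ q^ (d ℕ.+ e)
q^-* zero e = *-identityˡ (q^ e)
q^-* (suc d) e zero = refl
q^-* (suc d) e (suc n) = trans (ℤₚ.+-identityˡ _) (q^-* d e n)

q^-*-coefficient : ∀ d f n → (q^ d * f) (d ℕ.+ n) ≡ f n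
q^-*-coefficient zero f n = *-identityˡ f n
q^-*-coefficient (suc d) f n = trans (ℤₚ.+-identityˡ _) (q^-*-coefficient d f n)

constant : ℤ → PowerSeries
constant x zero    = x
constant x (suc _) = 0ℤ

-- Sends the literals 0 and 1 to 0# and 1# definitionally, for the ring solver.
scalar : ℤ → PowerSeries
scalar (+ 0) = 0#
scalar (+ 1) = 1#
scalar x     = constant x

scalar≈constant : ∀ x → scalar x ≈ constant x
scalar≈constant (+ 0)             zero    = refl
scalar≈constant (+ 0)             (suc _) = refl
scalar≈constant (+ 1)             zero    = refl
scalar≈constant (+ 1)             (suc _) = refl
scalar≈constant (+ suc (suc _))   _       = refl
scalar≈constant (ℤ.-[1+ _ ])      _       = refl

opaque
  unfolding _⊕_

  ⊗-cong[] : ∀ {n f f′ g g′} → f ≈[ n ] f′ → g ≈[ n ] g′ → f ⊗ g ≈[ n ] f′ ⊗ g′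
  ⊗-cong[] = *-cong[]

  ⊕-cong[] : ∀ {n f f′ g g′} → f ≈[ n ] f′ → g ≈[ n ] g′ → f ⊕ g ≈[ n ] f′ ⊕ g′
  ⊕-cong[] p q m m<n = cong₂ ℤ._+_ (p m m<n) (q m m<n)

  ⊖-cong[] : ∀ {n f f′} → f ≈[ n ] f′ → ⊖ f ≈[ n ] ⊖ f′
  ⊖-cong[] p m m<n = cong ℤ.-_ (p m m<n)

  -- If q divides f, the top coefficient of the second factor only meets `f 0`, which is zero. This
  -- gain of one order is the source of every contraction below.
  ⊗-gain : ∀ {n f g g′} → f 0 ≡ 0ℤ → g ≈[ n ] g′ → f ⊗ g ≈[ suc n ] f ⊗ g′
  ⊗-gain {f = f} {g} {g′} f₀≡0 p zero _ =
    cong (ℤ._+ 0ℤ) (trans (cong (ℤ._* g 0) f₀≡0) (cong (ℤ._* g′ 0) (sym f₀≡0)))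
  ⊗-gain {f = f} {g} {g′} f₀≡0 p (suc m) (s≤s m<n) = cong₂ ℤ._+_
    (trans (cong (ℤ._* g (suc m)) f₀≡0) (cong (ℤ._* g′ (suc m)) (sym f₀≡0)))
    (*-cong[] {f = f ∘ suc} (λ _ _ → refl) p m m<n)

  isCommutativeRing : IsCommutativeRing _⊕_ _⊗_ ⊖_ 0# 1#
  isCommutativeRing = record
    { isRing = record
      { +-isAbelianGroup = record
        { isGroup = record
          { isMonoid = record
            { isSemigroup = record
              { isMagma = record
                { isEquivalence = record
                  { refl = λ _ → refl ; sym = λ p n → sym (p n) ; trans = λ p q n → trans (p n) (q n) }
                ; ∙-cong = λ p q n → cong₂ ℤ._+_ (p n) (q n) }
              ; assoc = λ f g h n → ℤₚ.+-assoc (f n) (g n) (h n) }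
            ; identity = (λ f n → ℤₚ.+-identityˡ (f n)) , (λ f n → ℤₚ.+-identityʳ (f n)) }
          ; inverse = (λ f n → ℤₚ.+-inverseˡ (f n)) , (λ f n → ℤₚ.+-inverseʳ (f n))
          ; ⁻¹-cong = λ p n → cong ℤ.-_ (p n) }
        ; comm = λ f g n → ℤₚ.+-comm (f n) (g n) }
      ; *-cong = *-cong
      ; *-assoc = *-assoc
      ; *-identity = *-identityˡ , λ f n → trans (*-comm f 1# n) (*-identityˡ f n)
      ; distrib =
          (λ f g h n → trans (*-comm f (λ m → g m ℤ.+ h m) n) (trans (*-distribʳ g h f n)
            (cong₂ ℤ._+_ (*-comm g f n) (*-comm h f n))))
        , λ f g h → *-distribʳ g h f }
    ; *-comm = *-comm }

  mono-⊗ : ∀ d e → mono d ⊗ mono e ≈ mono (d ℕ.+ e)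
  mono-⊗ = q^-*

  mono-0 : mono 0 ≈ 1#
  mono-0 _ = refl

  -- The coefficients of the products at `d ℕ.+ n` are those of f and g at n. This replaces division
  -- by a power of q.
  mono-cancel : ∀ d {f g} → mono d ⊗ f ≈ mono d ⊗ g → f ≈ g
  mono-cancel d {f} {g} p n =
    trans (sym (q^-*-coefficient d f n)) (trans (p (d ℕ.+ n)) (q^-*-coefficient d g n))

  mono-high : ∀ {n e} → n ≤ e → mono e ≈[ n ] 0#
  mono-high n≤e m m<n = deg-q^ (ℕₚ.<-≤-trans m<n n≤e) m ℕₚ.≤-refl

  constant-scale : ∀ x f n → (constant x ⊗ f) n ≡ x ℤ.* f n
  constant-scale x f zero = ℤₚ.+-identityʳ _
  constant-scale x f (suc n) = trans (cong (ℤ._+_ (x ℤ.* f (suc n))) (0*-zero f n)) (ℤₚ.+-identityʳ _)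

series-commutativeRing : CommutativeRing 0ℓ 0ℓ
series-commutativeRing = record { isCommutativeRing = isCommutativeRing }

open CommutativeRing series-commutativeRing
  using (setoid)
  renaming (refl to ≈-refl; sym to ≈-sym; trans to ≈-trans; reflexive to ≈-reflexive;
            +-cong to ⊕-cong; *-cong to ⊗-cong; -‿cong to ⊖-cong;
            +-identityˡ to ⊕-identityˡ; +-identityʳ to ⊕-identityʳ; *-identityˡ to ⊗-identityˡ;
            *-identityʳ to ⊗-identityʳ; zeroˡ to ⊗-zeroˡ; zeroʳ to ⊗-zeroʳ;
            distribˡ to ⊗-distribˡ-⊕; *-comm to ⊗-comm; *-assoc to ⊗-assoc; +-comm to ⊕-comm)

opaque
  unfolding _⊕_

  scalar-⊕ : ∀ x y → scalar (x ℤ.+ y) ≈ scalar x ⊕ scalar y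
  scalar-⊕ x y = ≈-trans (scalar≈constant (x ℤ.+ y)) (≈-trans
    (λ { zero → refl ; (suc _) → refl })
    (⊕-cong (≈-sym (scalar≈constant x)) (≈-sym (scalar≈constant y))))

  scalar-⊗ : ∀ x y → scalar (x ℤ.* y) ≈ scalar x ⊗ scalar y
  scalar-⊗ x y = ≈-trans (scalar≈constant (x ℤ.* y)) (≈-trans
    (λ { zero → sym (ℤₚ.+-identityʳ _)
       ; (suc n) → sym (trans (constant-scale x (constant y) (suc n)) (ℤₚ.*-zeroʳ x)) })
    (⊗-cong (≈-sym (scalar≈constant x)) (≈-sym (scalar≈constant y))))

  scalar-⊖ : ∀ x → scalar (ℤ.- x) ≈ ⊖ scalar x
  scalar-⊖ x = ≈-trans (scalar≈constant (ℤ.- x)) (≈-trans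
    (λ { zero → refl ; (suc _) → refl })
    (⊖-cong (≈-sym (scalar≈constant x))))

scalar-homomorphism :
  ℤ.+-*-rawRing ACR.-Raw-AlmostCommutative⟶ ACR.fromCommutativeRing series-commutativeRing
scalar-homomorphism = record
  { ⟦_⟧    = scalar
  ; +-homo = scalar-⊕
  ; *-homo = scalar-⊗
  ; -‿homo = scalar-⊖
  ; 0-homo = ≈-refl
  ; 1-homo = ≈-refl }

scalar-≟ : ∀ x y → Maybe (scalar x ≈ scalar y)
scalar-≟ x y = Maybe.map (λ p → ≈-reflexive (cong scalar p)) (dec⇒maybe (x ℤₚ.≟ y))

open Algebra.Solver.Ring ℤ.+-*-rawRing (ACR.fromCommutativeRing series-commutativeRing)
  scalar-homomorphism scalar-≟
  using (solve; _:=_; con; _:+_; _:*_; _:-_; :-_)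

-- Sums of power series

module ≈-Reasoning = SetoidReasoning setoid

truncated-setoid : ℕ → Setoid 0ℓ 0ℓ
truncated-setoid n = record
  { Carrier       = PowerSeries
  ; _≈_           = λ f g → f ≈[ n ] g
  ; isEquivalence = record
    { refl  = λ _ _ → refl
    ; sym   = λ p m m<n → sym (p m m<n)
    ; trans = λ p q m m<n → trans (p m m<n) (q m m<n) } }

module ≈[]-Reasoning (n : ℕ) = SetoidReasoning (truncated-setoid n)

≈[]-sym : ∀ {n f g} → f ≈[ n ] g → g ≈[ n ] f
≈[]-sym p m m<n = sym (p m m<n)

≈[]-trans : ∀ {n f g h} → f ≈[ n ] g → g ≈[ n ] h → f ≈[ n ] h
≈[]-trans p q m m<n = trans (p m m<n) (q m m<n)

≈[]-mono : ∀ {k n f g} → k ≤ n → f ≈[ n ] g → f ≈[ k ] g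
≈[]-mono k≤n p m m<k = p m (ℕₚ.<-≤-trans m<k k≤n)

⊗-0ˡ[] : ∀ {n f} g → f ≈[ n ] 0# → f ⊗ g ≈[ n ] 0#
⊗-0ˡ[] {n} g p = ≈[]-trans (⊗-cong[] {g = g} p (≈⇒≈[] n ≈-refl)) (≈⇒≈[] n (⊗-zeroˡ g))

⊗-0ʳ[] : ∀ {n g} f → g ≈[ n ] 0# → f ⊗ g ≈[ n ] 0#
⊗-0ʳ[] {n} f p = ≈[]-trans (⊗-cong[] {f = f} (≈⇒≈[] n ≈-refl) p) (≈⇒≈[] n (⊗-zeroʳ f))

⊗-0-gain : ∀ {n f g} → f 0 ≡ 0ℤ → g ≈[ n ] 0# → f ⊗ g ≈[ suc n ] 0#
⊗-0-gain {n} {f} f₀≡0 p = ≈[]-trans (⊗-gain f₀≡0 p) (≈⇒≈[] (suc n) (⊗-zeroʳ f))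

⊕-0[] : ∀ {n f g} → f ≈[ n ] 0# → g ≈[ n ] 0# → f ⊕ g ≈[ n ] 0#
⊕-0[] {n} p q = ≈[]-trans (⊕-cong[] p q) (≈⇒≈[] n (⊕-identityˡ 0#))

⊖-0 : ⊖ 0# ≈ 0#
⊖-0 = solve 0 (:- con (+ 0) := con (+ 0)) ≈-refl

⊖-0[] : ∀ {n f} → f ≈[ n ] 0# → ⊖ f ≈[ n ] 0#
⊖-0[] {n} p = ≈[]-trans (⊖-cong[] p) (≈⇒≈[] n ⊖-0)

Sum : ℕ → (ℕ → PowerSeries) → PowerSeries
Sum zero    f = 0#
Sum (suc L) f = f 0 ⊕ Sum L (f ∘ suc)

Sum-cong[] : ∀ {n f g} L → (∀ l → f l ≈[ n ] g l) → Sum L f ≈[ n ] Sum L g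
Sum-cong[] zero    p = λ _ _ → refl
Sum-cong[] (suc L) p = ⊕-cong[] (p 0) (Sum-cong[] L (p ∘ suc))

Sum-cong : ∀ {f g} L → (∀ l → f l ≈ g l) → Sum L f ≈ Sum L g
Sum-cong zero    p = ≈-refl
Sum-cong (suc L) p = ⊕-cong (p 0) (Sum-cong L (p ∘ suc))

Sum-0[] : ∀ {n f} L → (∀ l → f l ≈[ n ] 0#) → Sum L f ≈[ n ] 0#
Sum-0[] zero    p = λ _ _ → refl
Sum-0[] (suc L) p = ⊕-0[] (p 0) (Sum-0[] L (p ∘ suc))

Sum-0 : ∀ {f} L → (∀ l → f l ≈ 0#) → Sum L f ≈ 0#
Sum-0 L p = ≈[]⇒≈ λ n → Sum-0[] L (λ l → ≈⇒≈[] n (p l))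

Sum-⊕ : ∀ f g L → Sum L (λ l → f l ⊕ g l) ≈ Sum L f ⊕ Sum L g
Sum-⊕ f g zero    = ≈-sym (⊕-identityˡ 0#)
Sum-⊕ f g (suc L) = ≈-trans (⊕-cong ≈-refl (Sum-⊕ (f ∘ suc) (g ∘ suc) L))
  (solve 4 (λ x y u v → (x :+ y) :+ (u :+ v) := (x :+ u) :+ (y :+ v)) ≈-refl _ _ _ _)

Sum-⊗ˡ : ∀ x f L → Sum L (λ l → x ⊗ f l) ≈ x ⊗ Sum L f
Sum-⊗ˡ x f zero    = ≈-sym (⊗-zeroʳ x)
Sum-⊗ˡ x f (suc L) = ≈-trans (⊕-cong ≈-refl (Sum-⊗ˡ x (f ∘ suc) L)) (≈-sym (⊗-distribˡ-⊕ x (f 0) _))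

Sum-⊗ʳ : ∀ x f L → Sum L (λ l → f l ⊗ x) ≈ Sum L f ⊗ x
Sum-⊗ʳ x f L = ≈-trans (Sum-cong L λ l → ⊗-comm (f l) x) (≈-trans (Sum-⊗ˡ x f L) (⊗-comm x _))

Sum-⊖ : ∀ f L → Sum L (λ l → ⊖ f l) ≈ ⊖ Sum L f
Sum-⊖ f zero    = ≈-sym ⊖-0
Sum-⊖ f (suc L) = ≈-trans (⊕-cong ≈-refl (Sum-⊖ (f ∘ suc) L))
  (solve 2 (λ x y → :- x :+ :- y := :- (x :+ y)) ≈-refl _ _)

Sum-swap : ∀ (f : ℕ → ℕ → PowerSeries) K L →
           Sum K (λ k → Sum L (λ l → f k l)) ≈ Sum L (λ l → Sum K (λ k → f k l))
Sum-swap f zero    L = ≈-sym (Sum-0 L λ _ → ≈-refl)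
Sum-swap f (suc K) L = ≈-trans (⊕-cong ≈-refl (Sum-swap (f ∘ suc) K L))
  (≈-sym (Sum-⊕ (f 0) (λ l → Sum K (λ k → f (suc k) l)) L))

Sum-snoc : ∀ f L → Sum (suc L) f ≈ Sum L f ⊕ f L
Sum-snoc f zero    = ⊕-comm (f 0) 0#
Sum-snoc f (suc L) = ≈-trans (⊕-cong ≈-refl (Sum-snoc (f ∘ suc) L))
  (solve 3 (λ x y z → x :+ (y :+ z) := (x :+ y) :+ z) ≈-refl _ _ _)

Sum-extend : ∀ {n} f {L L′} → L ≤ L′ → (∀ l → l ≥ L → f l ≈[ n ] 0#) → Sum L′ f ≈[ n ] Sum L f
Sum-extend f {L′ = L′} z≤n p = Sum-0[] {f = f} L′ λ l → p l z≤n
Sum-extend f (s≤s L≤L′) p =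
  ⊕-cong[] {f = f 0} (λ _ _ → refl) (Sum-extend (f ∘ suc) L≤L′ λ l l≥L → p (suc l) (s≤s l≥L))

opaque
  unfolding _⊕_

  Sum-coefficient : ∀ L f n → Sum L f n ≡ ∑[ l < L ] f (toℕ l) n
  Sum-coefficient zero    f n = refl
  Sum-coefficient (suc L) f n = cong (ℤ._+_ (f 0 n)) (Sum-coefficient L (f ∘ suc) n)

Σ∞-Sum : ∀ {f} (s : Summable f) {n} L → (∀ l → l ≥ L → f l ≈[ n ] 0#) → Σ∞ f s ≈[ n ] Sum L f
Σ∞-Sum {f} s L p m m<n =
  trans (Σ∞-partial f s m L λ l l≥L → p l l≥L m m<n) (sym (Sum-coefficient L f m))

-- `Summable` with the modulus fixed once and for all: n terms determine the sum modulo qⁿ, and no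
-- witness has to be carried along.
Decay : (ℕ → PowerSeries) → Set
Decay f = ∀ l → f l ≈[ l ] 0#

-- Coefficient n only sees the first n + 1 terms, so this is the sum of f only under Decay f.
Series : (ℕ → PowerSeries) → PowerSeries
Series f n = Sum (suc n) f n

Decay-tail : ∀ {f} → Decay f → ∀ {n} l → l ≥ n → f l ≈[ n ] 0#
Decay-tail d l l≥n = ≈[]-mono l≥n (d l)

Decay-⊗ˡ : ∀ {f} (g : ℕ → PowerSeries) → Decay f → Decay (λ l → f l ⊗ g l)
Decay-⊗ˡ g d l = ⊗-0ˡ[] (g l) (d l)

Series-Sum′ : ∀ {f} → Decay f → ∀ {n} L → L ≥ n → Series f ≈[ n ] Sum L f
Series-Sum′ {f} d L L≥n m m<n =
  sym (Sum-extend f (ℕₚ.<-≤-trans m<n L≥n) (λ l l>m → Decay-tail {f} d l l>m) m ℕₚ.≤-refl)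

Series-Sum : ∀ {f} → Decay f → ∀ n → Series f ≈[ n ] Sum n f
Series-Sum d n = Series-Sum′ d n ℕₚ.≤-refl

Σ∞-Series : ∀ {f} (s : Summable f) → Decay f → Σ∞ f s ≈ Series f
Σ∞-Series {f} s d = ≈[]⇒≈ λ n →
  ≈[]-trans (Σ∞-Sum s n λ l → Decay-tail d l) (≈[]-sym (Series-Sum d n))

Series-cong : ∀ {f g} → (∀ l → f l ≈ g l) → Series f ≈ Series g
Series-cong p n = Sum-cong (suc n) p n

opaque
  unfolding _⊕_

  Series-⊕ : ∀ f g → Series (λ l → f l ⊕ g l) ≈ Series f ⊕ Series g
  Series-⊕ f g n = Sum-⊕ f g (suc n) n

  Series-⊖ : ∀ f → Series (λ l → ⊖ f l) ≈ ⊖ Series f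
  Series-⊖ f n = Sum-⊖ f (suc n) n

Series-⊗ˡ : ∀ x {f} → Decay f → Series (λ l → x ⊗ f l) ≈ x ⊗ Series f
Series-⊗ˡ x {f} d = ≈[]⇒≈ λ n → let open ≈[]-Reasoning n in begin
  Series (λ l → x ⊗ f l)  ≈⟨ Series-Sum (λ l → ⊗-0ʳ[] x (d l)) n ⟩
  Sum n (λ l → x ⊗ f l)   ≈⟨ ≈⇒≈[] n (Sum-⊗ˡ x f n) ⟩
  x ⊗ Sum n f             ≈⟨ ⊗-cong[] {f = x} (λ _ _ → refl) (Series-Sum d n) ⟨
  x ⊗ Series f            ∎

-- Contractions

-- Precision is measured uniformly over the index set, which is ℕ for vectors and `ℕ × ℕ` for
-- matrices.
Contracting : ∀ {Ix : Set} → ((Ix → PowerSeries) → Ix → PowerSeries) → Set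
Contracting Φ = ∀ n x y → (∀ i → x i ≈[ n ] y i) → ∀ i → Φ x i ≈[ suc n ] Φ y i

iterate : ∀ {Ix : Set} → ((Ix → PowerSeries) → Ix → PowerSeries) → ℕ → Ix → PowerSeries
iterate Φ zero    _ = 0#
iterate Φ (suc n)   = Φ (iterate Φ n)

iterate-stable : ∀ {Ix : Set} {Φ : (Ix → PowerSeries) → Ix → PowerSeries} → Contracting Φ →
                 ∀ n k i → iterate Φ n i ≈[ n ] iterate Φ (n ℕ.+ k) i
iterate-stable contracting zero    k i _ ()
iterate-stable contracting (suc n) k i = contracting n _ _ (iterate-stable contracting n k) i

opaque

  -- Coefficient n no longer changes after `suc n` iterations, so the limit can be read off along
  -- the diagonal.
  fixpoint : ∀ {Ix : Set} → ((Ix → PowerSeries) → Ix → PowerSeries) → Ix → PowerSeries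
  fixpoint Φ i n = iterate Φ (suc n) i n

  fixpoint-iterate : ∀ {Ix : Set} {Φ : (Ix → PowerSeries) → Ix → PowerSeries} → Contracting Φ →
                     ∀ n i → fixpoint Φ i ≈[ n ] iterate Φ n i
  fixpoint-iterate {Φ = Φ} contracting n i m m<n =
    subst (λ k → iterate Φ (suc m) i m ≡ iterate Φ k i m) (ℕₚ.m+[n∸m]≡n m<n)
      (iterate-stable contracting (suc m) (n ∸ suc m) i m ℕₚ.≤-refl)

fixpoint-fixed : ∀ {Ix : Set} {Φ : (Ix → PowerSeries) → Ix → PowerSeries} → Contracting Φ →
                 ∀ i → fixpoint Φ i ≈ Φ (fixpoint Φ) i
fixpoint-fixed contracting i = ≈[]⇒≈ λ n → ≈[]-mono (ℕₚ.n≤1+n n) $ ≈[]-trans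
  (fixpoint-iterate contracting (suc n) i)
  (contracting n _ _ (λ j → ≈[]-sym (fixpoint-iterate contracting n j)) i)

-- The uniqueness counterpart of `fixpoint`: a solution of a contracting homogeneous system gains an
-- order at each pass, hence is zero.
vanishing : ∀ {Ix : Set} (x : Ix → PowerSeries) →
            (∀ n → (∀ i → x i ≈[ n ] 0#) → ∀ i → x i ≈[ suc n ] 0#) → ∀ i → x i ≈ 0#
vanishing x step i = ≈[]⇒≈ λ n → all n i
  where
  all : ∀ n i → x i ≈[ n ] 0#
  all zero    i _ ()
  all (suc n) = step n (all n)

-- Admissible matrices

≈[]⇒deg : ∀ {f n} → f ≈[ suc n ] 0# → deg f > n
≈[]⇒deg p m m≤n = p m (s≤s m≤n)

band : AdmissibleMatrix → ℕ → ℕ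
band M n = proj₁ (admissible M n)

outside-band : ∀ M n i j → ∣ i - j ∣ > band M n → entry M i j ≈[ n ] 0#
outside-band M n i j p m m<n = proj₂ (admissible M n) i j p m (ℕₚ.<⇒≤ m<n)

beyond : ∀ i k {l} → l > i ℕ.+ k → ∣ i - l ∣ > k
beyond i k {l} l> = ℕₚ.+-cancelˡ-< i k ∣ i - l ∣ (ℕₚ.<-≤-trans l>
  (subst (λ d → l ≤ i ℕ.+ d) (ℕₚ.∣-∣-comm l i) (ℕₚ.m≤n+∣m-n∣ l i)))

row-tail : ∀ M n i l → l > i ℕ.+ band M n → entry M i l ≈[ n ] 0#
row-tail M n i l p = outside-band M n i l (beyond i (band M n) p)

column-tail : ∀ M n j l → l > j ℕ.+ band M n → entry M l j ≈[ n ] 0#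
column-tail M n j l p = outside-band M n l j
  (subst (_> band M n) (ℕₚ.∣-∣-comm j l) (beyond j (band M n) p))

apply-summable : ∀ M (y : ℕ → PowerSeries) i → Summable (λ l → entry M i l * y l)
apply-summable M y i n = suc (i ℕ.+ k) , λ l l> →
  deg-*ˡ (y l) (proj₂ (admissible M n) i l (beyond i k l>))
  where k = band M n

-- Rows of an admissible matrix tend to zero, so the sum converges for arbitrary vectors, without
-- any decay of y.
apply : AdmissibleMatrix → (ℕ → PowerSeries) → ℕ → PowerSeries
apply M y i = Σ∞ (λ l → entry M i l * y l) (apply-summable M y i)

infixl 7 _⊡_

opaque
  unfolding _⊕_

  _⊡_ : AdmissibleMatrix → AdmissibleMatrix → AdmissibleMatrix
  _⊡_ = _·_

  apply-Sum : ∀ M y n i L → L > i ℕ.+ band M n →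
              apply M y i ≈[ n ] Sum L (λ l → entry M i l ⊗ y l)
  apply-Sum M y n i L L> = Σ∞-Sum (apply-summable M y i) L λ l l≥L →
    ⊗-0ˡ[] (y l) (row-tail M n i l (ℕₚ.<-≤-trans L> l≥L))

  ⊡-Sum : ∀ M N n i j L → (∀ l → l ≥ L → entry M i l ⊗ entry N l j ≈[ n ] 0#) →
          entry (M ⊡ N) i j ≈[ n ] Sum L (λ l → entry M i l ⊗ entry N l j)
  ⊡-Sum M N n i j L = Σ∞-Sum (product-summable M N i j) L

⊡-Sumˡ : ∀ M N n i j L → L > i ℕ.+ band M n →
         entry (M ⊡ N) i j ≈[ n ] Sum L (λ l → entry M i l ⊗ entry N l j)
⊡-Sumˡ M N n i j L L> = ⊡-Sum M N n i j L λ l l≥L →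
  ⊗-0ˡ[] (entry N l j) (row-tail M n i l (ℕₚ.<-≤-trans L> l≥L))

⊡-Sumʳ : ∀ M N n i j L → L > j ℕ.+ band N n →
         entry (M ⊡ N) i j ≈[ n ] Sum L (λ l → entry M i l ⊗ entry N l j)
⊡-Sumʳ M N n i j L L> = ⊡-Sum M N n i j L λ l l≥L →
  ⊗-0ʳ[] (entry M i l) (column-tail N n j l (ℕₚ.<-≤-trans L> l≥L))

opaque
  unfolding _⊕_ _⊡_

  ⊡-apply : ∀ M N i j → entry (M ⊡ N) i j ≈ apply M (λ l → entry N l j) i
  ⊡-apply M N i j = ≈[]⇒≈ λ n → let L = suc (i ℕ.+ band M n) in
    ≈[]-trans (⊡-Sumˡ M N n i j L ℕₚ.≤-refl) (≈[]-sym (apply-Sum M (λ l → entry N l j) n i L ℕₚ.≤-refl))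

infix 4 _≅_

-- A record around _≋_, so that unification can recover M and N.
record _≅_ (M N : AdmissibleMatrix) : Set where
  constructor mk≅
  field entrywise : M ≋ N

open _≅_

matrix-setoid : Setoid 0ℓ 0ℓ
matrix-setoid = record
  { Carrier       = AdmissibleMatrix
  ; _≈_           = _≅_
  ; isEquivalence = record
    { refl  = mk≅ λ i j → ≈-refl
    ; sym   = λ p → mk≅ λ i j → ≈-sym (entrywise p i j)
    ; trans = λ p q → mk≅ λ i j → ≈-trans (entrywise p i j) (entrywise q i j) } }

open Setoid matrix-setoid using () renaming (refl to ≅-refl; sym to ≅-sym)
module ≅-Reasoning = SetoidReasoning matrix-setoid

⊡-cong : ∀ {M M′ N N′} → M ≅ M′ → N ≅ N′ → M ⊡ N ≅ M′ ⊡ N′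
⊡-cong {M} {M′} {N} {N′} p q = mk≅ λ i j → ≈[]⇒≈ λ n →
  let L = suc ((i ℕ.+ band M n) ℕ.+ (i ℕ.+ band M′ n)) in ≈[]-trans
    (⊡-Sumˡ M N n i j L (s≤s (ℕₚ.m≤m+n _ _))) $ ≈[]-trans
    (≈⇒≈[] n (Sum-cong L λ l → ⊗-cong (entrywise p i l) (entrywise q l j)))
    (≈[]-sym (⊡-Sumˡ M′ N′ n i j L (s≤s (ℕₚ.m≤n+m _ (i ℕ.+ band M n)))))

⊡-assoc : ∀ M N P → (M ⊡ N) ⊡ P ≅ M ⊡ (N ⊡ P)
⊡-assoc M N P = mk≅ λ i j → ≈[]⇒≈ λ n →
  -- This cutoff depends on neither summation index: the row of M ends the sum over k, the column of
  -- P the sum over l. Both can then be finite sums of length `L`, which may be swapped.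
  let L = suc ((i ℕ.+ band M n) ℕ.+ (j ℕ.+ band P n))
      L>i = s≤s (ℕₚ.m≤m+n (i ℕ.+ band M n) (j ℕ.+ band P n))
      L>j = s≤s (ℕₚ.m≤n+m (j ℕ.+ band P n) (i ℕ.+ band M n))
      open ≈[]-Reasoning n
  in begin
  entry ((M ⊡ N) ⊡ P) i j
    ≈⟨ ⊡-Sumʳ (M ⊡ N) P n i j L L>j ⟩
  Sum L (λ l → entry (M ⊡ N) i l ⊗ entry P l j)
    ≈⟨ Sum-cong[] L (λ l → ⊗-cong[] {g = entry P l j} (⊡-Sumˡ M N n i l L L>i) (λ _ _ → refl)) ⟩
  Sum L (λ l → Sum L (λ k → entry M i k ⊗ entry N k l) ⊗ entry P l j)
    ≈⟨ ≈⇒≈[] n (Sum-cong L λ l → ≈-trans (≈-sym (Sum-⊗ʳ (entry P l j) (λ k → entry M i k ⊗ entry N k l) L))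
         (Sum-cong L λ k → ⊗-assoc (entry M i k) (entry N k l) (entry P l j))) ⟩
  Sum L (λ l → Sum L (λ k → entry M i k ⊗ (entry N k l ⊗ entry P l j)))
    ≈⟨ ≈⇒≈[] n (Sum-swap (λ l k → entry M i k ⊗ (entry N k l ⊗ entry P l j)) L L) ⟩
  Sum L (λ k → Sum L (λ l → entry M i k ⊗ (entry N k l ⊗ entry P l j)))
    ≈⟨ ≈⇒≈[] n (Sum-cong L λ k → Sum-⊗ˡ (entry M i k) (λ l → entry N k l ⊗ entry P l j) L) ⟩
  Sum L (λ k → entry M i k ⊗ Sum L (λ l → entry N k l ⊗ entry P l j))
    ≈⟨ Sum-cong[] L (λ k → ⊗-cong[] {f = entry M i k} (λ _ _ → refl) (⊡-Sumʳ N P n k j L L>j)) ⟨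
  Sum L (λ k → entry M i k ⊗ entry (N ⊡ P) k j)
    ≈⟨ ⊡-Sumˡ M (N ⊡ P) n i j L L>i ⟨
  entry (M ⊡ (N ⊡ P)) i j ∎

diagonal : (ℕ → PowerSeries) → AdmissibleMatrix
diagonal d = mkAdmissible e λ n → 0 , off-diagonal n
  where
  e : Matrix
  e i j = if does (i ℕₚ.≟ j) then d j else 0#

  off-diagonal : ∀ n i j → ∣ i - j ∣ > 0 → deg (e i j) > n
  off-diagonal n i j i-j>0
    rewrite dec-false (i ℕₚ.≟ j) (λ i≡j → ℕₚ.<⇒≢ i-j>0 (sym (ℕₚ.m≡n⇒∣m-n∣≡0 i≡j))) = deg-0# n

Sum-select : ∀ L j (f : ℕ → PowerSeries) → j < L →
             Sum L (λ l → if does (l ℕₚ.≟ j) then f l else 0#) ≈ f j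
Sum-select (suc L) zero    f _ = ≈-trans (⊕-cong ≈-refl (Sum-0 L λ _ → ≈-refl)) (⊕-identityʳ (f 0))
Sum-select (suc L) (suc j) f (s≤s j<L) = ≈-trans (⊕-identityˡ _) (Sum-select L j (f ∘ suc) j<L)

⊡-diagonal : ∀ M d i j → entry (M ⊡ diagonal d) i j ≈ entry M i j ⊗ d j
⊡-diagonal M d i j = ≈[]⇒≈ λ n → ≈[]-trans
  (⊡-Sumʳ M (diagonal d) n i j (suc (j ℕ.+ 0)) ℕₚ.≤-refl)
  (≈⇒≈[] n (≈-trans (Sum-cong (suc (j ℕ.+ 0)) term)
    (Sum-select (suc (j ℕ.+ 0)) j (λ l → entry M i l ⊗ d j) (s≤s (ℕₚ.m≤m+n j 0)))))
  where
  term : ∀ l → entry M i l ⊗ entry (diagonal d) l j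
             ≈ (if does (l ℕₚ.≟ j) then entry M i l ⊗ d j else 0#)
  term l with does (l ℕₚ.≟ j)
  ... | true  = ≈-refl
  ... | false = ⊗-zeroʳ (entry M i l)

⊡-identityʳ : ∀ M → M ⊡ I ≅ M
⊡-identityʳ M = mk≅ λ i j → ≈-trans
  (entrywise (⊡-cong (≅-refl {M}) (mk≅ {I} {diagonal (λ _ → 1#)} λ _ _ → ≈-refl)) i j)
  (≈-trans (⊡-diagonal M (λ _ → 1#) i j) (⊗-identityʳ (entry M i j)))

≡ᵇ-sym : ∀ i j → (i ℕ.≡ᵇ j) ≡ (j ℕ.≡ᵇ i)
≡ᵇ-sym zero    zero    = refl
≡ᵇ-sym zero    (suc j) = refl
≡ᵇ-sym (suc i) zero    = refl
≡ᵇ-sym (suc i) (suc j) = ≡ᵇ-sym i j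

⊡-identityˡ : ∀ M → I ⊡ M ≅ M
⊡-identityˡ M = mk≅ λ i j → ≈[]⇒≈ λ n → ≈[]-trans
  (⊡-Sumˡ I M n i j (suc (i ℕ.+ 0)) ℕₚ.≤-refl)
  (≈⇒≈[] n (≈-trans (Sum-cong (suc (i ℕ.+ 0)) (term i j))
    (Sum-select (suc (i ℕ.+ 0)) i (λ l → entry M l j) (s≤s (ℕₚ.m≤m+n i 0)))))
  where
  term : ∀ i j l → entry I i l ⊗ entry M l j ≈ (if does (l ℕₚ.≟ i) then entry M l j else 0#)
  term i j l rewrite ≡ᵇ-sym i l with l ℕ.≡ᵇ i
  ... | true  = ⊗-identityˡ (entry M l j)
  ... | false = ⊗-zeroˡ (entry M l j)

-- Entrywise congruence to I modulo q.
Unitary : AdmissibleMatrix → Set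
Unitary M = ∀ i j → entry M i j 0 ≡ entry I i j 0

far : ∀ a b {x y z} → z > a ℕ.+ b → z ≤ x ℕ.+ y → x > a ⊎ y > b
far a b {x} {y} z> z≤ with x ℕₚ.≤? a
... | no x≰a  = inj₁ (ℕₚ.≰⇒> x≰a)
... | yes x≤a = inj₂ (ℕₚ.+-cancelˡ-< a b y
  (ℕₚ.<-≤-trans z> (ℕₚ.≤-trans z≤ (ℕₚ.+-monoˡ-≤ y x≤a))))

opaque
  unfolding _⊕_

  ⊕-constant : ∀ f g → (f ⊕ g) 0 ≡ f 0 ℤ.+ g 0
  ⊕-constant f g = refl

  ⊖-constant : ∀ f → (⊖ f) 0 ≡ ℤ.- f 0
  ⊖-constant f = refl

-- Inversion of matrices congruent to the identity modulo q

module RightInverse (M : AdmissibleMatrix) (unitary : Unitary M) where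

  deviation : AdmissibleMatrix
  deviation = mkAdmissible (λ i j → entry M i j ⊕ ⊖ entry I i j) λ n →
    suc (band M (suc n)) , λ i j i-j> → ≈[]⇒deg $ ⊕-0[]
      (outside-band M (suc n) i j (ℕₚ.<-trans (ℕₚ.n<1+n _) i-j>))
      (⊖-0[] (outside-band I (suc n) i j (ℕₚ.≤-<-trans z≤n i-j>)))

  deviation-constant : ∀ i j → entry deviation i j 0 ≡ 0ℤ
  deviation-constant i j = begin
    (entry M i j ⊕ ⊖ entry I i j) 0        ≡⟨ ⊕-constant (entry M i j) (⊖ entry I i j) ⟩
    entry M i j 0 ℤ.+ (⊖ entry I i j) 0    ≡⟨ cong₂ ℤ._+_ (unitary i j) (⊖-constant (entry I i j)) ⟩
    entry I i j 0 ℤ.- entry I i j 0        ≡⟨ ℤₚ.+-inverseʳ (entry I i j 0) ⟩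
    0ℤ                                     ∎
    where open ≡-Reasoning

  -- The equation M Y = I in the form Y = I - (M - I) Y, which contracts because q divides M - I.
  step : (ℕ × ℕ → PowerSeries) → ℕ × ℕ → PowerSeries
  step y (i , j) = entry I i j ⊕ ⊖ apply deviation (λ l → y (l , j)) i

  step-contracting : Contracting step
  step-contracting n x y x≈y (i , j) = ⊕-cong[] {f = entry I i j} (λ _ _ → refl) $ ⊖-cong[] $
    let L = suc (i ℕ.+ band deviation (suc n)) in ≈[]-trans
    (apply-Sum deviation (λ l → x (l , j)) (suc n) i L ℕₚ.≤-refl) $ ≈[]-trans
    (Sum-cong[] L λ l → ⊗-gain {f = entry deviation i l} (deviation-constant i l) (x≈y (l , j)))
    (≈[]-sym (apply-Sum deviation (λ l → y (l , j)) (suc n) i L ℕₚ.≤-refl))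

  inverse-entry : Matrix
  inverse-entry i j = fixpoint step (i , j)

  inverse-fixed : ∀ i j →
    inverse-entry i j ≈ entry I i j ⊕ ⊖ apply deviation (λ l → inverse-entry l j) i
  inverse-fixed i j = fixpoint-fixed step-contracting (i , j)

  -- By the triangle inequality, a position farther than k₁ + k₂ from the diagonal leaves two cases
  -- for each summand: the entry of `deviation` lies outside its band, or the entry of the inverse
  -- vanishes to the previous precision and the factor from `deviation` supplies the missing order.
  inverse-band : ∀ n → ∃[ k ] (∀ i j → ∣ i - j ∣ > k → inverse-entry i j ≈[ n ] 0#)
  inverse-band zero = 0 , λ i j _ _ ()
  inverse-band (suc n) = k₁ ℕ.+ k₂ , λ i j i-j> →
    let L = suc (i ℕ.+ k₁) in ≈[]-trans (≈⇒≈[] (suc n) (inverse-fixed i j)) $ ⊕-0[]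
      (outside-band I (suc n) i j (ℕₚ.≤-<-trans z≤n i-j>))
      (⊖-0[] $ ≈[]-trans (apply-Sum deviation (λ l → inverse-entry l j) (suc n) i L ℕₚ.≤-refl) $
        Sum-0[] L λ l → term i j l (far k₁ k₂ i-j> (ℕₚ.∣-∣-triangle i l j)))
    where
    k₁ = band deviation (suc n)
    k₂ = proj₁ (inverse-band n)

    term : ∀ i j l → ∣ i - l ∣ > k₁ ⊎ ∣ l - j ∣ > k₂ →
           entry deviation i l ⊗ inverse-entry l j ≈[ suc n ] 0#
    term i j l (inj₁ p) = ⊗-0ˡ[] (inverse-entry l j) (outside-band deviation (suc n) i l p)
    term i j l (inj₂ p) = ⊗-0-gain {f = entry deviation i l} (deviation-constant i l) (proj₂ (inverse-band n) l j p)

  inverse : AdmissibleMatrix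
  inverse = mkAdmissible inverse-entry λ n →
    proj₁ (inverse-band (suc n)) , λ i j p → ≈[]⇒deg (proj₂ (inverse-band (suc n)) i j p)

  inverseʳ : M ⊡ inverse ≅ I
  inverseʳ = mk≅ λ i j → ≈[]⇒≈ λ n →
    let L  = suc ((i ℕ.+ band deviation n) ℕ.+ (j ℕ.+ band inverse n))
        L>i = s≤s (ℕₚ.m≤m+n (i ℕ.+ band deviation n) (j ℕ.+ band inverse n))
        L>j = s≤s (ℕₚ.m≤n+m (j ℕ.+ band inverse n) (i ℕ.+ band deviation n))
        open ≈[]-Reasoning n
    in begin
    entry (M ⊡ inverse) i j
      ≈⟨ ⊡-Sumʳ M inverse n i j L L>j ⟩
    Sum L (λ l → entry M i l ⊗ inverse-entry l j)
      ≈⟨ ≈⇒≈[] n (Sum-cong L λ l →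
           solve 3 (λ m e y → m :* y := e :* y :+ (m :+ :- e) :* y) ≈-refl
             (entry M i l) (entry I i l) (inverse-entry l j)) ⟩
    Sum L (λ l → entry I i l ⊗ inverse-entry l j ⊕ entry deviation i l ⊗ inverse-entry l j)
      ≈⟨ ≈⇒≈[] n (Sum-⊕ (λ l → entry I i l ⊗ inverse-entry l j) (λ l → entry deviation i l ⊗ inverse-entry l j) L) ⟩
    Sum L (λ l → entry I i l ⊗ inverse-entry l j) ⊕ Sum L (λ l → entry deviation i l ⊗ inverse-entry l j)
      ≈⟨ ⊕-cong[] (⊡-Sumʳ I inverse n i j L L>j)
                  (apply-Sum deviation (λ l → inverse-entry l j) n i L L>i) ⟨
    entry (I ⊡ inverse) i j ⊕ apply deviation (λ l → inverse-entry l j) i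
      ≈⟨ ≈⇒≈[] n (⊕-cong (≈-trans (entrywise (⊡-identityˡ inverse) i j) (inverse-fixed i j)) ≈-refl) ⟩
    (entry I i j ⊕ ⊖ apply deviation (λ l → inverse-entry l j) i)
      ⊕ apply deviation (λ l → inverse-entry l j) i
      ≈⟨ ≈⇒≈[] n (solve 2 (λ e x → (e :+ :- x) :+ x := e) ≈-refl (entry I i j) _) ⟩
    entry I i j ∎

  inverse-unitary : Unitary inverse
  inverse-unitary i j = begin
    inverse-entry i j 0
      ≡⟨ inverse-fixed i j 0 ⟩
    (entry I i j ⊕ ⊖ apply deviation (λ l → inverse-entry l j) i) 0
      ≡⟨ ⊕-constant (entry I i j) _ ⟩
    entry I i j 0 ℤ.+ (⊖ apply deviation (λ l → inverse-entry l j) i) 0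
      ≡⟨ cong (ℤ._+_ (entry I i j 0)) (⊖-0[] apply-constant 0 (s≤s z≤n)) ⟩
    entry I i j 0 ℤ.+ 0ℤ
      ≡⟨ ℤₚ.+-identityʳ _ ⟩
    entry I i j 0 ∎
    where
    open ≡-Reasoning
    apply-constant : apply deviation (λ l → inverse-entry l j) i ≈[ 1 ] 0#
    apply-constant = let L = suc (i ℕ.+ band deviation 1) in ≈[]-trans
      (apply-Sum deviation (λ l → inverse-entry l j) 1 i L ℕₚ.≤-refl)
      (Sum-0[] L λ l → ⊗-0-gain {f = entry deviation i l} {inverse-entry l j} (deviation-constant i l) λ _ ())

-- The contraction yields right inverses only. As the inverse found is again `Unitary`, it has a
-- right inverse Z in turn, and associativity makes it two-sided.
left-inverse : ∀ M Y Z → M ⊡ Y ≅ I → Y ⊡ Z ≅ I → Y ⊡ M ≅ I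
left-inverse M Y Z MY≅I YZ≅I = begin
  Y ⊡ M              ≈⟨ ⊡-cong ≅-refl (⊡-identityʳ M) ⟨
  Y ⊡ (M ⊡ I)        ≈⟨ ⊡-cong ≅-refl (⊡-cong ≅-refl YZ≅I) ⟨
  Y ⊡ (M ⊡ (Y ⊡ Z))  ≈⟨ ⊡-cong ≅-refl (⊡-assoc M Y Z) ⟨
  Y ⊡ ((M ⊡ Y) ⊡ Z)  ≈⟨ ⊡-cong ≅-refl (⊡-cong MY≅I ≅-refl) ⟩
  Y ⊡ (I ⊡ Z)        ≈⟨ ⊡-cong ≅-refl (⊡-identityˡ Z) ⟩
  Y ⊡ Z              ≈⟨ YZ≅I ⟩
  I                  ∎
  where open ≅-Reasoning

Invertibleᵒ : AdmissibleMatrix → Set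
Invertibleᵒ M = ∃[ Y ] (M ⊡ Y ≅ I × Y ⊡ M ≅ I)

RightInvertible : AdmissibleMatrix → Set
RightInvertible M = ∃[ Y ] (M ⊡ Y ≅ I × Unitary Y)

opaque

  unitary⇒rightInvertible : ∀ M → Unitary M → RightInvertible M
  unitary⇒rightInvertible M u =
    RightInverse.inverse M u , RightInverse.inverseʳ M u , RightInverse.inverse-unitary M u

right⇒two-sided : ∀ M → (∀ Y → Unitary Y → RightInvertible Y) → RightInvertible M → Invertibleᵒ M
right⇒two-sided M invert (Y , MY≅I , unitary) =
  let Z , YZ≅I , _ = invert Y unitary in Y , MY≅I , left-inverse M Y Z MY≅I YZ≅I

unitary⇒invertible : ∀ M → Unitary M → Invertibleᵒ M
unitary⇒invertible M u = right⇒two-sided M unitary⇒rightInvertible (unitary⇒rightInvertible M u)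

-- The relations between A, E and M

Vector : Set
Vector = ℕ → PowerSeries

infix 4 _≈ⱽ_
_≈ⱽ_ : Vector → Vector → Set
x ≈ⱽ y = ∀ i → x i ≈ y i

mono-constant : ∀ {e} → e > 0 → mono e 0 ≡ 0ℤ
mono-constant e>0 = mono-high e>0 0 (s≤s z≤n)

mono-cong : ∀ {d e} → d ≡ e → mono d ≈ mono e
mono-cong d≡e = ≈-reflexive (cong mono d≡e)

mono-⊗-⊗ : ∀ d e {s} f → d ℕ.+ e ≡ s → mono d ⊗ (mono e ⊗ f) ≈ mono s ⊗ f
mono-⊗-⊗ d e {s} f p = ≈-trans (≈-sym (⊗-assoc (mono d) (mono e) f))
  (⊗-cong (≈-trans (mono-⊗ d e) (mono-cong p)) ≈-refl)

α β : Vector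
α l = 1# ⊕ ⊖ mono (16 ℕ.* suc l)
β l = mono 4 ⊗ (1# ⊕ ⊖ mono (8 ℕ.+ 16 ℕ.* l))

β-constant : ∀ l → β l 0 ≡ 0ℤ
β-constant l = ⊗-0ˡ[] {1} (1# ⊕ ⊖ mono (8 ℕ.+ 16 ℕ.* l)) (mono-high (s≤s z≤n)) 0 (s≤s z≤n)

-- H is G minus the identity, with a factor of positive order in every term.
E Eᵀ G H : Vector → Vector
E y zero    = ⊖ (β 0 ⊗ y 0)
E y (suc i) = α i ⊗ y i ⊕ ⊖ (β (suc i) ⊗ y (suc i))
Eᵀ y l = α l ⊗ y (suc l) ⊕ ⊖ (β l ⊗ y l)
G y = Eᵀ (E y)
H y l = ⊖ (mono (16 ℕ.* suc l) ⊗ (α l ⊗ y l ⊕ y l))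
      ⊕ ⊖ (β (suc l) ⊗ (α l ⊗ y (suc l))) ⊕ ⊖ (β l ⊗ E y l)

-- With Q = q^(16(l+1)) one has α² = 1 - Q(α + 1); the other terms of `G` carry a factor β, which q
-- divides.
G-H : ∀ y l → G y l ≈ y l ⊕ H y l
G-H y l = solve 6
  (λ Q b′ y₀ y₁ b e → let al = con (+ 1) :- Q in
     al :* (al :* y₀ :+ :- (b′ :* y₁)) :+ :- (b :* e)
     := y₀ :+ (:- (Q :* (al :* y₀ :+ y₀)) :+ :- (b′ :* (al :* y₁)) :+ :- (b :* e)))
  ≈-refl (mono (16 ℕ.* suc l)) (β (suc l)) (y l) (y (suc l)) (β l) (E y l)

E-cong[] : ∀ {n} x y → (∀ i → x i ≈[ n ] y i) → ∀ i → E x i ≈[ n ] E y i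
E-cong[] x y p zero    = ⊖-cong[] (⊗-cong[] {f = β 0} (λ _ _ → refl) (p 0))
E-cong[] x y p (suc i) = ⊕-cong[]
  (⊗-cong[] {f = α i} (λ _ _ → refl) (p i))
  (⊖-cong[] (⊗-cong[] {f = β (suc i)} (λ _ _ → refl) (p (suc i))))

E-cong : ∀ x y → x ≈ⱽ y → E x ≈ⱽ E y
E-cong x y p i = ≈[]⇒≈ λ n → E-cong[] x y (λ j → ≈⇒≈[] n (p j)) i

Eᵀ-cong : ∀ x y → x ≈ⱽ y → Eᵀ x ≈ⱽ Eᵀ y
Eᵀ-cong x y p l = ⊕-cong (⊗-cong ≈-refl (p (suc l))) (⊖-cong (⊗-cong ≈-refl (p l)))

Eᵀ-cong[] : ∀ {n} x y → (∀ i → x i ≈[ n ] y i) → ∀ i → Eᵀ x i ≈[ n ] Eᵀ y i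
Eᵀ-cong[] x y p l = ⊕-cong[]
  (⊗-cong[] {f = α l} (λ _ _ → refl) (p (suc l)))
  (⊖-cong[] (⊗-cong[] {f = β l} (λ _ _ → refl) (p l)))

H-gain : ∀ {n} x y → (∀ i → x i ≈[ n ] y i) → ∀ l → H x l ≈[ suc n ] H y l
H-gain x y p l = ⊕-cong[] (⊕-cong[]
  (⊖-cong[] (⊗-gain (mono-constant (s≤s z≤n))
    (⊕-cong[] (⊗-cong[] {f = α l} (λ _ _ → refl) (p l)) (p l))))
  (⊖-cong[] (⊗-gain (β-constant (suc l)) (⊗-cong[] {f = α l} (λ _ _ → refl) (p (suc l))))))
  (⊖-cong[] (⊗-gain (β-constant l) (E-cong[] x y p l)))

-- The pointwise form of `H-gain`, for estimates that hold only near l. Asking about `E y l` instead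
-- of the entry before l spares a case for l = 0.
H-local : ∀ {n} y l → y l ≈[ n ] 0# → y (suc l) ≈[ n ] 0# → E y l ≈[ n ] 0# → H y l ≈[ suc n ] 0#
H-local y l p q r = ⊕-0[] (⊕-0[]
  (⊖-0[] (⊗-0-gain (mono-constant (s≤s z≤n)) (⊕-0[] (⊗-0ʳ[] (α l) p) p)))
  (⊖-0[] (⊗-0-gain (β-constant (suc l)) (⊗-0ʳ[] (α l) q))))
  (⊖-0[] (⊗-0-gain (β-constant l) r))

H-constant : ∀ y l → H y l 0 ≡ 0ℤ
H-constant y l = H-local {0} y l (λ _ ()) (λ _ ()) (λ _ ()) 0 (s≤s z≤n)

E-⊕-⊗ : ∀ x c y i → E (λ j → x j ⊕ c ⊗ y j) i ≈ E x i ⊕ c ⊗ E y i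
E-⊕-⊗ x c y zero = solve 4
  (λ b x c y → :- (b :* (x :+ c :* y)) := :- (b :* x) :+ c :* (:- (b :* y)))
  ≈-refl (β 0) (x 0) c (y 0)
E-⊕-⊗ x c y (suc i) = solve 7
  (λ a b x₀ x₁ c y₀ y₁ → a :* (x₀ :+ c :* y₀) :+ :- (b :* (x₁ :+ c :* y₁))
     := (a :* x₀ :+ :- (b :* x₁)) :+ c :* (a :* y₀ :+ :- (b :* y₁)))
  ≈-refl (α i) (β (suc i)) (x i) (x (suc i)) c (y i) (y (suc i))

Eᵀ-⊕-⊗ : ∀ x c y i → Eᵀ (λ j → x j ⊕ c ⊗ y j) i ≈ Eᵀ x i ⊕ c ⊗ Eᵀ y i
Eᵀ-⊕-⊗ x c y i = solve 7
  (λ a b x₀ x₁ c y₀ y₁ → a :* (x₁ :+ c :* y₁) :+ :- (b :* (x₀ :+ c :* y₀))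
     := (a :* x₁ :+ :- (b :* x₀)) :+ c :* (a :* y₁ :+ :- (b :* y₀)))
  ≈-refl (α i) (β i) (x i) (x (suc i)) c (y i) (y (suc i))

G-⊕-⊗ : ∀ x c y i → G (λ j → x j ⊕ c ⊗ y j) i ≈ G x i ⊕ c ⊗ G y i
G-⊕-⊗ x c y i = ≈-trans (Eᵀ-cong _ (λ j → E x j ⊕ c ⊗ E y j) (E-⊕-⊗ x c y) i) (Eᵀ-⊕-⊗ (E x) c (E y) i)

Eᵀ-⊖ : ∀ y i → Eᵀ (λ j → ⊖ y j) i ≈ ⊖ Eᵀ y i
Eᵀ-⊖ y i = solve 4
  (λ a b y₀ y₁ → a :* :- y₁ :+ :- (b :* :- y₀) := :- (a :* y₁ :+ :- (b :* y₀)))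
  ≈-refl (α i) (β i) (y i) (y (suc i))

-- Summation by parts: E and Eᵀ are adjoint, and cutting the bidiagonal sum leaves a single boundary
-- term.
by-parts-Sum : ∀ x y L → Sum (suc L) (λ j → x j ⊗ E y j)
                       ≈ Sum L (λ l → Eᵀ x l ⊗ y l) ⊕ ⊖ (x L ⊗ (β L ⊗ y L))
by-parts-Sum x y zero = solve 3
  (λ x b y → x :* :- (b :* y) :+ con (+ 0) := con (+ 0) :+ :- (x :* (b :* y)))
  ≈-refl (x 0) (β 0) (y 0)
by-parts-Sum x y (suc L) = begin
  Sum (suc (suc L)) (λ j → x j ⊗ E y j)
    ≈⟨ Sum-snoc (λ j → x j ⊗ E y j) (suc L) ⟩
  Sum (suc L) (λ j → x j ⊗ E y j) ⊕ x (suc L) ⊗ E y (suc L)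
    ≈⟨ ⊕-cong (by-parts-Sum x y L) ≈-refl ⟩
  (Sum L (λ l → Eᵀ x l ⊗ y l) ⊕ ⊖ (x L ⊗ (β L ⊗ y L))) ⊕ x (suc L) ⊗ E y (suc L)
    ≈⟨ solve 8 (λ s x₀ b₀ y₀ x₁ a b₁ y₁ →
         (s :+ :- (x₀ :* (b₀ :* y₀))) :+ x₁ :* (a :* y₀ :+ :- (b₁ :* y₁))
         := (s :+ (a :* x₁ :+ :- (b₀ :* x₀)) :* y₀) :+ :- (x₁ :* (b₁ :* y₁)))
       ≈-refl _ (x L) (β L) (y L) (x (suc L)) (α L) (β (suc L)) (y (suc L)) ⟩
  (Sum L (λ l → Eᵀ x l ⊗ y l) ⊕ Eᵀ x L ⊗ y L) ⊕ ⊖ (x (suc L) ⊗ (β (suc L) ⊗ y (suc L)))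
    ≈⟨ ⊕-cong (Sum-snoc (λ l → Eᵀ x l ⊗ y l) L) ≈-refl ⟨
  Sum (suc L) (λ l → Eᵀ x l ⊗ y l) ⊕ ⊖ (x (suc L) ⊗ (β (suc L) ⊗ y (suc L))) ∎
  where open ≈-Reasoning

by-parts : ∀ x y → Decay (λ j → x j ⊗ E y j) → Decay (λ l → Eᵀ x l ⊗ y l) →
           Decay (λ l → x l ⊗ (β l ⊗ y l)) →
           Series (λ j → x j ⊗ E y j) ≈ Series (λ l → Eᵀ x l ⊗ y l)
by-parts x y d₁ d₂ d₃ = ≈[]⇒≈ λ n → let open ≈[]-Reasoning n in begin
  Series (λ j → x j ⊗ E y j)                               ≈⟨ Series-Sum′ d₁ (suc n) (ℕₚ.n≤1+n n) ⟩
  Sum (suc n) (λ j → x j ⊗ E y j)                          ≈⟨ ≈⇒≈[] n (by-parts-Sum x y n) ⟩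
  Sum n (λ l → Eᵀ x l ⊗ y l) ⊕ ⊖ (x n ⊗ (β n ⊗ y n))       ≈⟨ ⊕-cong[] {f = Sum n (λ l → Eᵀ x l ⊗ y l)} (λ _ _ → refl) (⊖-0[] (d₃ n)) ⟩
  Sum n (λ l → Eᵀ x l ⊗ y l) ⊕ 0#                          ≈⟨ ≈⇒≈[] n (⊕-identityʳ _) ⟩
  Sum n (λ l → Eᵀ x l ⊗ y l)                               ≈⟨ Series-Sum d₂ n ⟨
  Series (λ l → Eᵀ x l ⊗ y l)                              ∎

-- Infinite matrices with decaying rows, and the intertwining relations

Kernel : Set
Kernel = ℕ → ℕ → PowerSeries

⟪_⟫ : Kernel → Vector → Vector
⟪ K ⟫ y i = Series (λ j → K i j ⊗ y j)

Decaying : Kernel → Set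
Decaying K = ∀ i → Decay (K i)

⟪⟫-cong : ∀ K x y → x ≈ⱽ y → ⟪ K ⟫ x ≈ⱽ ⟪ K ⟫ y
⟪⟫-cong K x y p i = Series-cong λ j → ⊗-cong (≈-refl {K i j}) (p j)

⟪⟫-scale : ∀ K → Decaying K → ∀ c y i → ⟪ K ⟫ (λ j → c ⊗ y j) i ≈ c ⊗ ⟪ K ⟫ y i
⟪⟫-scale K d c y i = ≈-trans
  (Series-cong λ j → solve 3 (λ k c y → k :* (c :* y) := c :* (k :* y)) ≈-refl (K i j) c (y j))
  (Series-⊗ˡ c (Decay-⊗ˡ y (d i)))

E-⟪⟫ : ∀ K → Decaying K → ∀ y i → E (⟪ K ⟫ y) i ≈ ⟪ (λ i j → E (λ l → K l j) i) ⟫ y i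
E-⟪⟫ K d y zero = ≈-sym (≈-trans
  (Series-cong λ j → solve 3 (λ b k y → :- (b :* k) :* y := :- (b :* (k :* y))) ≈-refl (β 0) (K 0 j) (y j))
  (≈-trans (Series-⊖ (λ j → β 0 ⊗ (K 0 j ⊗ y j))) (⊖-cong (Series-⊗ˡ (β 0) (Decay-⊗ˡ y (d 0))))))
E-⟪⟫ K d y (suc i) = ≈-sym (≈-trans
  (Series-cong λ j → solve 5 (λ a k₀ b k₁ y → (a :* k₀ :+ :- (b :* k₁)) :* y := a :* (k₀ :* y) :+ :- (b :* (k₁ :* y)))
    ≈-refl (α i) (K i j) (β (suc i)) (K (suc i) j) (y j))
  (≈-trans (Series-⊕ (λ j → α i ⊗ (K i j ⊗ y j)) (λ j → ⊖ (β (suc i) ⊗ (K (suc i) j ⊗ y j))))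
  (⊕-cong (Series-⊗ˡ (α i) (Decay-⊗ˡ y (d i)))
    (≈-trans (Series-⊖ (λ j → β (suc i) ⊗ (K (suc i) j ⊗ y j)))
      (⊖-cong (Series-⊗ˡ (β (suc i)) (Decay-⊗ˡ y (d (suc i)))))))))

Eᵀ-⟪⟫ : ∀ K → Decaying K → ∀ y i → Eᵀ (⟪ K ⟫ y) i ≈ ⟪ (λ i j → Eᵀ (λ l → K l j) i) ⟫ y i
Eᵀ-⟪⟫ K d y i = ≈-sym (≈-trans
  (Series-cong λ j → solve 5 (λ a k₁ b k₀ y → (a :* k₁ :+ :- (b :* k₀)) :* y := a :* (k₁ :* y) :+ :- (b :* (k₀ :* y)))
    ≈-refl (α i) (K (suc i) j) (β i) (K i j) (y j))
  (≈-trans (Series-⊕ (λ j → α i ⊗ (K (suc i) j ⊗ y j)) (λ j → ⊖ (β i ⊗ (K i j ⊗ y j))))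
  (⊕-cong (Series-⊗ˡ (α i) (Decay-⊗ˡ y (d (suc i))))
    (≈-trans (Series-⊖ (λ j → β i ⊗ (K i j ⊗ y j)))
      (⊖-cong (Series-⊗ˡ (β i) (Decay-⊗ˡ y (d i))))))))

-- The entries of −B and −M, whose signs are dropped here, are 𝐁 and 𝐌; the
-- indices of 𝐁 start at the second row and column of B.
aᵉ bᵉ mᵉ : ℕ → ℕ → ℕ
aᵉ i j = (4 ℕ.* i ℕ.+ 1) ℕ.* (4 ℕ.* j ℕ.+ 1)
bᵉ i j = 9 ℕ.+ 12 ℕ.* i ℕ.+ 12 ℕ.* j ℕ.+ 16 ℕ.* (i ℕ.* j)
mᵉ i j = 9 ℕ.+ 4 ℕ.* i ℕ.+ 20 ℕ.* j ℕ.+ 16 ℕ.* (i ℕ.* j)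

𝐀 𝐌 𝐌ᵀ 𝐁 : Kernel
𝐀 i j = mono (aᵉ i j)
𝐁 i j = mono (bᵉ i j)
𝐌 i j = mono (mᵉ i j)
𝐌ᵀ i j = 𝐌 j i

aᵉ-comm : ∀ i j → aᵉ i j ≡ aᵉ j i
aᵉ-comm i j = ℕₚ.*-comm (4 ℕ.* i ℕ.+ 1) (4 ℕ.* j ℕ.+ 1)

mono-α : ∀ l e → α l ⊗ mono e ≈ mono e ⊕ ⊖ mono (16 ℕ.* suc l ℕ.+ e)
mono-α l e = ≈-trans
  (solve 2 (λ Q x → (con (+ 1) :- Q) :* x := x :+ :- (Q :* x)) ≈-refl (mono (16 ℕ.* suc l)) (mono e))
  (⊕-cong ≈-refl (⊖-cong (mono-⊗ (16 ℕ.* suc l) e)))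

mono-β : ∀ l e → β l ⊗ mono e ≈ mono (4 ℕ.+ e) ⊕ ⊖ mono (12 ℕ.+ 16 ℕ.* l ℕ.+ e)
mono-β l e = ≈-trans
  (solve 3 (λ f Q x → (f :* (con (+ 1) :- Q)) :* x := f :* x :+ :- (f :* (Q :* x))) ≈-refl
    (mono 4) (mono (8 ℕ.+ 16 ℕ.* l)) (mono e))
  (⊕-cong (mono-⊗ 4 e) (⊖-cong (≈-trans (mono-⊗-⊗ 4 (8 ℕ.+ 16 ℕ.* l) (mono e) refl) (mono-⊗ (12 ℕ.+ 16 ℕ.* l) e))))

-- Entry (i, l) of A E = E M. Both sides expand into four signed monomials, and `e₁` to `e₄` match
-- them across: for instance the plain α-term on the left is the Q-term of α on the right, and the
-- plain β-term on the left is the plain α-term on the right.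
Eᵀ𝐀≈⊖E𝐌 : ∀ i l → Eᵀ (λ j → 𝐀 i j) l ≈ ⊖ E (λ j → 𝐌 j l) i
Eᵀ𝐀≈⊖E𝐌 zero l = begin
  α l ⊗ mono (aᵉ 0 (suc l)) ⊕ ⊖ (β l ⊗ mono (aᵉ 0 l))
    ≈⟨ ⊕-cong (mono-α l _) (⊖-cong (mono-β l _)) ⟩
  (mono (aᵉ 0 (suc l)) ⊕ ⊖ mono (16 ℕ.* suc l ℕ.+ aᵉ 0 (suc l)))
    ⊕ ⊖ (mono (4 ℕ.+ aᵉ 0 l) ⊕ ⊖ mono (12 ℕ.+ 16 ℕ.* l ℕ.+ aᵉ 0 l))
    -- Row 0 of E has no α-term; correspondingly the two plain monomials on the left coincide and
    -- cancel.
    ≈⟨ ⊕-cong (⊕-cong (mono-cong (e₁ l)) (⊖-cong (mono-cong (e₂ l))))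
              (⊖-cong (⊕-cong ≈-refl (⊖-cong (mono-cong (e₃ l))))) ⟩
  (mono (4 ℕ.+ aᵉ 0 l) ⊕ ⊖ mono (12 ℕ.+ 16 ℕ.* 0 ℕ.+ mᵉ 0 l))
    ⊕ ⊖ (mono (4 ℕ.+ aᵉ 0 l) ⊕ ⊖ mono (4 ℕ.+ mᵉ 0 l))
    ≈⟨ solve 3 (λ x y z → (x :+ :- y) :+ :- (x :+ :- z) := :- (:- (z :+ :- y))) ≈-refl _ _ _ ⟩
  ⊖ (⊖ (mono (4 ℕ.+ mᵉ 0 l) ⊕ ⊖ mono (12 ℕ.+ 16 ℕ.* 0 ℕ.+ mᵉ 0 l)))
    ≈⟨ ⊖-cong (⊖-cong (mono-β 0 (mᵉ 0 l))) ⟨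
  ⊖ (⊖ (β 0 ⊗ mono (mᵉ 0 l))) ∎
  where
  open ≈-Reasoning
  e₁ : ∀ l → (4 ℕ.* 0 ℕ.+ 1) ℕ.* (4 ℕ.* suc l ℕ.+ 1) ≡ 4 ℕ.+ (4 ℕ.* 0 ℕ.+ 1) ℕ.* (4 ℕ.* l ℕ.+ 1)
  e₁ = ℕSolver.solve-∀
  e₂ : ∀ l → 16 ℕ.* suc l ℕ.+ (4 ℕ.* 0 ℕ.+ 1) ℕ.* (4 ℕ.* suc l ℕ.+ 1)
           ≡ 12 ℕ.+ 16 ℕ.* 0 ℕ.+ (9 ℕ.+ 4 ℕ.* 0 ℕ.+ 20 ℕ.* l ℕ.+ 16 ℕ.* (0 ℕ.* l))
  e₂ = ℕSolver.solve-∀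
  e₃ : ∀ l → 12 ℕ.+ 16 ℕ.* l ℕ.+ (4 ℕ.* 0 ℕ.+ 1) ℕ.* (4 ℕ.* l ℕ.+ 1)
           ≡ 4 ℕ.+ (9 ℕ.+ 4 ℕ.* 0 ℕ.+ 20 ℕ.* l ℕ.+ 16 ℕ.* (0 ℕ.* l))
  e₃ = ℕSolver.solve-∀
Eᵀ𝐀≈⊖E𝐌 (suc i) l = begin
  α l ⊗ mono x₁ ⊕ ⊖ (β l ⊗ mono x₂)
    ≈⟨ ⊕-cong (mono-α l x₁) (⊖-cong (mono-β l x₂)) ⟩
  (mono x₁ ⊕ ⊖ mono (16 ℕ.* suc l ℕ.+ x₁)) ⊕ ⊖ (mono (4 ℕ.+ x₂) ⊕ ⊖ mono (12 ℕ.+ 16 ℕ.* l ℕ.+ x₂))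
    ≈⟨ ⊕-cong (⊕-cong (mono-cong (e₁ i l)) (⊖-cong (mono-cong (e₂ i l))))
              (⊖-cong (⊕-cong (mono-cong (e₃ i l)) (⊖-cong (mono-cong (e₄ i l))))) ⟩
  (mono (16 ℕ.* suc i ℕ.+ n₁) ⊕ ⊖ mono (12 ℕ.+ 16 ℕ.* suc i ℕ.+ n₂)) ⊕ ⊖ (mono n₁ ⊕ ⊖ mono (4 ℕ.+ n₂))
    ≈⟨ solve 4 (λ x y z u → (x :+ :- y) :+ :- (z :+ :- u) := :- ((z :+ :- x) :+ :- (u :+ :- y))) ≈-refl _ _ _ _ ⟩
  ⊖ ((mono n₁ ⊕ ⊖ mono (16 ℕ.* suc i ℕ.+ n₁)) ⊕ ⊖ (mono (4 ℕ.+ n₂) ⊕ ⊖ mono (12 ℕ.+ 16 ℕ.* suc i ℕ.+ n₂)))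
    ≈⟨ ⊖-cong (⊕-cong (mono-α i n₁) (⊖-cong (mono-β (suc i) n₂))) ⟨
  ⊖ (α i ⊗ mono n₁ ⊕ ⊖ (β (suc i) ⊗ mono n₂)) ∎
  where
  open ≈-Reasoning
  x₁ = aᵉ (suc i) (suc l)
  x₂ = aᵉ (suc i) l
  n₁ = mᵉ i l
  n₂ = mᵉ (suc i) l
  e₁ : ∀ i l → (4 ℕ.* suc i ℕ.+ 1) ℕ.* (4 ℕ.* suc l ℕ.+ 1)
             ≡ 16 ℕ.* suc i ℕ.+ (9 ℕ.+ 4 ℕ.* i ℕ.+ 20 ℕ.* l ℕ.+ 16 ℕ.* (i ℕ.* l))
  e₁ = ℕSolver.solve-∀
  e₂ : ∀ i l → 16 ℕ.* suc l ℕ.+ (4 ℕ.* suc i ℕ.+ 1) ℕ.* (4 ℕ.* suc l ℕ.+ 1)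
             ≡ 12 ℕ.+ 16 ℕ.* suc i ℕ.+ (9 ℕ.+ 4 ℕ.* suc i ℕ.+ 20 ℕ.* l ℕ.+ 16 ℕ.* (suc i ℕ.* l))
  e₂ = ℕSolver.solve-∀
  e₃ : ∀ i l → 4 ℕ.+ (4 ℕ.* suc i ℕ.+ 1) ℕ.* (4 ℕ.* l ℕ.+ 1)
             ≡ 9 ℕ.+ 4 ℕ.* i ℕ.+ 20 ℕ.* l ℕ.+ 16 ℕ.* (i ℕ.* l)
  e₃ = ℕSolver.solve-∀
  e₄ : ∀ i l → 12 ℕ.+ 16 ℕ.* l ℕ.+ (4 ℕ.* suc i ℕ.+ 1) ℕ.* (4 ℕ.* l ℕ.+ 1)
             ≡ 4 ℕ.+ (9 ℕ.+ 4 ℕ.* suc i ℕ.+ 20 ℕ.* l ℕ.+ 16 ℕ.* (suc i ℕ.* l))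
  e₄ = ℕSolver.solve-∀

𝐀-decay : Decaying 𝐀
𝐀-decay i j = mono-high (ℕₚ.≤-trans (ℕₚ.m≤n*m j 4) (ℕₚ.≤-trans (ℕₚ.m≤m+n (4 ℕ.* j) 1)
  (subst (λ d → 4 ℕ.* j ℕ.+ 1 ≤ d ℕ.* (4 ℕ.* j ℕ.+ 1)) (ℕₚ.+-comm 1 (4 ℕ.* i))
    (ℕₚ.m≤n*m (4 ℕ.* j ℕ.+ 1) (1 ℕ.+ 4 ℕ.* i)))))

≤-linear : ∀ c .{{_ : ℕ.NonZero c}} d j e → j ≤ d ℕ.+ c ℕ.* j ℕ.+ e
≤-linear c d j e = ℕₚ.≤-trans (ℕₚ.m≤n*m j c) (ℕₚ.≤-trans (ℕₚ.m≤n+m (c ℕ.* j) d) (ℕₚ.m≤m+n _ e))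

𝐌-decay : Decaying 𝐌
𝐌-decay i j = mono-high (≤-linear 20 (9 ℕ.+ 4 ℕ.* i) j (16 ℕ.* (i ℕ.* j)))

𝐁-decay : Decaying 𝐁
𝐁-decay i j = mono-high (≤-linear 12 (9 ℕ.+ 12 ℕ.* i) j (16 ℕ.* (i ℕ.* j)))

𝐌ᵀ-decay : Decaying 𝐌ᵀ
𝐌ᵀ-decay i j = mono-high (ℕₚ.≤-trans (≤-linear 4 9 j (20 ℕ.* i)) (ℕₚ.m≤m+n _ (16 ℕ.* (j ℕ.* i))))

E𝐌≈⊖Eᵀ𝐀 : ∀ i l → E (λ j → 𝐌 j l) i ≈ ⊖ Eᵀ (λ j → 𝐀 j i) l
E𝐌≈⊖Eᵀ𝐀 i l = begin
  E (λ j → 𝐌 j l) i          ≈⟨ solve 1 (λ x → x := :- (:- x)) ≈-refl _ ⟩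
  ⊖ (⊖ E (λ j → 𝐌 j l) i)    ≈⟨ ⊖-cong (Eᵀ𝐀≈⊖E𝐌 i l) ⟨
  ⊖ Eᵀ (λ j → 𝐀 i j) l       ≈⟨ ⊖-cong (Eᵀ-cong (λ j → 𝐀 i j) (λ j → 𝐀 j i) (λ j → mono-cong (aᵉ-comm i j)) l) ⟩
  ⊖ Eᵀ (λ j → 𝐀 j i) l       ∎
  where open ≈-Reasoning

E𝐌-decay : ∀ l → Decay (E (λ j → 𝐌 j l))
E𝐌-decay l i = ≈[]-trans (≈⇒≈[] i (E𝐌≈⊖Eᵀ𝐀 i l)) (⊖-0[] (⊕-0[]
  (⊗-0ʳ[] (α l) (aᵉ-high (suc l))) (⊖-0[] (⊗-0ʳ[] (β l) (aᵉ-high l)))))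
  where
  aᵉ-high : ∀ j → 𝐀 j i ≈[ i ] 0#
  aᵉ-high j = 𝐀-decay j i

⟪⟫-⊖ : ∀ {K L : Kernel} → (∀ i j → K i j ≈ ⊖ L i j) → ∀ y i → ⟪ K ⟫ y i ≈ ⊖ ⟪ L ⟫ y i
⟪⟫-⊖ {K} {L} p y i = ≈-trans
  (Series-cong λ j → ≈-trans (⊗-cong (p i j) (≈-refl {y j}))
    (solve 2 (λ k y → :- k :* y := :- (k :* y)) ≈-refl (L i j) (y j)))
  (Series-⊖ (λ j → L i j ⊗ y j))

𝐀E≈⊖E𝐌 : ∀ y → ⟪ 𝐀 ⟫ (E y) ≈ⱽ (λ i → ⊖ E (⟪ 𝐌 ⟫ y) i)
𝐀E≈⊖E𝐌 y i = begin
  ⟪ 𝐀 ⟫ (E y) i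
    ≈⟨ by-parts (𝐀 i) y (Decay-⊗ˡ (E y) (𝐀-decay i))
         (Decay-⊗ˡ y λ l → ⊕-0[] (⊗-0ʳ[] (α l) (≈[]-mono (ℕₚ.n≤1+n l) (𝐀-decay i (suc l))))
                                 (⊖-0[] (⊗-0ʳ[] (β l) (𝐀-decay i l))))
         (Decay-⊗ˡ (λ l → β l ⊗ y l) (𝐀-decay i)) ⟩
  ⟪ (λ i l → Eᵀ (𝐀 i) l) ⟫ y i
    ≈⟨ ⟪⟫-⊖ Eᵀ𝐀≈⊖E𝐌 y i ⟩
  ⊖ ⟪ (λ i l → E (λ j → 𝐌 j l) i) ⟫ y i
    ≈⟨ ⊖-cong (E-⟪⟫ 𝐌 𝐌-decay y i) ⟨
  ⊖ E (⟪ 𝐌 ⟫ y) i ∎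
  where open ≈-Reasoning

Eᵀ𝐀≈⊖𝐌ᵀEᵀ : ∀ y → Eᵀ (⟪ 𝐀 ⟫ y) ≈ⱽ (λ l → ⊖ ⟪ 𝐌ᵀ ⟫ (Eᵀ y) l)
Eᵀ𝐀≈⊖𝐌ᵀEᵀ y l = begin
  Eᵀ (⟪ 𝐀 ⟫ y) l
    ≈⟨ Eᵀ-⟪⟫ 𝐀 𝐀-decay y l ⟩
  ⟪ (λ l j → Eᵀ (λ i → 𝐀 i j) l) ⟫ y l
    ≈⟨ ⟪⟫-⊖ (λ l j → ≈-trans (solve 1 (λ x → x := :- (:- x)) ≈-refl _) (⊖-cong (≈-sym (E𝐌≈⊖Eᵀ𝐀 j l)))) y l ⟩
  ⊖ ⟪ (λ l j → E (λ k → 𝐌 k l) j) ⟫ y l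
    ≈⟨ ⊖-cong (Series-cong λ j → ⊗-comm (E (λ k → 𝐌 k l) j) (y j)) ⟩
  ⊖ Series (λ j → y j ⊗ E (λ k → 𝐌 k l) j)
    ≈⟨ ⊖-cong (by-parts y (λ k → 𝐌 k l)
         (λ j → ⊗-0ʳ[] (y j) (E𝐌-decay l j))
         (λ k → ⊗-0ʳ[] (Eᵀ y k) (𝐌ᵀ-decay l k))
         (λ k → ⊗-0ʳ[] (y k) (⊗-0ʳ[] (β k) (𝐌ᵀ-decay l k)))) ⟩
  ⊖ Series (λ k → Eᵀ y k ⊗ 𝐌 k l)
    ≈⟨ ⊖-cong (Series-cong λ k → ⊗-comm (Eᵀ y k) (𝐌 k l)) ⟩
  ⊖ ⟪ 𝐌ᵀ ⟫ (Eᵀ y) l ∎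
  where open ≈-Reasoning

G𝐌≈𝐌ᵀG : ∀ y → G (⟪ 𝐌 ⟫ y) ≈ⱽ ⟪ 𝐌ᵀ ⟫ (G y)
G𝐌≈𝐌ᵀG y l = begin
  Eᵀ (E (⟪ 𝐌 ⟫ y)) l
    ≈⟨ Eᵀ-cong _ (λ i → ⊖ ⟪ 𝐀 ⟫ (E y) i)
         (λ i → ≈-trans (solve 1 (λ x → x := :- (:- x)) ≈-refl _) (⊖-cong (≈-sym (𝐀E≈⊖E𝐌 y i)))) l ⟩
  Eᵀ (λ i → ⊖ ⟪ 𝐀 ⟫ (E y) i) l
    ≈⟨ Eᵀ-⊖ (⟪ 𝐀 ⟫ (E y)) l ⟩
  ⊖ Eᵀ (⟪ 𝐀 ⟫ (E y)) l
    ≈⟨ ⊖-cong (Eᵀ𝐀≈⊖𝐌ᵀEᵀ (E y) l) ⟩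
  ⊖ (⊖ ⟪ 𝐌ᵀ ⟫ (G y) l)
    ≈⟨ solve 1 (λ x → :- (:- x) := x) ≈-refl _ ⟩
  ⟪ 𝐌ᵀ ⟫ (G y) l ∎
  where open ≈-Reasoning

-- The kernel equation α y₁ = β y₀ with α = 1 - Q, rewritten as y₁ = Q y₁ + β y₀ so that nothing is
-- divided by α. The first entry is normalised to 1.
v-step : Vector → Vector
v-step y zero    = 1#
v-step y (suc i) = mono (16 ℕ.* suc i) ⊗ y (suc i) ⊕ β i ⊗ y i

v-step-contracting : Contracting v-step
v-step-contracting n x y p zero    = λ _ _ → refl
v-step-contracting n x y p (suc i) =
  ⊕-cong[] (⊗-gain (mono-constant (s≤s z≤n)) (p (suc i))) (⊗-gain (β-constant i) (p i))

v : Vector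
v = fixpoint v-step

v-fixed : v ≈ⱽ v-step v
v-fixed = fixpoint-fixed v-step-contracting

v-decay : ∀ n i → n ≤ i → v i ≈[ n ] 0#
v-decay zero    i       _         _ ()
v-decay (suc n) (suc i) (s≤s n≤i) = ≈[]-trans (≈⇒≈[] (suc n) (v-fixed (suc i))) (⊕-0[]
  (⊗-0-gain (mono-constant {16 ℕ.* suc i} (s≤s z≤n)) (v-decay n (suc i) (ℕₚ.m≤n⇒m≤1+n n≤i)))
  (⊗-0-gain (β-constant i) (v-decay n i n≤i)))

Eᵀ-kernel-step : ∀ y → (∀ l → Eᵀ y l ≈ 0#) → ∀ i → y (suc i) ≈ v-step y (suc i)
Eᵀ-kernel-step y p i = begin
  y (suc i)
    ≈⟨ solve 4 (λ Q y₁ b y₀ → y₁ := ((con (+ 1) :- Q) :* y₁ :+ :- (b :* y₀)) :+ (Q :* y₁ :+ b :* y₀))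
         ≈-refl (mono (16 ℕ.* suc i)) (y (suc i)) (β i) (y i) ⟩
  Eᵀ y i ⊕ v-step y (suc i)  ≈⟨ ⊕-cong (p i) ≈-refl ⟩
  0# ⊕ v-step y (suc i)      ≈⟨ ⊕-identityˡ _ ⟩
  v-step y (suc i)           ∎
  where open ≈-Reasoning

Eᵀv≈0 : ∀ l → Eᵀ v l ≈ 0#
Eᵀv≈0 l = begin
  Eᵀ v l
    ≈⟨ solve 4 (λ Q y₁ b y₀ → (con (+ 1) :- Q) :* y₁ :+ :- (b :* y₀) := y₁ :+ :- (Q :* y₁ :+ b :* y₀))
         ≈-refl (mono (16 ℕ.* suc l)) (v (suc l)) (β l) (v l) ⟩
  v (suc l) ⊕ ⊖ v-step v (suc l)   ≈⟨ ⊕-cong (v-fixed (suc l)) ≈-refl ⟩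
  v-step v (suc l) ⊕ ⊖ v-step v (suc l) ≈⟨ solve 1 (λ x → x :+ :- x := con (+ 0)) ≈-refl _ ⟩
  0# ∎
  where open ≈-Reasoning

⊕-⊖-⊗≈0 : ∀ {x c y} → x ⊕ (⊖ c) ⊗ y ≈ 0# → x ≈ c ⊗ y
⊕-⊖-⊗≈0 {x} {c} {y} p = ≈-trans
  (solve 3 (λ x c y → x := (x :+ (:- c) :* y) :+ c :* y) ≈-refl x c y)
  (≈-trans (⊕-cong p ≈-refl) (⊕-identityˡ _))

-- Subtracting `y 0` times `v` leaves a kernel vector that starts with 0, and the kernel recurrence
-- raises its order without end.
Eᵀ-kernel : ∀ y → (∀ l → Eᵀ y l ≈ 0#) → ∀ i → y i ≈ y 0 ⊗ v i
Eᵀ-kernel y p i = ⊕-⊖-⊗≈0 (vanishing u step i)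
  where
  u : Vector
  u j = y j ⊕ (⊖ y 0) ⊗ v j

  Eᵀu≈0 : ∀ l → Eᵀ u l ≈ 0#
  Eᵀu≈0 l = ≈-trans (Eᵀ-⊕-⊗ y (⊖ y 0) v l)
    (≈-trans (⊕-cong (p l) (⊗-cong ≈-refl (Eᵀv≈0 l)))
      (solve 1 (λ c → con (+ 0) :+ c :* con (+ 0) := con (+ 0)) ≈-refl (⊖ y 0)))

  u₀≈0 : u 0 ≈ 0#
  u₀≈0 = ≈-trans (⊕-cong ≈-refl (⊗-cong ≈-refl (v-fixed 0)))
    (solve 1 (λ y → y :+ (:- y) :* con (+ 1) := con (+ 0)) ≈-refl (y 0))

  step : ∀ n → (∀ j → u j ≈[ n ] 0#) → ∀ j → u j ≈[ suc n ] 0#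
  step n q zero    = ≈⇒≈[] (suc n) u₀≈0
  step n q (suc j) = ≈[]-trans (≈⇒≈[] (suc n) (Eᵀ-kernel-step u Eᵀu≈0 j)) (⊕-0[]
    (⊗-0-gain (mono-constant {16 ℕ.* suc j} (s≤s z≤n)) (q (suc j)))
    (⊗-0-gain (β-constant j) (q j)))

-- The eigenvalue of `v`, read off at index 0 where `v` is 1.
θ : PowerSeries
θ = ⟪ 𝐀 ⟫ v 0

𝐀v≈θv : ∀ i → ⟪ 𝐀 ⟫ v i ≈ θ ⊗ v i
𝐀v≈θv = Eᵀ-kernel (⟪ 𝐀 ⟫ v) λ l → begin
  Eᵀ (⟪ 𝐀 ⟫ v) l          ≈⟨ Eᵀ𝐀≈⊖𝐌ᵀEᵀ v l ⟩
  ⊖ ⟪ 𝐌ᵀ ⟫ (Eᵀ v) l       ≈⟨ ⊖-cong (⟪⟫-cong 𝐌ᵀ (Eᵀ v) (λ _ → 0#) Eᵀv≈0 l) ⟩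
  ⊖ ⟪ 𝐌ᵀ ⟫ (λ _ → 0#) l   ≈⟨ ⊖-cong (≈[]⇒≈ λ n → ≈[]-trans (Series-Sum (Decay-⊗ˡ (λ _ → 0#) (𝐌ᵀ-decay l)) n)
                               (Sum-0[] n λ k → ≈⇒≈[] n (⊗-zeroʳ (𝐌ᵀ l k)))) ⟩
  ⊖ 0#                    ≈⟨ ⊖-0 ⟩
  0#                      ∎
  where open ≈-Reasoning

-- Eigenvectors of M

-- The unknown w encodes an eigenvector T = lift m w of D⁻²G with T_m = 1: the
-- factor q^{8(m−l)}, which the equation forces on T_l for l < m, is split off,
-- so that both T and its conjugate S by D have integral entries.
lift : ℕ → Vector → Vector
lift m w l = mono (8 ℕ.* (m ∸ l)) ⊗ w l

-- Since T_m = 1, row m of the eigenvector equation determines the eigenvalue as (G T)_m = 1 + (H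
-- T)_m. It is thus a function of the unknown, and q divides its deviation `η` from 1.
η λ̂ : ℕ → Vector → PowerSeries
η m w = H (lift m w) m
λ̂ m w = 1# ⊕ η m w

-- Row l of the equation solved for w_l. Below m it is divided by q^(16l + 8(m-l)), which leaves the
-- factor q^(8(m-l)) on G; above m it is divided by q^(16m) and G is split as 1 + H. The comparison
-- is an explicit argument, so that later lemmas can match on it.
w-case : ∀ m (w : Vector) l → Tri (l < m) (l ≡ m) (l > m) → PowerSeries
w-case m w l (tri< _ _ _) = mono (8 ℕ.* (m ∸ l)) ⊗ G (lift m w) l ⊕ ⊖ (η m w ⊗ w l)
w-case m w l (tri≈ _ _ _) = 1#
w-case m w l (tri> _ _ _) = λ̂ m w ⊗ (mono (16 ℕ.* (l ∸ m)) ⊗ w l) ⊕ ⊖ H (lift m w) l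

w-step : ℕ → Vector → Vector
w-step m w l = w-case m w l (ℕₚ.<-cmp l m)

∸-positive : ∀ c .{{_ : ℕ.NonZero c}} {l m} → l < m → c ℕ.* (m ∸ l) > 0
∸-positive c {l} {m} l<m = ℕₚ.<-≤-trans (ℕₚ.m<n⇒0<n∸m l<m) (ℕₚ.m≤n*m (m ∸ l) c)

G-cong[] : ∀ {n} x y → (∀ i → x i ≈[ n ] y i) → ∀ i → G x i ≈[ n ] G y i
G-cong[] x y p = Eᵀ-cong[] (E x) (E y) (E-cong[] x y p)

w-step-contracting : ∀ m → Contracting (w-step m)
w-step-contracting m n x y p l = case l (ℕₚ.<-cmp l m)
  where
  lifted : ∀ i → lift m x i ≈[ n ] lift m y i
  lifted i = ⊗-cong[] {f = mono (8 ℕ.* (m ∸ i))} (λ _ _ → refl) (p i)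

  η-gain : η m x ≈[ suc n ] η m y
  η-gain = H-gain (lift m x) (lift m y) lifted m

  case : ∀ l t → w-case m x l t ≈[ suc n ] w-case m y l t
  case l (tri< l<m _ _) = ⊕-cong[]
    (⊗-gain (mono-constant (∸-positive 8 l<m)) (G-cong[] (lift m x) (lift m y) lifted l))
    -- A product of two unknowns: w changes first, against `η` divisible by q, and then `η`, which
    -- has gained an order by itself.
    (⊖-cong[] (≈[]-trans (⊗-gain (H-constant (lift m x) m) (p l))
                         (⊗-cong[] {g = y l} η-gain (λ _ _ → refl))))
  case l (tri≈ _ _ _) = λ _ _ → refl
  case l (tri> _ _ m<l) = ⊕-cong[]
    (⊗-cong[] (⊕-cong[] {f = 1#} (λ _ _ → refl) η-gain)
              (⊗-gain (mono-constant (∸-positive 16 m<l)) (p l)))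
    (⊖-cong[] (H-gain (lift m x) (lift m y) lifted l))

opaque

  w : ℕ → Vector
  w m = fixpoint (w-step m)

  w-fixed : ∀ m → w m ≈ⱽ w-step m (w m)
  w-fixed m = fixpoint-fixed (w-step-contracting m)

T : ℕ → Vector
T m = lift m (w m)

w-below : ∀ m {l} → l < m →
          w m l ≈ mono (8 ℕ.* (m ∸ l)) ⊗ G (T m) l ⊕ ⊖ (η m (w m) ⊗ w m l)
w-below m {l} l<m = ≈-trans (w-fixed m l) (case (ℕₚ.<-cmp l m))
  where
  case : ∀ t → w-case m (w m) l t ≈ mono (8 ℕ.* (m ∸ l)) ⊗ G (T m) l ⊕ ⊖ (η m (w m) ⊗ w m l)
  case (tri< _ _ _)   = ≈-refl
  case (tri≈ l≮m _ _) = contradiction l<m l≮m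
  case (tri> l≮m _ _) = contradiction l<m l≮m

w-diagonal : ∀ m → w m m ≈ 1#
w-diagonal m = ≈-trans (w-fixed m m) (case (ℕₚ.<-cmp m m))
  where
  case : ∀ t → w-case m (w m) m t ≈ 1#
  case (tri< m<m _ _) = contradiction m<m (ℕₚ.<-irrefl refl)
  case (tri≈ _ _ _)   = ≈-refl
  case (tri> _ _ m<m) = contradiction m<m (ℕₚ.<-irrefl refl)

w-above : ∀ m {l} → m < l →
          w m l ≈ λ̂ m (w m) ⊗ (mono (16 ℕ.* (l ∸ m)) ⊗ w m l) ⊕ ⊖ H (T m) l
w-above m {l} m<l = ≈-trans (w-fixed m l) (case (ℕₚ.<-cmp l m))
  where
  case : ∀ t → w-case m (w m) l t ≈ λ̂ m (w m) ⊗ (mono (16 ℕ.* (l ∸ m)) ⊗ w m l) ⊕ ⊖ H (T m) l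
  case (tri< _ _ m≮l) = contradiction m<l m≮l
  case (tri≈ _ _ m≮l) = contradiction m<l m≮l
  case (tri> _ _ _)   = ≈-refl

lift-above : ∀ m {l} y → m ≤ l → lift m y l ≈ y l
lift-above m {l} y m≤l = ≈-trans
  (⊗-cong (≈-trans (mono-cong (cong (8 ℕ.*_) (ℕₚ.m≤n⇒m∸n≡0 m≤l))) mono-0) ≈-refl)
  (⊗-identityˡ (y l))

-- D⁻²G y = q^{−16m} ℓ y, with denominators cleared.
Eigenvector : ℕ → PowerSeries → Vector → Set
Eigenvector m ℓ y = ∀ l → mono (16 ℕ.* m) ⊗ G y l ≈ ℓ ⊗ (mono (16 ℕ.* l) ⊗ y l)

c*≤ : ∀ c {l m} → l ≤ m → c ℕ.* l ℕ.+ c ℕ.* (m ∸ l) ≡ c ℕ.* m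
c*≤ c {l} {m} l≤m = trans (sym (ℕₚ.*-distribˡ-+ c l (m ∸ l))) (cong (c ℕ.*_) (ℕₚ.m+[n∸m]≡n l≤m))

T-eigenvector : ∀ m → Eigenvector m (λ̂ m (w m)) (T m)
T-eigenvector m l with ℕₚ.<-cmp l m
... | tri< l<m _ _ = begin
  mono (16 ℕ.* m) ⊗ G (T m) l
    ≈⟨ mono-⊗-⊗ (16 ℕ.* l ℕ.+ d) d (G (T m) l) split ⟨
  mono (16 ℕ.* l ℕ.+ d) ⊗ (mono d ⊗ G (T m) l)
    ≈⟨ ⊗-cong ≈-refl (≈-trans
         (solve 3 (λ x e w → x := (x :+ :- (e :* w)) :+ e :* w) ≈-refl (mono d ⊗ G (T m) l) (η m (w m)) (w m l))
         (⊕-cong (≈-sym (w-below m l<m)) ≈-refl)) ⟩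
  mono (16 ℕ.* l ℕ.+ d) ⊗ (w m l ⊕ η m (w m) ⊗ w m l)
    ≈⟨ ⊗-cong (mono-⊗ (16 ℕ.* l) d) ≈-refl ⟨
  (mono (16 ℕ.* l) ⊗ mono d) ⊗ (w m l ⊕ η m (w m) ⊗ w m l)
    ≈⟨ solve 4 (λ x y w e → (x :* y) :* (w :+ e :* w) := (con (+ 1) :+ e) :* (x :* (y :* w)))
         ≈-refl (mono (16 ℕ.* l)) (mono d) (w m l) (η m (w m)) ⟩
  λ̂ m (w m) ⊗ (mono (16 ℕ.* l) ⊗ T m l) ∎
  where
  open ≈-Reasoning
  d = 8 ℕ.* (m ∸ l)
  double : ∀ k → 8 ℕ.* k ℕ.+ 8 ℕ.* k ≡ 16 ℕ.* k
  double = ℕSolver.solve-∀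
  -- One `d` comes from the factor in `lift`, the other from the factor kept in front of G in
  -- `w-below`.
  split : 16 ℕ.* l ℕ.+ d ℕ.+ d ≡ 16 ℕ.* m
  split = trans (ℕₚ.+-assoc (16 ℕ.* l) d d)
    (trans (cong (16 ℕ.* l ℕ.+_) (double (m ∸ l))) (c*≤ 16 (ℕₚ.<⇒≤ l<m)))
... | tri≈ _ refl _ = begin
  mono (16 ℕ.* m) ⊗ G (T m) m
    ≈⟨ ⊗-cong ≈-refl (≈-trans (G-H (T m) m) (⊕-cong Tₘ≈1 ≈-refl)) ⟩
  mono (16 ℕ.* m) ⊗ λ̂ m (w m)
    ≈⟨ solve 2 (λ x y → x :* y := y :* (x :* con (+ 1))) ≈-refl (mono (16 ℕ.* m)) (λ̂ m (w m)) ⟩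
  λ̂ m (w m) ⊗ (mono (16 ℕ.* m) ⊗ 1#)
    ≈⟨ ⊗-cong ≈-refl (⊗-cong ≈-refl Tₘ≈1) ⟨
  λ̂ m (w m) ⊗ (mono (16 ℕ.* m) ⊗ T m m) ∎
  where
  open ≈-Reasoning
  Tₘ≈1 : T m m ≈ 1#
  Tₘ≈1 = ≈-trans (lift-above m (w m) ℕₚ.≤-refl) (w-diagonal m)
... | tri> _ _ m<l = begin
  mono (16 ℕ.* m) ⊗ G (T m) l
    ≈⟨ ⊗-cong ≈-refl (≈-trans (G-H (T m) l)
         (⊕-cong (≈-trans (lift-above m (w m) (ℕₚ.<⇒≤ m<l)) (w-above m m<l)) ≈-refl)) ⟩
  mono (16 ℕ.* m) ⊗ ((λ̂ m (w m) ⊗ (mono d ⊗ w m l) ⊕ ⊖ H (T m) l) ⊕ H (T m) l)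
    ≈⟨ solve 5 (λ x e y w h → x :* ((e :* (y :* w) :+ :- h) :+ h) := e :* (x :* (y :* w)))
         ≈-refl (mono (16 ℕ.* m)) (λ̂ m (w m)) (mono d) (w m l) (H (T m) l) ⟩
  λ̂ m (w m) ⊗ (mono (16 ℕ.* m) ⊗ (mono d ⊗ w m l))
    ≈⟨ ⊗-cong ≈-refl (mono-⊗-⊗ (16 ℕ.* m) d (w m l) (c*≤ 16 (ℕₚ.<⇒≤ m<l))) ⟩
  λ̂ m (w m) ⊗ (mono (16 ℕ.* l) ⊗ w m l)
    ≈⟨ ⊗-cong ≈-refl (⊗-cong ≈-refl (lift-above m (w m) (ℕₚ.<⇒≤ m<l))) ⟨
  λ̂ m (w m) ⊗ (mono (16 ℕ.* l) ⊗ T m l) ∎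
  where
  open ≈-Reasoning
  d = 16 ℕ.* (l ∸ m)

E-0[] : ∀ {n} y → (∀ i → y i ≈[ n ] 0#) → ∀ i → E y i ≈[ n ] 0#
E-0[] y p zero    = ⊖-0[] (⊗-0ʳ[] (β 0) (p 0))
E-0[] y p (suc i) = ⊕-0[] (⊗-0ʳ[] (α i) (p i)) (⊖-0[] (⊗-0ʳ[] (β (suc i)) (p (suc i))))

-- With the eigenvalue given the system is linear and homogeneous. Below m the factor q^(16(m-l))
-- gains an order, above m both q^(16(l-m)) and H do, and row m is the hypothesis on `y m`.
eigenvector-unique : ∀ m (e : PowerSeries) y → e 0 ≡ 0ℤ →
                     Eigenvector m (1# ⊕ e) y → y m ≈ 0# → ∀ l → y l ≈ 0#
eigenvector-unique m e y e₀≡0 eigen yₘ≈0 = vanishing y step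
  where
  below : ∀ {l} → l < m → y l ≈ mono (16 ℕ.* (m ∸ l)) ⊗ G y l ⊕ ⊖ (e ⊗ y l)
  below {l} l<m = ≈-trans
    (solve 2 (λ y e → y := (con (+ 1) :+ e) :* y :+ :- (e :* y)) ≈-refl (y l) e)
    (⊕-cong (≈-sym (mono-cancel (16 ℕ.* l) (begin
      mono (16 ℕ.* l) ⊗ (mono (16 ℕ.* (m ∸ l)) ⊗ G y l)
        ≈⟨ mono-⊗-⊗ (16 ℕ.* l) _ (G y l) (c*≤ 16 (ℕₚ.<⇒≤ l<m)) ⟩
      mono (16 ℕ.* m) ⊗ G y l
        ≈⟨ eigen l ⟩
      (1# ⊕ e) ⊗ (mono (16 ℕ.* l) ⊗ y l)
        ≈⟨ solve 3 (λ l x y → l :* (x :* y) := x :* (l :* y)) ≈-refl (1# ⊕ e) (mono (16 ℕ.* l)) (y l) ⟩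
      mono (16 ℕ.* l) ⊗ ((1# ⊕ e) ⊗ y l) ∎))) ≈-refl)
    where open ≈-Reasoning

  above : ∀ {l} → m < l → y l ≈ (1# ⊕ e) ⊗ (mono (16 ℕ.* (l ∸ m)) ⊗ y l) ⊕ ⊖ H y l
  above {l} m<l = ≈-trans
    (solve 2 (λ y h → y := (y :+ h) :+ :- h) ≈-refl (y l) (H y l))
    (⊕-cong (≈-trans (≈-sym (G-H y l)) (mono-cancel (16 ℕ.* m) (begin
      mono (16 ℕ.* m) ⊗ G y l
        ≈⟨ eigen l ⟩
      (1# ⊕ e) ⊗ (mono (16 ℕ.* l) ⊗ y l)
        ≈⟨ ⊗-cong ≈-refl (mono-⊗-⊗ (16 ℕ.* m) (16 ℕ.* (l ∸ m)) (y l) (c*≤ 16 (ℕₚ.<⇒≤ m<l))) ⟨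
      (1# ⊕ e) ⊗ (mono (16 ℕ.* m) ⊗ (mono (16 ℕ.* (l ∸ m)) ⊗ y l))
        ≈⟨ solve 3 (λ l x y → l :* (x :* y) := x :* (l :* y)) ≈-refl
             (1# ⊕ e) (mono (16 ℕ.* m)) (mono (16 ℕ.* (l ∸ m)) ⊗ y l) ⟩
      mono (16 ℕ.* m) ⊗ ((1# ⊕ e) ⊗ (mono (16 ℕ.* (l ∸ m)) ⊗ y l)) ∎))) ≈-refl)
    where open ≈-Reasoning

  step : ∀ n → (∀ l → y l ≈[ n ] 0#) → ∀ l → y l ≈[ suc n ] 0#
  step n p l with ℕₚ.<-cmp l m
  ... | tri< l<m _ _ = ≈[]-trans (≈⇒≈[] (suc n) (below l<m)) (⊕-0[]
    (⊗-0-gain (mono-constant (∸-positive 16 l<m)) (⊕-0[]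
      (⊗-0ʳ[] (α l) (E-0[] y p (suc l))) (⊖-0[] (⊗-0ʳ[] (β l) (E-0[] y p l)))))
    (⊖-0[] (⊗-0-gain e₀≡0 (p l))))
  ... | tri≈ _ refl _ = ≈⇒≈[] (suc n) yₘ≈0
  ... | tri> _ _ m<l = ≈[]-trans (≈⇒≈[] (suc n) (above m<l)) (⊕-0[]
    (⊗-0ʳ[] (1# ⊕ e) (⊗-0-gain (mono-constant (∸-positive 16 m<l)) (p l)))
    (⊖-0[] (H-local y l (p l) (p (suc l)) (E-0[] y p l))))

-- M commutes with D⁻²G: this combines G M = Mᵀ G with Mᵀ D² = D² M, the latter being the exponent
-- identity `transposed`.
𝐌-eigenvector : ∀ m ℓ y → Eigenvector m ℓ y → Eigenvector m ℓ (⟪ 𝐌 ⟫ y)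
𝐌-eigenvector m ℓ y eigen l = begin
  mono (16 ℕ.* m) ⊗ G (⟪ 𝐌 ⟫ y) l
    ≈⟨ ⊗-cong ≈-refl (G𝐌≈𝐌ᵀG y l) ⟩
  mono (16 ℕ.* m) ⊗ ⟪ 𝐌ᵀ ⟫ (G y) l
    ≈⟨ ⟪⟫-scale 𝐌ᵀ 𝐌ᵀ-decay (mono (16 ℕ.* m)) (G y) l ⟨
  ⟪ 𝐌ᵀ ⟫ (λ k → mono (16 ℕ.* m) ⊗ G y k) l
    ≈⟨ ⟪⟫-cong 𝐌ᵀ _ (λ k → ℓ ⊗ (mono (16 ℕ.* k) ⊗ y k)) eigen l ⟩
  ⟪ 𝐌ᵀ ⟫ (λ k → ℓ ⊗ (mono (16 ℕ.* k) ⊗ y k)) l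
    ≈⟨ ⟪⟫-scale 𝐌ᵀ 𝐌ᵀ-decay ℓ (λ k → mono (16 ℕ.* k) ⊗ y k) l ⟩
  ℓ ⊗ ⟪ 𝐌ᵀ ⟫ (λ k → mono (16 ℕ.* k) ⊗ y k) l
    ≈⟨ ⊗-cong ≈-refl (Series-cong λ k → ≈-trans
         (mono-⊗-⊗ (mᵉ k l) (16 ℕ.* k) (y k) (transposed k l))
         (≈-sym (≈-trans (solve 3 (λ a x y → x :* (a :* y) := a :* (x :* y)) ≈-refl (mono (16 ℕ.* l)) (𝐌 l k) (y k))
           (mono-⊗-⊗ (16 ℕ.* l) (mᵉ l k) (y k) refl)))) ⟩
  ℓ ⊗ ⟪ 𝐌 ⟫ (λ k → mono (16 ℕ.* l) ⊗ y k) l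
    ≈⟨ ⊗-cong ≈-refl (⟪⟫-scale 𝐌 𝐌-decay (mono (16 ℕ.* l)) y l) ⟩
  ℓ ⊗ (mono (16 ℕ.* l) ⊗ ⟪ 𝐌 ⟫ y l) ∎
  where
  open ≈-Reasoning
  transposed : ∀ k l → 9 ℕ.+ 4 ℕ.* k ℕ.+ 20 ℕ.* l ℕ.+ 16 ℕ.* (k ℕ.* l) ℕ.+ 16 ℕ.* k
                     ≡ 16 ℕ.* l ℕ.+ (9 ℕ.+ 4 ℕ.* l ℕ.+ 20 ℕ.* k ℕ.+ 16 ℕ.* (l ℕ.* k))
  transposed = ℕSolver.solve-∀

μ : ℕ → PowerSeries
μ m = ⟪ 𝐌 ⟫ (T m) m

-- The eigenspace containing `T m` is one-dimensional: M T - μ T lies in it, and its entry m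
-- vanishes by the choice of `μ`.
𝐌T≈μT : ∀ m l → ⟪ 𝐌 ⟫ (T m) l ≈ μ m ⊗ T m l
𝐌T≈μT m l = ⊕-⊖-⊗≈0 (eigenvector-unique m (η m (w m)) u (H-constant (T m) m) u-eigen uₘ≈0 l)
  where
  open ≈-Reasoning
  t u : Vector
  t = ⟪ 𝐌 ⟫ (T m)
  u l = t l ⊕ (⊖ μ m) ⊗ T m l

  u-eigen : Eigenvector m (λ̂ m (w m)) u
  u-eigen l = begin
    mono (16 ℕ.* m) ⊗ G u l
      ≈⟨ ⊗-cong ≈-refl (G-⊕-⊗ t (⊖ μ m) (T m) l) ⟩
    mono (16 ℕ.* m) ⊗ (G t l ⊕ (⊖ μ m) ⊗ G (T m) l)
      ≈⟨ solve 4 (λ x g c h → x :* (g :+ c :* h) := x :* g :+ c :* (x :* h)) ≈-refl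
           (mono (16 ℕ.* m)) (G t l) (⊖ μ m) (G (T m) l) ⟩
    mono (16 ℕ.* m) ⊗ G t l ⊕ (⊖ μ m) ⊗ (mono (16 ℕ.* m) ⊗ G (T m) l)
      ≈⟨ ⊕-cong (𝐌-eigenvector m _ (T m) (T-eigenvector m) l) (⊗-cong ≈-refl (T-eigenvector m l)) ⟩
    λ̂ m (w m) ⊗ (mono (16 ℕ.* l) ⊗ t l) ⊕ (⊖ μ m) ⊗ (λ̂ m (w m) ⊗ (mono (16 ℕ.* l) ⊗ T m l))
      ≈⟨ solve 5 (λ e x t c y → e :* (x :* t) :+ c :* (e :* (x :* y)) := e :* (x :* (t :+ c :* y))) ≈-refl
           (λ̂ m (w m)) (mono (16 ℕ.* l)) (t l) (⊖ μ m) (T m l) ⟩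
    λ̂ m (w m) ⊗ (mono (16 ℕ.* l) ⊗ u l) ∎

  uₘ≈0 : u m ≈ 0#
  uₘ≈0 = ≈-trans
    (⊕-cong ≈-refl (⊗-cong ≈-refl (≈-trans (lift-above m (w m) ℕₚ.≤-refl) (w-diagonal m))))
    (solve 1 (λ x → x :+ (:- x) :* con (+ 1) := con (+ 0)) ≈-refl (μ m))

-- Column m of D T D⁻¹. The factor q^(8(l-m)) cancels the one inside T when l < m and stays a
-- genuine power of q when l > m, so the entries are integral on both sides.
S : ℕ → Vector
S m l = mono (8 ℕ.* (l ∸ m)) ⊗ w m l

-- Both sides are the maximum of m and l.
+-∸-comm : ∀ m l → m ℕ.+ (l ∸ m) ≡ l ℕ.+ (m ∸ l)
+-∸-comm zero    zero    = refl
+-∸-comm zero    (suc l) = sym (ℕₚ.+-identityʳ (suc l))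
+-∸-comm (suc m) zero    = ℕₚ.+-identityʳ (suc m)
+-∸-comm (suc m) (suc l) = cong suc (+-∸-comm m l)

S-T : ∀ m l → mono (8 ℕ.* m) ⊗ S m l ≈ mono (8 ℕ.* l) ⊗ T m l
S-T m l = ≈-trans (mono-⊗-⊗ (8 ℕ.* m) (8 ℕ.* (l ∸ m)) (w m l) balance)
  (≈-sym (mono-⊗-⊗ (8 ℕ.* l) (8 ℕ.* (m ∸ l)) (w m l) (sym (ℕₚ.*-distribˡ-+ 8 l (m ∸ l)))))
  where
  balance : 8 ℕ.* m ℕ.+ 8 ℕ.* (l ∸ m) ≡ 8 ℕ.* (l ℕ.+ (m ∸ l))
  balance = trans (sym (ℕₚ.*-distribˡ-+ 8 m (l ∸ m))) (cong (8 ℕ.*_) (+-∸-comm m l))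

𝐁S≈μS : ∀ m l → ⟪ 𝐁 ⟫ (S m) l ≈ μ m ⊗ S m l
𝐁S≈μS m l = mono-cancel (8 ℕ.* m) (begin
  mono (8 ℕ.* m) ⊗ ⟪ 𝐁 ⟫ (S m) l
    ≈⟨ ⟪⟫-scale 𝐁 𝐁-decay (mono (8 ℕ.* m)) (S m) l ⟨
  ⟪ 𝐁 ⟫ (λ k → mono (8 ℕ.* m) ⊗ S m k) l
    ≈⟨ ⟪⟫-cong 𝐁 _ (λ k → mono (8 ℕ.* k) ⊗ T m k) (S-T m) l ⟩
  ⟪ 𝐁 ⟫ (λ k → mono (8 ℕ.* k) ⊗ T m k) l
    ≈⟨ Series-cong (λ k → ≈-trans
         (mono-⊗-⊗ (bᵉ l k) (8 ℕ.* k) (T m k) (conjugate l k))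
         (≈-sym (≈-trans (solve 3 (λ a x y → x :* (a :* y) := a :* (x :* y)) ≈-refl (mono (8 ℕ.* l)) (𝐌 l k) (T m k))
           (mono-⊗-⊗ (8 ℕ.* l) (mᵉ l k) (T m k) refl)))) ⟩
  ⟪ 𝐌 ⟫ (λ k → mono (8 ℕ.* l) ⊗ T m k) l
    ≈⟨ ⟪⟫-scale 𝐌 𝐌-decay (mono (8 ℕ.* l)) (T m) l ⟩
  mono (8 ℕ.* l) ⊗ ⟪ 𝐌 ⟫ (T m) l
    ≈⟨ ⊗-cong ≈-refl (𝐌T≈μT m l) ⟩
  mono (8 ℕ.* l) ⊗ (μ m ⊗ T m l)
    ≈⟨ solve 3 (λ x c y → x :* (c :* y) := c :* (x :* y)) ≈-refl (mono (8 ℕ.* l)) (μ m) (T m l) ⟩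
  μ m ⊗ (mono (8 ℕ.* l) ⊗ T m l)
    ≈⟨ ⊗-cong ≈-refl (S-T m l) ⟨
  μ m ⊗ (mono (8 ℕ.* m) ⊗ S m l)
    ≈⟨ solve 3 (λ x c y → c :* (x :* y) := x :* (c :* y)) ≈-refl (mono (8 ℕ.* m)) (μ m) (S m l) ⟩
  mono (8 ℕ.* m) ⊗ (μ m ⊗ S m l) ∎)
  where
  open ≈-Reasoning
  conjugate : ∀ l k → 9 ℕ.+ 12 ℕ.* l ℕ.+ 12 ℕ.* k ℕ.+ 16 ℕ.* (l ℕ.* k) ℕ.+ 8 ℕ.* k
                    ≡ 8 ℕ.* l ℕ.+ (9 ℕ.+ 4 ℕ.* l ℕ.+ 20 ℕ.* k ℕ.+ 16 ℕ.* (l ℕ.* k))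
  conjugate = ℕSolver.solve-∀

𝐀ET≈-μET : ∀ m i → ⟪ 𝐀 ⟫ (E (T m)) i ≈ E (T m) i ⊗ ⊖ μ m
𝐀ET≈-μET m i = begin
  ⟪ 𝐀 ⟫ (E (T m)) i                       ≈⟨ 𝐀E≈⊖E𝐌 (T m) i ⟩
  ⊖ E (⟪ 𝐌 ⟫ (T m)) i                     ≈⟨ ⊖-cong (E-cong _ (λ l → 0# ⊕ μ m ⊗ T m l)
                                               (λ l → ≈-trans (𝐌T≈μT m l) (≈-sym (⊕-identityˡ _))) i) ⟩
  ⊖ E (λ l → 0# ⊕ μ m ⊗ T m l) i          ≈⟨ ⊖-cong (E-⊕-⊗ (λ _ → 0#) (μ m) (T m) i) ⟩
  ⊖ (E (λ _ → 0#) i ⊕ μ m ⊗ E (T m) i)    ≈⟨ ⊖-cong (⊕-cong (E-0 i) ≈-refl) ⟩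
  ⊖ (0# ⊕ μ m ⊗ E (T m) i)                ≈⟨ solve 2 (λ c y → :- (con (+ 0) :+ c :* y) := y :* :- c) ≈-refl (μ m) (E (T m) i) ⟩
  E (T m) i ⊗ ⊖ μ m                       ∎
  where
  open ≈-Reasoning
  E-0 : ∀ i → E (λ _ → 0#) i ≈ 0#
  E-0 zero    = solve 1 (λ b → :- (b :* con (+ 0)) := con (+ 0)) ≈-refl (β 0)
  E-0 (suc i) = solve 2 (λ a b → a :* con (+ 0) :+ :- (b :* con (+ 0)) := con (+ 0)) ≈-refl (α i) (β (suc i))

-- Below the diagonal the explicit power of q in front of G is large enough. Above it, H reaches
-- only the neighbours of l and contributes one order per step away from the diagonal.
w-decay : ∀ n m l → n ≤ ∣ l - m ∣ → w m l ≈[ n ] 0#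
w-decay zero    m l _ _ ()
w-decay (suc n) m l n<d with ℕₚ.<-cmp l m
... | tri< l<m _ _ = ≈[]-trans (≈⇒≈[] (suc n) (w-below m l<m)) (⊕-0[]
  (⊗-0ˡ[] (G (T m) l) (mono-high (ℕₚ.≤-trans n<d
    (subst (_≤ 8 ℕ.* (m ∸ l)) (sym (ℕₚ.m≤n⇒∣m-n∣≡n∸m (ℕₚ.<⇒≤ l<m))) (ℕₚ.m≤n*m (m ∸ l) 8)))))
  (⊖-0[] (⊗-0-gain (H-constant (T m) m) (w-decay n m l (ℕₚ.<⇒≤ n<d)))))
... | tri≈ _ refl _ = contradiction (subst (suc n ≤_) (ℕₚ.m≡n⇒∣m-n∣≡0 {m} refl) n<d) λ ()
w-decay (suc n) m (suc l) n<d | tri> _ _ (s≤s m≤l) = ≈[]-trans (≈⇒≈[] (suc n) (w-above m (s≤s m≤l))) (⊕-0[]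
  (⊗-0ʳ[] (λ̂ m (w m)) (⊗-0-gain (mono-constant (∸-positive 16 (s≤s m≤l))) (w-decay n m (suc l) (ℕₚ.<⇒≤ n<d))))
  (⊖-0[] (H-local (T m) (suc l) T₁ T₂ (⊕-0[] (⊗-0ʳ[] (α l) T₀) (⊖-0[] (⊗-0ʳ[] (β (suc l)) T₁))))))
  where
  distance : ∀ {l} → m ≤ l → ∣ l - m ∣ ≡ l ∸ m
  distance m≤l = ℕₚ.m≤n⇒∣n-m∣≡n∸m m≤l

  T-0 : ∀ k → n ≤ ∣ k - m ∣ → T m k ≈[ n ] 0#
  T-0 k p = ⊗-0ʳ[] (mono (8 ℕ.* (m ∸ k))) (w-decay n m k p)

  -- The lower neighbour is one step closer to the diagonal, which costs exactly the order that
  -- `H-local` gains.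
  n≤l∸m : n ≤ l ∸ m
  n≤l∸m = ℕₚ.≤-pred (subst (suc n ≤_) (trans (distance (ℕₚ.m≤n⇒m≤1+n m≤l)) (ℕₚ.+-∸-assoc 1 m≤l)) n<d)

  T₀ : T m l ≈[ n ] 0#
  T₀ = T-0 l (subst (n ≤_) (sym (distance m≤l)) n≤l∸m)
  T₁ : T m (suc l) ≈[ n ] 0#
  T₁ = T-0 (suc l) (ℕₚ.<⇒≤ n<d)
  T₂ : T m (suc (suc l)) ≈[ n ] 0#
  T₂ = T-0 (suc (suc l)) (subst (n ≤_) (sym (distance (ℕₚ.m≤n⇒m≤1+n (ℕₚ.m≤n⇒m≤1+n m≤l))))
    (ℕₚ.≤-trans n≤l∸m (ℕₚ.∸-monoˡ-≤ m (ℕₚ.m≤n⇒m≤1+n (ℕₚ.n≤1+n l)))))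

-- Diagonalisation and traces

I-diagonal : ∀ i → entry I i i ≡ 1#
I-diagonal i rewrite dec-true (i ℕₚ.≟ i) refl = refl

I-off-diagonal : ∀ {i j} → i ≢ j → entry I i j ≡ 0#
I-off-diagonal {i} {j} i≢j rewrite dec-false (i ℕₚ.≟ j) i≢j = refl

∣i-1+i∣ : ∀ i → ∣ i - suc i ∣ ≡ 1
∣i-1+i∣ zero    = refl
∣i-1+i∣ (suc i) = ∣i-1+i∣ i

SA-entry SB-entry : Matrix
SA-entry i zero    = v i
SA-entry i (suc m) = E (T m) i
SB-entry zero    zero    = 1#
SB-entry zero    (suc m) = 0#
SB-entry (suc l) zero    = 0#
SB-entry (suc l) (suc m) = S m l

T-decay : ∀ n m l → n ≤ ∣ l - m ∣ → T m l ≈[ n ] 0#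
T-decay n m l p = ⊗-0ʳ[] (mono (8 ℕ.* (m ∸ l))) (w-decay n m l p)

SA-band : ∀ n i j → ∣ i - j ∣ > n → SA-entry i j ≈[ n ] 0#
SA-band n zero    zero    ()
SA-band n (suc i) zero    n<d = v-decay n (suc i) (ℕₚ.<⇒≤ n<d)
SA-band n zero    (suc m) n<d = ⊖-0[] (⊗-0ʳ[] (β 0) (T-decay n m 0 (ℕₚ.≤-pred n<d)))
SA-band n (suc i) (suc m) n<d = ⊕-0[]
  (⊗-0ʳ[] (α i) (T-decay n m i (ℕₚ.<⇒≤ n<d)))
  (⊖-0[] (⊗-0ʳ[] (β (suc i)) (T-decay n m (suc i) (ℕₚ.≤-pred (ℕₚ.≤-trans n<d
    (subst (λ d → ∣ i - m ∣ ≤ d ℕ.+ ∣ suc i - m ∣) (∣i-1+i∣ i) (ℕₚ.∣-∣-triangle i (suc i) m)))))))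

SB-band : ∀ n i j → ∣ i - j ∣ > n → SB-entry i j ≈[ n ] 0#
SB-band n zero    zero    ()
SB-band n zero    (suc m) _   = λ _ _ → refl
SB-band n (suc l) zero    _   = λ _ _ → refl
SB-band n (suc l) (suc m) n<d = ⊗-0ʳ[] (mono (8 ℕ.* (l ∸ m))) (w-decay n m l (ℕₚ.<⇒≤ n<d))

banded : (e : Matrix) → (∀ n i j → ∣ i - j ∣ > n → e i j ≈[ n ] 0#) → AdmissibleMatrix
banded e p = mkAdmissible e λ n → suc n , λ i j d → ≈[]⇒deg (p (suc n) i j d)

SA SB : AdmissibleMatrix
SA = banded SA-entry SA-band
SB = banded SB-entry SB-band

∣-∣≥1 : ∀ {i j} → i ≢ j → 1 ≤ ∣ i - j ∣
∣-∣≥1 {zero}  {zero}  i≢j = contradiction refl i≢j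
∣-∣≥1 {zero}  {suc j} _   = s≤s z≤n
∣-∣≥1 {suc i} {zero}  _   = s≤s z≤n
∣-∣≥1 {suc i} {suc j} i≢j = ∣-∣≥1 (i≢j ∘ cong suc)

mono-w-constant : ∀ m l e → (l ≡ m → e ≡ 0) → (mono e ⊗ w m l) 0 ≡ entry I l m 0
mono-w-constant m l e e≡0 with l ℕₚ.≟ m
... | yes refl = trans (≈-trans (⊗-cong (≈-trans (mono-cong (e≡0 refl)) mono-0) (w-diagonal m)) (⊗-identityˡ 1#) 0)
                       (cong (_$ 0) (sym (I-diagonal m)))
... | no l≢m   = trans (⊗-0ʳ[] (mono e) (w-decay 1 m l (∣-∣≥1 l≢m)) 0 (s≤s z≤n))
                       (cong (_$ 0) (sym (I-off-diagonal l≢m)))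

n∸n*8 : ∀ {l m} → l ≡ m → 8 ℕ.* (l ∸ m) ≡ 0
n∸n*8 {l} refl = cong (8 ℕ.*_) (ℕₚ.n∸n≡0 l)

-- Modulo q the matrix E is the shift e_l ↦ e_(l+1), which frees column 0 for `v`; T and `v` reduce
-- to the identity and to e₀.
SA-unitary : Unitary SA
SA-unitary zero    zero    = v-fixed 0 0
SA-unitary (suc i) zero    = v-decay 1 (suc i) (s≤s z≤n) 0 (s≤s z≤n)
SA-unitary zero    (suc m) = ⊖-0[] (⊗-0-gain {0} {β 0} {T m 0} (β-constant 0) λ _ ()) 0 (s≤s z≤n)
SA-unitary (suc i) (suc m) = begin
  (α i ⊗ T m i ⊕ ⊖ (β (suc i) ⊗ T m (suc i))) 0
    ≡⟨ ⊕-cong[] (⊗-cong[] α≈1 (λ _ _ → refl))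
                (⊖-0[] (⊗-0-gain {0} {β (suc i)} {T m (suc i)} (β-constant (suc i)) λ _ ())) 0 (s≤s z≤n) ⟩
  (1# ⊗ T m i ⊕ 0#) 0
    ≡⟨ ≈-trans (⊕-identityʳ _) (⊗-identityˡ (T m i)) 0 ⟩
  T m i 0
    ≡⟨ mono-w-constant m i (8 ℕ.* (m ∸ i)) (λ i≡m → n∸n*8 (sym i≡m)) ⟩
  entry I i m 0 ∎
  where
  open ≡-Reasoning
  α≈1 : α i ≈[ 1 ] 1#
  α≈1 = ≈[]-trans (⊕-cong[] {f = 1#} (λ _ _ → refl) (⊖-0[] (mono-high (s≤s z≤n))))
                  (≈⇒≈[] 1 (⊕-identityʳ 1#))

SB-unitary : Unitary SB
SB-unitary zero    zero    = refl
SB-unitary zero    (suc m) = refl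
SB-unitary (suc l) zero    = refl
SB-unitary (suc l) (suc m) = mono-w-constant m l (8 ℕ.* (l ∸ m)) n∸n*8

-- B with the eigenvalue θ of A as its corner; that θ ≈ b 0 0 follows by comparing traces below.
B̂-entry : Matrix
B̂-entry zero    zero    = θ
B̂-entry zero    (suc j) = 0#
B̂-entry (suc i) zero    = 0#
B̂-entry (suc i) (suc j) = ⊖ 𝐁 i j

B̂-high : ∀ n i j → i ⊔ j > n → B̂-entry i j ≈[ n ] 0#
B̂-high n zero    zero    ()
B̂-high n zero    (suc j) _ = λ _ _ → refl
B̂-high n (suc i) zero    _ = λ _ _ → refl
B̂-high n (suc i) (suc j) p = ⊖-0[] (mono-high (ℕₚ.≤-trans (ℕₚ.≤-pred p) (ℕₚ.⊔-lub
  (ℕₚ.≤-trans (≤-linear 12 9 i (12 ℕ.* j)) (ℕₚ.m≤m+n _ (16 ℕ.* (i ℕ.* j))))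
  (≤-linear 12 (9 ℕ.+ 12 ℕ.* i) j (16 ℕ.* (i ℕ.* j))))))

B̂-admitted : Admitted B̂-entry
B̂-admitted n = suc n , λ i j p → ≈[]⇒deg (B̂-high (suc n) i j p)

B̂ : AdmissibleMatrix
B̂ = mkAdmissible B̂-entry (admitted⇒admissible B̂-admitted)

opaque
  unfolding _⊕_

  A-entry : ∀ i j → entry A i j ≈ 𝐀 i j
  A-entry i j = ≈-refl

  apply-A : ∀ y i → apply A y i ≈ ⟪ 𝐀 ⟫ y i
  apply-A y i = Σ∞-Series (apply-summable A y i) (Decay-⊗ˡ y (𝐀-decay i))

Λ : ℕ → PowerSeries
Λ zero    = θ
Λ (suc m) = ⊖ μ m

A-diagonalised : A ⊡ SA ≅ SA ⊡ diagonal Λ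
A-diagonalised = mk≅ λ i j → ≈-trans (⊡-apply A SA i j)
  (≈-trans (apply-A (λ l → SA-entry l j) i) (≈-trans (eigen i j) (≈-sym (⊡-diagonal SA Λ i j))))
  where
  eigen : ∀ i j → ⟪ 𝐀 ⟫ (λ l → SA-entry l j) i ≈ SA-entry i j ⊗ Λ j
  eigen i zero    = ≈-trans (𝐀v≈θv i) (⊗-comm θ (v i))
  eigen i (suc m) = 𝐀ET≈-μET m i

apply-B̂-zero : ∀ y → apply B̂ y 0 ≈ θ ⊗ y 0
apply-B̂-zero y = ≈[]⇒≈ λ n → let L = band B̂ n in ≈[]-trans
  (apply-Sum B̂ y n 0 (suc L) ℕₚ.≤-refl)
  (≈⇒≈[] n (≈-trans (⊕-cong ≈-refl (Sum-0 L λ l → ⊗-zeroˡ (y (suc l)))) (⊕-identityʳ (θ ⊗ y 0))))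

apply-B̂-suc : ∀ y i → apply B̂ y (suc i) ≈ ⊖ ⟪ 𝐁 ⟫ (y ∘ suc) i
apply-B̂-suc y i = ≈[]⇒≈ λ n →
  let L = n ℕ.+ (suc i ℕ.+ band B̂ n)
      open ≈[]-Reasoning n
  in begin
  apply B̂ y (suc i)
    ≈⟨ apply-Sum B̂ y n (suc i) (suc L) (s≤s (ℕₚ.m≤n+m (suc i ℕ.+ band B̂ n) n)) ⟩
  0# ⊗ y 0 ⊕ Sum L (λ l → ⊖ 𝐁 i l ⊗ y (suc l))
    ≈⟨ ≈⇒≈[] n (⊕-cong (⊗-zeroˡ (y 0)) (Sum-cong L λ l →
         solve 2 (λ x y → :- x :* y := :- (x :* y)) ≈-refl (𝐁 i l) (y (suc l)))) ⟩
  0# ⊕ Sum L (λ l → ⊖ (𝐁 i l ⊗ y (suc l)))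
    ≈⟨ ≈⇒≈[] n (≈-trans (⊕-identityˡ _) (Sum-⊖ (λ l → 𝐁 i l ⊗ y (suc l)) L)) ⟩
  ⊖ Sum L (λ l → 𝐁 i l ⊗ y (suc l))
    ≈⟨ ⊖-cong[] (Series-Sum′ (Decay-⊗ˡ (y ∘ suc) (𝐁-decay i)) L (ℕₚ.m≤m+n n _)) ⟨
  ⊖ ⟪ 𝐁 ⟫ (y ∘ suc) i ∎

B̂-diagonalised : B̂ ⊡ SB ≅ SB ⊡ diagonal Λ
B̂-diagonalised = mk≅ λ i j → ≈-trans (⊡-apply B̂ SB i j)
  (≈-trans (eigen i j) (≈-sym (⊡-diagonal SB Λ i j)))
  where
  eigen : ∀ i j → apply B̂ (λ l → SB-entry l j) i ≈ SB-entry i j ⊗ Λ j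
  eigen zero zero = ≈-trans (apply-B̂-zero (λ l → SB-entry l 0)) (⊗-comm θ 1#)
  eigen zero (suc m) = ≈-trans (apply-B̂-zero (λ l → SB-entry l (suc m)))
    (solve 2 (λ x y → x :* con (+ 0) := con (+ 0) :* y) ≈-refl θ (⊖ μ m))
  eigen (suc i) zero = ≈-trans (apply-B̂-suc (λ l → SB-entry l 0) i) (≈-trans
    (⊖-cong (≈-trans (Series-cong λ k → solve 2 (λ x y → x :* con (+ 0) := y :* (x :* con (+ 0))) ≈-refl (𝐁 i k) 0#)
      (≈-trans (Series-⊗ˡ 0# (Decay-⊗ˡ (λ _ → 0#) (𝐁-decay i))) (⊗-zeroˡ _))))
    (≈-trans ⊖-0 (≈-sym (⊗-zeroˡ θ))))
  eigen (suc i) (suc m) = ≈-trans (apply-B̂-suc (λ l → SB-entry l (suc m)) i) (≈-trans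
    (⊖-cong (𝐁S≈μS m i))
    (solve 2 (λ c y → :- (c :* y) := y :* :- c) ≈-refl (μ m) (S m i)))

intertwiner : ∀ M N P Q D R → M ⊡ P ≅ P ⊡ D → N ⊡ Q ≅ Q ⊡ D → Q ⊡ R ≅ I → R ⊡ Q ≅ I →
              (P ⊡ R) ⊡ N ≅ M ⊡ (P ⊡ R)
intertwiner M N P Q D R MP≅PD NQ≅QD QR≅I RQ≅I = begin
  (P ⊡ R) ⊡ N                  ≈⟨ ⊡-identityʳ ((P ⊡ R) ⊡ N) ⟨
  ((P ⊡ R) ⊡ N) ⊡ I            ≈⟨ ⊡-cong ≅-refl QR≅I ⟨
  ((P ⊡ R) ⊡ N) ⊡ (Q ⊡ R)      ≈⟨ ⊡-assoc ((P ⊡ R) ⊡ N) Q R ⟨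
  (((P ⊡ R) ⊡ N) ⊡ Q) ⊡ R      ≈⟨ ⊡-cong (⊡-assoc (P ⊡ R) N Q) ≅-refl ⟩
  ((P ⊡ R) ⊡ (N ⊡ Q)) ⊡ R      ≈⟨ ⊡-cong (⊡-cong ≅-refl NQ≅QD) ≅-refl ⟩
  ((P ⊡ R) ⊡ (Q ⊡ D)) ⊡ R      ≈⟨ ⊡-cong (⊡-assoc P R (Q ⊡ D)) ≅-refl ⟩
  (P ⊡ (R ⊡ (Q ⊡ D))) ⊡ R      ≈⟨ ⊡-cong (⊡-cong ≅-refl (⊡-assoc R Q D)) ≅-refl ⟨
  (P ⊡ ((R ⊡ Q) ⊡ D)) ⊡ R      ≈⟨ ⊡-cong (⊡-cong ≅-refl (⊡-cong RQ≅I ≅-refl)) ≅-refl ⟩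
  (P ⊡ (I ⊡ D)) ⊡ R            ≈⟨ ⊡-cong (⊡-cong ≅-refl (⊡-identityˡ D)) ≅-refl ⟩
  (P ⊡ D) ⊡ R                  ≈⟨ ⊡-cong MP≅PD ≅-refl ⟨
  (M ⊡ P) ⊡ R                  ≈⟨ ⊡-assoc M P R ⟩
  M ⊡ (P ⊡ R)                  ∎
  where open ≅-Reasoning

product-inverse : ∀ P P′ R R′ → P ⊡ P′ ≅ I → R ⊡ R′ ≅ I → (P ⊡ R) ⊡ (R′ ⊡ P′) ≅ I
product-inverse P P′ R R′ PP′≅I RR′≅I = begin
  (P ⊡ R) ⊡ (R′ ⊡ P′)    ≈⟨ ⊡-assoc P R (R′ ⊡ P′) ⟩
  P ⊡ (R ⊡ (R′ ⊡ P′))    ≈⟨ ⊡-cong ≅-refl (⊡-assoc R R′ P′) ⟨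
  P ⊡ ((R ⊡ R′) ⊡ P′)    ≈⟨ ⊡-cong ≅-refl (⊡-cong RR′≅I ≅-refl) ⟩
  P ⊡ (I ⊡ P′)           ≈⟨ ⊡-cong ≅-refl (⊡-identityˡ P′) ⟩
  P ⊡ P′                 ≈⟨ PP′≅I ⟩
  I                      ∎
  where open ≅-Reasoning

-- Traces and similarity

tr-Sum : ∀ M (adm : Admitted (entry M)) n L → (∀ l → l ≥ L → entry M l l ≈[ n ] 0#) →
         tr M adm ≈[ n ] Sum L (λ i → entry M i i)
tr-Sum M adm n L = Σ∞-Sum (diagonal-summable (entry M) adm) L

admitted-tail : ∀ M (adm : Admitted (entry M)) n i j → i ⊔ j > proj₁ (adm n) → entry M i j ≈[ n ] 0#
admitted-tail M adm n i j p m m<n = proj₂ (adm n) i j p m (ℕₚ.<⇒≤ m<n)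

tr-cong : ∀ {M N} → M ≅ N → (p : Admitted (entry M)) (q : Admitted (entry N)) → tr M p ≈ tr N q
tr-cong {M} {N} M≅N p q = ≈[]⇒≈ λ n →
  let L = suc (proj₁ (p n) ℕ.+ proj₁ (q n)) in ≈[]-trans
  (tr-Sum M p n L λ l l≥L → admitted-tail M p n l l
    (ℕₚ.≤-trans (ℕₚ.≤-trans (s≤s (ℕₚ.m≤m+n _ _)) l≥L) (ℕₚ.m≤m⊔n l l))) $ ≈[]-trans
  (≈⇒≈[] n (Sum-cong L λ i → entrywise M≅N i i))
  (≈[]-sym (tr-Sum N q n L λ l l≥L → admitted-tail N q n l l
    (ℕₚ.≤-trans (ℕₚ.≤-trans (s≤s (ℕₚ.m≤n+m _ (proj₁ (p n)))) l≥L) (ℕₚ.m≤m⊔n l l))))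

⊡-Sum-0 : ∀ M N n i j → (∀ l → entry M i l ⊗ entry N l j ≈[ n ] 0#) → entry (M ⊡ N) i j ≈[ n ] 0#
⊡-Sum-0 M N n i j = ⊡-Sum M N n i j 0 ∘ (λ p l _ → p l)

tr-cyclic : ∀ M N → Admitted (entry M) → (p : Admitted (entry (M ⊡ N))) (q : Admitted (entry (N ⊡ M))) →
            tr (M ⊡ N) p ≈ tr (N ⊡ M) q
tr-cyclic M N adm p q = ≈[]⇒≈ λ n →
  let L = suc (proj₁ (adm n))
      row : ∀ i l → l ≥ L → entry M i l ≈[ n ] 0#
      row i l l≥L = admitted-tail M adm n i l (ℕₚ.≤-trans l≥L (ℕₚ.m≤n⊔m i l))
      column : ∀ i l → i ≥ L → entry M i l ≈[ n ] 0#
      column i l i≥L = admitted-tail M adm n i l (ℕₚ.≤-trans i≥L (ℕₚ.m≤m⊔n i l))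
      open ≈[]-Reasoning n
  in begin
  tr (M ⊡ N) p
    ≈⟨ tr-Sum (M ⊡ N) p n L (λ i i≥L → ⊡-Sum-0 M N n i i λ l → ⊗-0ˡ[] (entry N l i) (column i l i≥L)) ⟩
  Sum L (λ i → entry (M ⊡ N) i i)
    ≈⟨ Sum-cong[] L (λ i → ⊡-Sum M N n i i L λ l l≥L → ⊗-0ˡ[] (entry N l i) (row i l l≥L)) ⟩
  Sum L (λ i → Sum L (λ l → entry M i l ⊗ entry N l i))
    ≈⟨ ≈⇒≈[] n (Sum-swap (λ i l → entry M i l ⊗ entry N l i) L L) ⟩
  Sum L (λ l → Sum L (λ i → entry M i l ⊗ entry N l i))
    ≈⟨ ≈⇒≈[] n (Sum-cong L λ l → Sum-cong L λ i → ⊗-comm (entry M i l) (entry N l i)) ⟩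
  Sum L (λ l → Sum L (λ i → entry N l i ⊗ entry M i l))
    ≈⟨ Sum-cong[] L (λ l → ⊡-Sum N M n l l L λ i i≥L → ⊗-0ʳ[] (entry N l i) (column i l i≥L)) ⟨
  Sum L (λ l → entry (N ⊡ M) l l)
    ≈⟨ tr-Sum (N ⊡ M) q n L (λ i i≥L → ⊡-Sum-0 N M n i i λ l → ⊗-0ʳ[] (entry N i l) (row l i i≥L)) ⟨
  tr (N ⊡ M) q ∎

opaque
  unfolding _⊡_

  ⊡-admitted : ∀ M N → Admitted (entry M) → Admitted (entry (M ⊡ N))
  ⊡-admitted = ·-admitted

admitted-resp : ∀ {M N} → M ≅ N → Admitted (entry M) → Admitted (entry N)
admitted-resp M≅N adm n = proj₁ (adm n) , λ i j p m m≤n →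
  trans (sym (entrywise M≅N i j m)) (proj₂ (adm n) i j p m m≤n)

tr-similar : ∀ M N X Y → X ⊡ N ≅ M ⊡ X → X ⊡ Y ≅ I → Y ⊡ X ≅ I →
             (p : Admitted (entry M)) (q : Admitted (entry N)) → tr M p ≈ tr N q
tr-similar M N X Y XN≅MX XY≅I YX≅I p q =
  ≈-trans (tr-cong M≅XNY p XNY-adm) (≈-trans
    (≈-sym (tr-cyclic (N ⊡ Y) X (⊡-admitted N Y q) (⊡-admitted (N ⊡ Y) X (⊡-admitted N Y q)) XNY-adm))
    (tr-cong NYX≅N (⊡-admitted (N ⊡ Y) X (⊡-admitted N Y q)) q))
  where
  open ≅-Reasoning
  M≅XNY : M ≅ X ⊡ (N ⊡ Y)
  M≅XNY = begin
    M              ≈⟨ ⊡-identityʳ M ⟨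
    M ⊡ I          ≈⟨ ⊡-cong ≅-refl XY≅I ⟨
    M ⊡ (X ⊡ Y)    ≈⟨ ⊡-assoc M X Y ⟨
    (M ⊡ X) ⊡ Y    ≈⟨ ⊡-cong XN≅MX ≅-refl ⟨
    (X ⊡ N) ⊡ Y    ≈⟨ ⊡-assoc X N Y ⟩
    X ⊡ (N ⊡ Y)    ∎

  NYX≅N : (N ⊡ Y) ⊡ X ≅ N
  NYX≅N = begin
    (N ⊡ Y) ⊡ X    ≈⟨ ⊡-assoc N Y X ⟩
    N ⊡ (Y ⊡ X)    ≈⟨ ⊡-cong ≅-refl YX≅I ⟩
    N ⊡ I          ≈⟨ ⊡-identityʳ N ⟩
    N              ∎

  XNY-adm : Admitted (entry (X ⊡ (N ⊡ Y)))
  XNY-adm = admitted-resp M≅XNY p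

infixr 8 _↑_

-- Powers formed with the opaque product; `↑≅^ᴹ` leads back to `_^ᴹ_`.
_↑_ : AdmissibleMatrix → ℕ → AdmissibleMatrix
M ↑ zero  = I
M ↑ suc k = M ⊡ (M ↑ k)

opaque
  unfolding _⊡_

  ↑≅^ᴹ : ∀ M k → M ↑ k ≅ M ^ᴹ k
  ↑≅^ᴹ M zero    = mk≅ λ _ _ → ≈-refl
  ↑≅^ᴹ M (suc k) = mk≅ (entrywise (⊡-cong {M} {M} {M ↑ k} {M ^ᴹ k} (mk≅ λ _ _ → ≈-refl) (↑≅^ᴹ M k)))

↑-intertwined : ∀ M N X → X ⊡ N ≅ M ⊡ X → ∀ k → X ⊡ N ↑ k ≅ M ↑ k ⊡ X
↑-intertwined M N X p zero = begin
  X ⊡ I  ≈⟨ ⊡-identityʳ X ⟩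
  X      ≈⟨ ⊡-identityˡ X ⟨
  I ⊡ X  ∎
  where open ≅-Reasoning
↑-intertwined M N X p (suc k) = begin
  X ⊡ (N ⊡ N ↑ k)    ≈⟨ ⊡-assoc X N (N ↑ k) ⟨
  (X ⊡ N) ⊡ N ↑ k    ≈⟨ ⊡-cong p ≅-refl ⟩
  (M ⊡ X) ⊡ N ↑ k    ≈⟨ ⊡-assoc M X (N ↑ k) ⟩
  M ⊡ (X ⊡ N ↑ k)    ≈⟨ ⊡-cong ≅-refl (↑-intertwined M N X p k) ⟩
  M ⊡ (M ↑ k ⊡ X)    ≈⟨ ⊡-assoc M (M ↑ k) X ⟨
  (M ⊡ M ↑ k) ⊡ X    ∎
  where open ≅-Reasoning

Similar : AdmissibleMatrix → AdmissibleMatrix → Set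
Similar M N = ∃[ X ] ∃[ Y ] (X ⊡ Y ≅ I × Y ⊡ X ≅ I × X ⊡ N ≅ M ⊡ X)

diagonalisation-similar : ∀ M N P Q D → M ⊡ P ≅ P ⊡ D → N ⊡ Q ≅ Q ⊡ D →
                          Invertibleᵒ P → Invertibleᵒ Q → Similar M N
diagonalisation-similar M N P Q D MP≅PD NQ≅QD (P⁻¹ , PP⁻¹≅I , P⁻¹P≅I) (Q⁻¹ , QQ⁻¹≅I , Q⁻¹Q≅I) =
  P ⊡ Q⁻¹ , Q ⊡ P⁻¹ ,
  product-inverse P P⁻¹ Q⁻¹ Q PP⁻¹≅I Q⁻¹Q≅I ,
  product-inverse Q Q⁻¹ P⁻¹ P QQ⁻¹≅I P⁻¹P≅I ,
  intertwiner M N P Q D Q⁻¹ MP≅PD NQ≅QD QQ⁻¹≅I Q⁻¹Q≅I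

similar-resp : ∀ {M N N′} → N ≅ N′ → Similar M N′ → Similar M N
similar-resp {M} {N} {N′} N≅N′ (X , Y , XY≅I , YX≅I , XN′≅MX) = X , Y , XY≅I , YX≅I , (begin
  X ⊡ N   ≈⟨ ⊡-cong ≅-refl N≅N′ ⟩
  X ⊡ N′  ≈⟨ XN′≅MX ⟩
  M ⊡ X   ∎)
  where open ≅-Reasoning

similar⇒tr : ∀ {M N} → Similar M N → (p : Admitted (entry M)) (q : Admitted (entry N)) → tr M p ≈ tr N q
similar⇒tr {M} {N} (X , Y , XY≅I , YX≅I , XN≅MX) = tr-similar M N X Y XN≅MX XY≅I YX≅I

similar-↑ : ∀ {M N} → Similar M N → ∀ k → Similar (M ↑ k) (N ↑ k)
similar-↑ {M} {N} (X , Y , XY≅I , YX≅I , XN≅MX) k = X , Y , XY≅I , YX≅I , ↑-intertwined M N X XN≅MX k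

tr-↑ : ∀ M k (p : Admitted (entry (M ↑ k))) (q : Admitted (entry (M ^ᴹ k))) → tr (M ↑ k) p ≈ tr (M ^ᴹ k) q
tr-↑ M k = tr-cong (↑≅^ᴹ M k)

opaque
  unfolding _⊡_

  similar⇒conjugate : ∀ {M N} → Similar M N → ∃[ X ] (Invertible X × X · N ≋ M · X)
  similar⇒conjugate (X , Y , XY≅I , YX≅I , XN≅MX) =
    X , (Y , entrywise XY≅I , entrywise YX≅I) , entrywise XN≅MX

opaque

  similar-B̂ : Similar A B̂
  similar-B̂ = diagonalisation-similar A B̂ SA SB (diagonal Λ) A-diagonalised B̂-diagonalised
    (unitary⇒invertible SA SA-unitary) (unitary⇒invertible SB SB-unitary)

-- Applied to the squares of 2l + 1, this separates the odd numbers that are 1 modulo 4 from those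
-- that are 3.
Sum-parity : ∀ f L → Sum (2 ℕ.* L) f ≈ Sum L (λ l → f (2 ℕ.* l)) ⊕ Sum L (λ l → f (suc (2 ℕ.* l)))
Sum-parity f zero    = ≈-sym (⊕-identityˡ 0#)
Sum-parity f (suc L) = begin
  Sum (2 ℕ.* suc L) f
    ≈⟨ ≈-reflexive (cong (λ k → Sum (suc k) f) (ℕₚ.+-suc L (L ℕ.+ 0))) ⟩
  Sum (2 ℕ.+ 2 ℕ.* L) f
    ≈⟨ ⊕-cong ≈-refl (⊕-cong ≈-refl (Sum-parity (λ l → f (2 ℕ.+ l)) L)) ⟩
  f 0 ⊕ (f 1 ⊕ (Sum L (λ l → f (2 ℕ.+ 2 ℕ.* l)) ⊕ Sum L (λ l → f (3 ℕ.+ 2 ℕ.* l))))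
    ≈⟨ ⊕-cong ≈-refl (⊕-cong ≈-refl (⊕-cong
         (Sum-cong L λ l → ≈-reflexive (cong f (two l))) (Sum-cong L λ l → ≈-reflexive (cong (f ∘ suc) (two l))))) ⟩
  f 0 ⊕ (f 1 ⊕ (Sum L (λ l → f (2 ℕ.* suc l)) ⊕ Sum L (λ l → f (suc (2 ℕ.* suc l)))))
    ≈⟨ solve 4 (λ x y z u → x :+ (y :+ (z :+ u)) := (x :+ z) :+ (y :+ u)) ≈-refl _ _ _ _ ⟩
  (f 0 ⊕ Sum L (λ l → f (2 ℕ.* suc l))) ⊕ (f 1 ⊕ Sum L (λ l → f (suc (2 ℕ.* suc l)))) ∎
  where
  open ≈-Reasoning
  two : ∀ l → 2 ℕ.+ 2 ℕ.* l ≡ 2 ℕ.* suc l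
  two = ℕSolver.solve-∀

opaque
  unfolding _⊕_

  b₀₀-Sum : ∀ n L → L ≥ n → b 0 0 ≈[ n ] Sum L (λ l → mono ((2 ℕ.* l ℕ.+ 1) ℕ.^ 2))
  b₀₀-Sum n L L≥n = Σ∞-Sum odd-squares-summable L λ l l≥L →
    mono-high (ℕₚ.≤-trans L≥n (ℕₚ.≤-trans l≥L (ℕₚ.≤-trans (l≤2l+1 l) (square (2 ℕ.* l)))))
    where
    l≤2l+1 : ∀ l → l ≤ 2 ℕ.* l
    l≤2l+1 l = ℕₚ.m≤n*m l 2
    square : ∀ x → x ≤ (x ℕ.+ 1) ℕ.^ 2
    square x rewrite ℕₚ.+-comm x 1 = ℕₚ.≤-trans (ℕₚ.n≤1+n x) (ℕₚ.m≤m*n (suc x) (suc x ℕ.* 1))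

-- The diagonal of A sums the squares of numbers 1 modulo 4, that of `B̂` is `θ` minus those of
-- numbers 3 modulo 4. Equal traces make `θ` the sum over all odd squares.
θ≈b₀₀ : θ ≈ b 0 0
θ≈b₀₀ = ≈[]⇒≈ λ n →
  let open ≈[]-Reasoning n
  in begin
  θ
    ≈⟨ ≈⇒≈[] n (solve 2 (λ t s → t := (t :+ :- s) :+ s) ≈-refl θ (Sum n odd₃)) ⟩
  (θ ⊕ ⊖ Sum n odd₃) ⊕ Sum n odd₃
    ≈⟨ ⊕-cong[] {g = Sum n odd₃} (≈⇒≈[] n (⊕-cong (≈-refl {θ}) (Sum-⊖ odd₃ n))) (λ _ _ → refl) ⟨
  Sum (suc n) (λ i → entry B̂ i i) ⊕ Sum n odd₃
    ≈⟨ ⊕-cong[] {g = Sum n odd₃} (tr-Sum B̂ B̂-admitted n (suc n) λ l l>n →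
         B̂-high n l l (ℕₚ.≤-trans l>n (ℕₚ.m≤m⊔n l l))) (λ _ _ → refl) ⟨
  tr B̂ B̂-admitted ⊕ Sum n odd₃
    ≈⟨ ≈⇒≈[] n (⊕-cong trA≈trB̂ ≈-refl) ⟨
  tr A a-admitted ⊕ Sum n odd₃
    ≈⟨ ⊕-cong[] {g = Sum n odd₃} (≈[]-trans (tr-Sum A a-admitted n n λ l l≥n →
         ≈[]-trans (≈⇒≈[] n (A-entry l l)) (≈[]-mono l≥n (𝐀-decay l l)))
         (≈⇒≈[] n (Sum-cong n λ l → A-entry l l))) (λ _ _ → refl) ⟩
  Sum n odd₁ ⊕ Sum n odd₃
    ≈⟨ ≈⇒≈[] n (⊕-cong (Sum-cong n λ l → mono-cong (square₁ l)) (Sum-cong n λ l → mono-cong (square₃ l))) ⟩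
  Sum n (λ l → mono ((2 ℕ.* (2 ℕ.* l) ℕ.+ 1) ℕ.^ 2)) ⊕ Sum n (λ l → mono ((2 ℕ.* suc (2 ℕ.* l) ℕ.+ 1) ℕ.^ 2))
    ≈⟨ ≈⇒≈[] n (Sum-parity (λ l → mono ((2 ℕ.* l ℕ.+ 1) ℕ.^ 2)) n) ⟨
  Sum (2 ℕ.* n) (λ l → mono ((2 ℕ.* l ℕ.+ 1) ℕ.^ 2))
    ≈⟨ b₀₀-Sum n (2 ℕ.* n) (ℕₚ.m≤n*m n 2) ⟨
  b 0 0 ∎
  where
  odd₁ odd₃ : ℕ → PowerSeries
  odd₁ l = mono (aᵉ l l)
  odd₃ l = mono (bᵉ l l)
  trA≈trB̂ : tr A a-admitted ≈ tr B̂ B̂-admitted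
  trA≈trB̂ = similar⇒tr similar-B̂ a-admitted B̂-admitted
  square₁ : ∀ l → (4 ℕ.* l ℕ.+ 1) ℕ.* (4 ℕ.* l ℕ.+ 1)
                ≡ (2 ℕ.* (2 ℕ.* l) ℕ.+ 1) ℕ.* ((2 ℕ.* (2 ℕ.* l) ℕ.+ 1) ℕ.* 1)
  square₁ = ℕSolver.solve-∀
  square₃ : ∀ l → 9 ℕ.+ 12 ℕ.* l ℕ.+ 12 ℕ.* l ℕ.+ 16 ℕ.* (l ℕ.* l)
                ≡ (2 ℕ.* suc (2 ℕ.* l) ℕ.+ 1) ℕ.* ((2 ℕ.* suc (2 ℕ.* l) ℕ.+ 1) ℕ.* 1)
  square₃ = ℕSolver.solve-∀

opaque
  unfolding _⊕_

  b-block : ∀ i j → b (suc i) (suc j) ≈ ⊖ mono (bᵉ i j)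
  b-block i j = ≈-reflexive (cong (λ e → - (q^ e)) (exponent i j))
    where
    predecessor : ∀ i → 4 ℕ.* suc i ∸ 1 ≡ 4 ℕ.* i ℕ.+ 3
    predecessor i = trans (cong (_∸ 1) (lemma i)) refl
      where
      lemma : ∀ i → 4 ℕ.* suc i ≡ 1 ℕ.+ (4 ℕ.* i ℕ.+ 3)
      lemma = ℕSolver.solve-∀
    exponent : ∀ i j → (4 ℕ.* suc i ∸ 1) ℕ.* (4 ℕ.* suc j ∸ 1) ≡ bᵉ i j
    exponent i j = trans (cong₂ ℕ._*_ (predecessor i) (predecessor j)) (lemma i j)
      where
      lemma : ∀ i j → (4 ℕ.* i ℕ.+ 3) ℕ.* (4 ℕ.* j ℕ.+ 3) ≡ 9 ℕ.+ 12 ℕ.* i ℕ.+ 12 ℕ.* j ℕ.+ 16 ℕ.* (i ℕ.* j)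
      lemma = ℕSolver.solve-∀

B≅B̂ : B ≅ B̂
B≅B̂ = mk≅ λ { zero zero → ≈-sym θ≈b₀₀ ; zero (suc j) → ≈-refl ; (suc i) zero → ≈-refl ; (suc i) (suc j) → b-block i j }

opaque

  similar-B : Similar A B
  similar-B = similar-resp B≅B̂ similar-B̂

tr-powers : ∀ k (k≥1 : k ≥ 1) → tr (A ^ᴹ k) (^ᴹ-admitted A a-admitted k k≥1)
                              ≈ tr (B ^ᴹ k) (^ᴹ-admitted B b-admitted k k≥1)
tr-powers k k≥1 = ≈-trans (≈-sym (tr-↑ A k A↑-admitted (^ᴹ-admitted A a-admitted k k≥1))) (≈-trans
  (similar⇒tr (similar-↑ similar-B k) A↑-admitted B↑-admitted)
  (tr-↑ B k B↑-admitted (^ᴹ-admitted B b-admitted k k≥1)))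
  where
  A↑-admitted : Admitted (entry (A ↑ k))
  A↑-admitted = admitted-resp (≅-sym (↑≅^ᴹ A k)) (^ᴹ-admitted A a-admitted k k≥1)
  B↑-admitted : Admitted (entry (B ↑ k))
  B↑-admitted = admitted-resp (≅-sym (↑≅^ᴹ B k)) (^ᴹ-admitted B b-admitted k k≥1)

-- Counting

VecSum : ∀ L k → (Vec ℕ k → PowerSeries) → PowerSeries
VecSum L zero    f = f []
VecSum L (suc k) f = Sum L λ l → VecSum L k λ v → f (l ∷ v)

VecSum-cong : ∀ L k {f g : Vec ℕ k → PowerSeries} → (∀ v → f v ≈ g v) → VecSum L k f ≈ VecSum L k g
VecSum-cong L zero    p = p []
VecSum-cong L (suc k) p = Sum-cong L λ l → VecSum-cong L k λ v → p (l ∷ v)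

VecSum-⊗ˡ : ∀ L k x (f : Vec ℕ k → PowerSeries) → VecSum L k (λ v → x ⊗ f v) ≈ x ⊗ VecSum L k f
VecSum-⊗ˡ L zero    x f = ≈-refl
VecSum-⊗ˡ L (suc k) x f = ≈-trans
  (Sum-cong L λ l → VecSum-⊗ˡ L k x λ v → f (l ∷ v))
  (Sum-⊗ˡ x (λ l → VecSum L k λ v → f (l ∷ v)) L)

VecSum-mono : ∀ L k d (e : Vec ℕ k → ℕ) →
              mono d ⊗ VecSum L k (λ v → mono (e v)) ≈ VecSum L k (λ v → mono (d ℕ.+ e v))
VecSum-mono L k d e = ≈-trans (≈-sym (VecSum-⊗ˡ L k (mono d) λ v → mono (e v)))
  (VecSum-cong L k λ v → mono-⊗ d (e v))

-- Powers of A and B as sums over walks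

sign : ℕ → PowerSeries
sign zero    = 1#
sign (suc k) = ⊖ sign k

opaque
  unfolding _⊕_

  sign-coefficient : ∀ k f n → (sign k ⊗ f) n ≡ (-1ℤ ^ k) *ℤ f n
  sign-coefficient zero    f n = trans (⊗-identityˡ f n) (sym (ℤₚ.*-identityˡ (f n)))
  sign-coefficient (suc k) f n = begin
    (⊖ sign k ⊗ f) n            ≡⟨ solve 2 (λ s f → :- s :* f := :- (s :* f)) ≈-refl (sign k) f n ⟩
    ℤ.- (sign k ⊗ f) n          ≡⟨ cong ℤ.-_ (sign-coefficient k f n) ⟩
    ℤ.- ((-1ℤ ^ k) *ℤ f n)      ≡⟨ ℤₚ.-1*i≡-i _ ⟨
    -1ℤ *ℤ ((-1ℤ ^ k) *ℤ f n)   ≡⟨ ℤₚ.*-assoc -1ℤ (-1ℤ ^ k) (f n) ⟨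
    (-1ℤ ^ suc k) *ℤ f n        ∎
    where open ≡-Reasoning

  mono-coefficient : ∀ e n → mono e n ≡ (if does (n ℕₚ.≟ e) then 1ℤ else 0ℤ)
  mono-coefficient e n = refl

  ⊕-coefficient : ∀ f g n → (f ⊕ g) n ≡ f n ℤ.+ g n
  ⊕-coefficient f g n = refl

-- For z = x this is `cyclicSum (x ∷ xs)` by definition; the free endpoint is what lets the
-- induction on the power go through.
walk : ∀ {k} → ℕ → Vec ℕ k → ℕ → ℕ
walk x xs z = Vec.sum (zipWith ℕ._*_ (x ∷ xs) (xs ∷ʳ z))

-- An exponent of the form `g i ℕ.* g j` turns the product of entries along a path into the sum of
-- products of neighbours.
↑-walk : ∀ M g → (∀ i j → entry M i j ≈ mono (g i ℕ.* g j)) →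
         ∀ {n} L → (∀ i l → l ≥ L → entry M i l ≈[ n ] 0#) → ∀ k i j →
         entry (M ↑ suc k) i j ≈[ n ] VecSum L k (λ v → mono (walk (g i) (Vec.map g v) (g j)))
↑-walk M g p {n} L tail zero i j = ≈⇒≈[] n (≈-trans (entrywise (⊡-identityʳ M) i j)
  (≈-trans (p i j) (mono-cong (sym (ℕₚ.+-identityʳ (g i ℕ.* g j))))))
↑-walk M g p {n} L tail (suc k) i j = begin
  entry (M ⊡ M ↑ suc k) i j
    ≈⟨ ⊡-Sum M (M ↑ suc k) n i j L (λ l l≥L → ⊗-0ˡ[] (entry (M ↑ suc k) l j) (tail i l l≥L)) ⟩
  Sum L (λ l → entry M i l ⊗ entry (M ↑ suc k) l j)
    ≈⟨ Sum-cong[] L (λ l → ⊗-cong[] (≈⇒≈[] n (p i l)) (↑-walk M g p L tail k l j)) ⟩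
  Sum L (λ l → mono (g i ℕ.* g l) ⊗ VecSum L k (λ v → mono (walk (g l) (Vec.map g v) (g j))))
    ≈⟨ ≈⇒≈[] n (Sum-cong L λ l → VecSum-mono L k (g i ℕ.* g l) λ v → walk (g l) (Vec.map g v) (g j)) ⟩
  VecSum L (suc k) (λ v → mono (walk (g i) (Vec.map g v) (g j))) ∎
  where open ≈[]-Reasoning n

-- An entry of A in row or column l has order at least l, so modulo qⁿ all indices stay below n;
-- closed walks give the cyclic sum.
tr-A↑ : ∀ k n → (p : Admitted (entry (A ↑ suc k))) →
        tr (A ↑ suc k) p ≈[ n ] VecSum n (suc k) (λ v → mono (cyclicSum (Vec.map (λ i → 4 ℕ.* i ℕ.+ 1) v)))
tr-A↑ k n p = ≈[]-trans
  (tr-Sum (A ↑ suc k) p n n λ i i≥n → ⊡-Sum-0 A (A ↑ k) n i i λ l → ⊗-0ˡ[] (entry (A ↑ k) l i)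
    (≈[]-trans (≈⇒≈[] n (≈-trans (A-entry i l) (mono-cong (aᵉ-comm i l)))) (≈[]-mono i≥n (𝐀-decay l i))))
  (Sum-cong[] n λ i → ↑-walk A (λ i → 4 ℕ.* i ℕ.+ 1) A-entry n
    (λ i l l≥n → ≈[]-trans (≈⇒≈[] n (A-entry i l)) (≈[]-mono l≥n (𝐀-decay i l))) k i i)

B-high : ∀ n i j → i ⊔ j > n → entry B i j ≈[ n ] 0#
B-high n i j p = ≈[]-trans (≈⇒≈[] n (entrywise B≅B̂ i j)) (B̂-high n i j p)

-- B is block diagonal, so this is the power of `b 0 0` alone, and exponents of independent factors
-- add up to a sum of squares.
B↑-corner : ∀ k n → entry (B ↑ k) 0 0 ≈[ n ] VecSum n k (λ v → mono (sumOfSquares (Vec.map (λ l → 2 ℕ.* l ℕ.+ 1) v)))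
B↑-corner zero    n = ≈⇒≈[] n (≈-sym mono-0)
B↑-corner (suc k) n = begin
  entry (B ⊡ B ↑ k) 0 0
    ≈⟨ ⊡-Sum B (B ↑ k) n 0 0 1 (λ { (suc l) _ → ⊗-0ˡ[] (entry (B ↑ k) (suc l) 0) (λ _ _ → refl) }) ⟩
  b 0 0 ⊗ entry (B ↑ k) 0 0 ⊕ 0#
    ≈⟨ ≈⇒≈[] n (⊕-identityʳ _) ⟩
  b 0 0 ⊗ entry (B ↑ k) 0 0
    ≈⟨ ⊗-cong[] (b₀₀-Sum n n ℕₚ.≤-refl) (B↑-corner k n) ⟩
  Sum n (λ l → mono ((2 ℕ.* l ℕ.+ 1) ℕ.^ 2)) ⊗ VecSum n k f
    ≈⟨ ≈⇒≈[] n (Sum-⊗ʳ (VecSum n k f) (λ l → mono ((2 ℕ.* l ℕ.+ 1) ℕ.^ 2)) n) ⟨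
  Sum n (λ l → mono ((2 ℕ.* l ℕ.+ 1) ℕ.^ 2) ⊗ VecSum n k f)
    ≈⟨ ≈⇒≈[] n (Sum-cong n λ l → VecSum-mono n k ((2 ℕ.* l ℕ.+ 1) ℕ.^ 2) λ v → sumOfSquares (Vec.map (λ l → 2 ℕ.* l ℕ.+ 1) v)) ⟩
  VecSum n (suc k) (λ v → mono (sumOfSquares (Vec.map (λ l → 2 ℕ.* l ℕ.+ 1) v))) ∎
  where
  open ≈[]-Reasoning n
  f : Vec ℕ k → PowerSeries
  f v = mono (sumOfSquares (Vec.map (λ l → 2 ℕ.* l ℕ.+ 1) v))

4i+3 : ℕ → ℕ
4i+3 i = 4 ℕ.* i ℕ.+ 3

B-block : ∀ i j → b (suc i) (suc j) ≈ ⊖ mono (4i+3 i ℕ.* 4i+3 j)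
B-block i j = ≈-trans (b-block i j) (⊖-cong (mono-cong (lemma i j)))
  where
  lemma : ∀ i j → 9 ℕ.+ 12 ℕ.* i ℕ.+ 12 ℕ.* j ℕ.+ 16 ℕ.* (i ℕ.* j) ≡ (4 ℕ.* i ℕ.+ 3) ℕ.* (4 ℕ.* j ℕ.+ 3)
  lemma = ℕSolver.solve-∀

-- The complementary block: each of the `suc k` factors contributes a sign, and index 0 drops out of
-- the intermediate sums.
B↑-block : ∀ n k i j → entry (B ↑ suc k) (suc i) (suc j)
                 ≈[ n ] sign (suc k) ⊗ VecSum n k (λ v → mono (walk (4i+3 i) (Vec.map 4i+3 v) (4i+3 j)))
B↑-block n zero i j = ≈⇒≈[] n (≈-trans (entrywise (⊡-identityʳ B) (suc i) (suc j))
  (≈-trans (B-block i j) (≈-trans (⊖-cong (mono-cong (sym (ℕₚ.+-identityʳ _))))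
    (solve 1 (λ x → :- x := :- con (+ 1) :* x) ≈-refl (mono (4i+3 i ℕ.* 4i+3 j ℕ.+ 0))))))
B↑-block n (suc k) i j = begin
  entry (B ⊡ B ↑ suc k) (suc i) (suc j)
    ≈⟨ ⊡-Sum B (B ↑ suc k) n (suc i) (suc j) (suc n) (λ l l>n →
         ⊗-0ˡ[] (entry (B ↑ suc k) l (suc j)) (B-high n (suc i) l (ℕₚ.≤-trans l>n (ℕₚ.m≤n⊔m (suc i) l)))) ⟩
  0# ⊗ entry (B ↑ suc k) 0 (suc j) ⊕ Sum n (λ l → b (suc i) (suc l) ⊗ entry (B ↑ suc k) (suc l) (suc j))
    ≈⟨ ≈⇒≈[] n (≈-trans (⊕-cong (⊗-zeroˡ _) ≈-refl) (⊕-identityˡ _)) ⟩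
  Sum n (λ l → b (suc i) (suc l) ⊗ entry (B ↑ suc k) (suc l) (suc j))
    ≈⟨ Sum-cong[] n (λ l → ⊗-cong[] (≈⇒≈[] n (B-block i l)) (B↑-block n k l j)) ⟩
  Sum n (λ l → ⊖ mono (4i+3 i ℕ.* 4i+3 l) ⊗ (sign (suc k) ⊗ f l))
    ≈⟨ ≈⇒≈[] n (Sum-cong n λ l → ≈-trans
         (solve 3 (λ x s y → :- x :* (s :* y) := :- s :* (x :* y)) ≈-refl
           (mono (4i+3 i ℕ.* 4i+3 l)) (sign (suc k)) (f l))
         (⊗-cong ≈-refl (VecSum-mono n k (4i+3 i ℕ.* 4i+3 l) λ v → walk (4i+3 l) (Vec.map 4i+3 v) (4i+3 j)))) ⟩
  Sum n (λ l → sign (suc (suc k)) ⊗ VecSum n k (λ v → mono (walk (4i+3 i) (Vec.map 4i+3 (l ∷ v)) (4i+3 j))))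
    ≈⟨ ≈⇒≈[] n (Sum-⊗ˡ (sign (suc (suc k)))
         (λ l → VecSum n k (λ v → mono (walk (4i+3 i) (Vec.map 4i+3 (l ∷ v)) (4i+3 j)))) n) ⟩
  sign (suc (suc k)) ⊗ VecSum n (suc k) (λ v → mono (walk (4i+3 i) (Vec.map 4i+3 v) (4i+3 j))) ∎
  where
  open ≈[]-Reasoning n
  f : ℕ → PowerSeries
  f l = VecSum n k (λ v → mono (walk (4i+3 l) (Vec.map 4i+3 v) (4i+3 j)))

tr-B↑ : ∀ k n → (p : Admitted (entry (B ↑ suc k))) → tr (B ↑ suc k) p
        ≈[ n ] VecSum n (suc k) (λ v → mono (sumOfSquares (Vec.map (λ l → 2 ℕ.* l ℕ.+ 1) v)))
               ⊕ sign (suc k) ⊗ VecSum n (suc k) (λ v → mono (cyclicSum (Vec.map 4i+3 v)))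
tr-B↑ k n p = ≈[]-trans
  (tr-Sum (B ↑ suc k) p n (suc n) λ i i>n → ⊡-Sum-0 B (B ↑ k) n i i λ l → ⊗-0ˡ[] (entry (B ↑ k) l i)
    (B-high n i l (ℕₚ.≤-trans i>n (ℕₚ.m≤m⊔n i l))))
  (⊕-cong[] (B↑-corner (suc k) n) (≈[]-trans
    (Sum-cong[] n λ i → B↑-block n k i i)
    (≈⇒≈[] n (Sum-⊗ˡ (sign (suc k)) (λ i → VecSum n k (λ v → mono (walk (4i+3 i) (Vec.map 4i+3 v) (4i+3 i)))) n))))

-- Coefficients as numbers of solutions

vectors : ∀ L k → List (Vec ℕ k)
vectors L zero    = [] ∷ []
vectors L (suc k) = cartesianProductWith _∷_ (upTo L) (vectors L k)

length-filter-map : ∀ {X Y : Set} {P : Pred Y 0ℓ} (P? : Decidable P) (f : X → Y) xs →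
                    length (filter P? (List.map f xs)) ≡ length (filter (P? ∘ f) xs)
length-filter-map P? f []       = refl
length-filter-map P? f (x ∷ xs) with does (P? (f x))
... | true  = cong suc (length-filter-map P? f xs)
... | false = length-filter-map P? f xs

-- The list `upTo L` is `applyUpTo` of the identity, whose function is shifted by the recursion; the
-- general `h` makes the induction close.
Sum-count : ∀ {k} {P : Pred (Vec ℕ (suc k)) 0ℓ} (P? : Decidable P) (ys : List (Vec ℕ k)) n
            (h : ℕ → ℕ) (f : ℕ → PowerSeries) →
            (∀ x → f x n ≡ + length (filter (P? ∘ (h x ∷_)) ys)) → ∀ L →
            Sum L f n ≡ + length (filter P? (cartesianProductWith _∷_ (applyUpTo h L) ys))
Sum-count P? ys n h f p zero    = refl
Sum-count P? ys n h f p (suc L) = begin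
  (f 0 ⊕ Sum L (f ∘ suc)) n
    ≡⟨ ⊕-coefficient (f 0) _ n ⟩
  f 0 n ℤ.+ Sum L (f ∘ suc) n
    ≡⟨ cong₂ ℤ._+_ (p 0) (Sum-count P? ys n (h ∘ suc) (f ∘ suc) (p ∘ suc) L) ⟩
  + length (filter (P? ∘ (h 0 ∷_)) ys) ℤ.+ + length (filter P? rest)
    ≡⟨ cong (λ m → + (m ℕ.+ length (filter P? rest))) (length-filter-map P? (h 0 ∷_) ys) ⟨
  + (length (filter P? (List.map (h 0 ∷_) ys)) ℕ.+ length (filter P? rest))
    ≡⟨ cong +_ (Listₚ.length-++ (filter P? (List.map (h 0 ∷_) ys))) ⟨
  + length (filter P? (List.map (h 0 ∷_) ys) List.++ filter P? rest)
    ≡⟨ cong (+_ ∘ length) (Listₚ.filter-++ P? (List.map (h 0 ∷_) ys) rest) ⟨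
  + length (filter P? (List.map (h 0 ∷_) ys List.++ rest)) ∎
  where
  open ≡-Reasoning
  rest = cartesianProductWith _∷_ (applyUpTo (h ∘ suc) L) ys

VecSum-count : ∀ L n k (e : Vec ℕ k → ℕ) →
  VecSum L k (λ v → mono (e v)) n ≡ + length (filter (λ v → n ℕₚ.≟ e v) (vectors L k))
VecSum-count L n zero e = trans (mono-coefficient (e []) n) (lemma (does (n ℕₚ.≟ e [])) refl)
  where
  lemma : ∀ t → t ≡ does (n ℕₚ.≟ e []) →
          (if t then 1ℤ else 0ℤ) ≡ + length (filter (λ v → n ℕₚ.≟ e v) ([] ∷ []))
  lemma true  p rewrite sym p = refl
  lemma false p rewrite sym p = refl
VecSum-count L n (suc k) e = Sum-count (λ v → n ℕₚ.≟ e v) (vectors L k) n (λ l → l)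
  (λ l → VecSum L k (λ v → mono (e (l ∷ v)))) (λ l → VecSum-count L n k (e ∘ (l ∷_))) L

-- Makes the cardinality independent of the enumeration that a `Finite` happens to carry.
unique-length : ∀ {X : Set} {xs ys : List X} → Unique xs → Unique ys →
                (∀ {z} → z ∈ xs → z ∈ ys) → (∀ {z} → z ∈ ys → z ∈ xs) → length xs ≡ length ys
unique-length u u′ p p′ = ↭-length (∼bag⇒↭ (unique∧set⇒bag u u′ (mk⇔ p p′)))

vectors-unique : ∀ L k → Unique (vectors L k)
vectors-unique L zero    = []ᴸ ∷ []
vectors-unique L (suc k) =
  Uniqueₚ.cartesianProductWith⁺ _∷_ Vecₚ.∷-injective (Uniqueₚ.upTo⁺ L) (vectors-unique L k)

∈-vectors : ∀ {L k} {v : Vec ℕ k} → All (_< L) v → v ∈ vectors L k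
∈-vectors []       = here refl
∈-vectors (p ∷ ps) = ∈-cartesianProductWith⁺ _∷_ (∈-upTo⁺ p) (∈-vectors ps)

-- A parametrisation of a residue class by ℕ. The field `increases` turns a bound on the members
-- into a bound on their indices.
record Enumerates (g : ℕ → ℕ) (Q : ℕ → Set) : Set where
  field
    sound     : ∀ i → Q (g i)
    index     : ∀ {x} → Q x → ∃[ i ] g i ≡ x
    increases : ∀ i → i ≤ g i
    injective : ∀ {i j} → g i ≡ g j → i ≡ j

module _ {g : ℕ → ℕ} {Q : ℕ → Set} (en : Enumerates g Q) where
  open Enumerates en

  map-injective : ∀ {k} {v v′ : Vec ℕ k} → Vec.map g v ≡ Vec.map g v′ → v ≡ v′
  map-injective {v = []}    {[]}      _ = refl
  map-injective {v = x ∷ v} {x′ ∷ v′} p =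
    cong₂ _∷_ (injective (Vecₚ.∷-injectiveˡ p)) (map-injective (Vecₚ.∷-injectiveʳ p))

  indices : ∀ {k n} {xs : Vec ℕ k} → All Q xs → All (_≤ n) xs → ∃[ v ] (Vec.map g v ≡ xs × All (_< suc n) v)
  indices []       []       = [] , refl , []
  indices (q ∷ qs) (p ∷ ps) with index q | indices qs ps
  ... | i , refl | v , refl , b = i ∷ v , refl , s≤s (ℕₚ.≤-trans (increases i) p) ∷ b

  all-sound : ∀ {k} (v : Vec ℕ k) → All Q (Vec.map g v)
  all-sound []      = []
  all-sound (x ∷ v) = sound x ∷ all-sound v

  -- Entries of a solution are at most n, hence so are their indices, and the box of side `suc n`
  -- contains every solution exactly once.
  count : ∀ {k n} (e : Vec ℕ k → ℕ) → (∀ {xs} → All Q xs → All (_≤ e xs) xs) →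
          (F : Finite (λ xs → All Q xs × e xs ≡ n)) →
          VecSum (suc n) k (λ v → mono (e (Vec.map g v))) n ≡ + cardinality F
  count {k} {n} e bounded F = trans (VecSum-count (suc n) n k (e ∘ Vec.map g)) (cong +_
    (trans (sym (Listₚ.length-map (Vec.map g) solutions))
      (unique-length (Uniqueₚ.map⁺ map-injective (Uniqueₚ.filter⁺ P? (vectors-unique (suc n) k)))
        (Finite.unique F) to from)))
    where
    P? : Decidable (λ v → n ≡ e (Vec.map g v))
    P? v = n ℕₚ.≟ e (Vec.map g v)

    solutions : List (Vec ℕ k)
    solutions = filter P? (vectors (suc n) k)

    to : ∀ {z} → z ∈ List.map (Vec.map g) solutions → z ∈ Finite.elements F
    to z∈ with ∈-map⁻ (Vec.map g) z∈
    ... | v , v∈ , refl = Equivalence.from (Finite.complete F)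
      (all-sound v , sym (proj₂ (∈-filter⁻ P? {xs = vectors (suc n) k} v∈)))

    from : ∀ {z} → z ∈ Finite.elements F → z ∈ List.map (Vec.map g) solutions
    from z∈ with Equivalence.to (Finite.complete F) z∈
    ... | qs , refl with indices qs (bounded qs)
    ... | v , refl , b = ∈-map⁺ (Vec.map g) (∈-filter⁺ P? (∈-vectors b) refl)

progression : ∀ d r .{{_ : ℕ.NonZero d}} .{{_ : ℕ.NonZero r}} → r % d ≡ r →
              Enumerates (λ i → d ℕ.* i ℕ.+ r) (λ x → x > 0 × x % d ≡ r)
progression d r r%d≡r = record
  { sound     = λ i → ℕₚ.<-≤-trans (ℕ.>-nonZero⁻¹ r) (ℕₚ.m≤n+m r (d ℕ.* i)) ,
      trans (cong (_% d) (sym (swap i))) (trans ([m+kn]%n≡m%n r i d) r%d≡r)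
  ; index     = λ { {x} (_ , refl) → x / d , trans (sym (swap (x / d))) (sym (m≡m%n+[m/n]*n x d)) }
  ; increases = λ i → ℕₚ.≤-trans (ℕₚ.m≤n*m i d) (ℕₚ.m≤m+n _ r)
  ; injective = λ {i} {j} p → ℕₚ.*-cancelˡ-≡ i j d (ℕₚ.+-cancelʳ-≡ r (d ℕ.* i) (d ℕ.* j) p) }
  where
  swap : ∀ i → r ℕ.+ i ℕ.* d ≡ d ℕ.* i ℕ.+ r
  swap i = trans (ℕₚ.+-comm r (i ℕ.* d)) (cong (ℕ._+ r) (ℕₚ.*-comm i d))

≤-sum-zipWith : ∀ {k} (xs ys : Vec ℕ k) → All (_> 0) ys → All (_≤ Vec.sum (zipWith ℕ._*_ xs ys)) xs
≤-sum-zipWith []       []       []       = []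
≤-sum-zipWith (x ∷ xs) (y ∷ ys) (p ∷ ps) =
  ℕₚ.≤-trans (ℕₚ.m≤m*n x y {{ℕ.>-nonZero p}}) (ℕₚ.m≤m+n _ _) ∷
  All.map (λ q → ℕₚ.≤-trans q (ℕₚ.m≤n+m _ (x ℕ.* y))) (≤-sum-zipWith xs ys ps)

≤-cyclicSum : ∀ {k} {xs : Vec ℕ k} → All (_> 0) xs → All (_≤ cyclicSum xs) xs
≤-cyclicSum []                      = []
≤-cyclicSum {xs = x ∷ xs} (p ∷ ps) = ≤-sum-zipWith (x ∷ xs) (xs ∷ʳ x) (snoc ps p)
  where
  snoc : ∀ {k x} {xs : Vec ℕ k} → All (_> 0) xs → x > 0 → All (_> 0) (xs ∷ʳ x)
  snoc []       q = q ∷ []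
  snoc (p ∷ ps) q = p ∷ snoc ps q

≤-sumOfSquares : ∀ {k} {xs : Vec ℕ k} → All (_> 0) xs → All (_≤ sumOfSquares xs) xs
≤-sumOfSquares []                     = []
≤-sumOfSquares {xs = x ∷ xs} (p ∷ ps) =
  ℕₚ.≤-trans (ℕₚ.m≤m*n x (x ℕ.* 1) {{ℕ.>-nonZero (subst (_> 0) (sym (ℕₚ.*-identityʳ x)) p)}}) (ℕₚ.m≤m+n _ _) ∷
  All.map (λ q → ℕₚ.≤-trans q (ℕₚ.m≤n+m _ (x ℕ.^ 2))) (≤-sumOfSquares ps)

counting : ∀ n k → k ≥ 1 → + c 1 k n ≡ + r k n + (-1ℤ ^ k) *ℤ (+ c 3 k n)
counting n (suc k) k≥1 = begin
  + c 1 (suc k) n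
    ≡⟨ count (progression 4 1 refl) cyclicSum (≤-cyclicSum ∘ All.map proj₁) (CSet-finite 1 (suc k) n) ⟨
  VecSum (suc n) (suc k) (λ v → mono (cyclicSum (Vec.map (λ i → 4 ℕ.* i ℕ.+ 1) v))) n
    -- Precision `suc n` is the least that reveals coefficient n, and it gives the box the side that
    -- `count` expects.
    ≡⟨ tr-A↑ k (suc n) A↑-admitted n ℕₚ.≤-refl ⟨
  tr (A ↑ suc k) A↑-admitted n
    ≡⟨ similar⇒tr (similar-↑ similar-B (suc k)) A↑-admitted B↑-admitted n ⟩
  tr (B ↑ suc k) B↑-admitted n
    ≡⟨ tr-B↑ k (suc n) B↑-admitted n ℕₚ.≤-refl ⟩
  (R ⊕ sign (suc k) ⊗ C) n
    ≡⟨ ⊕-coefficient R (sign (suc k) ⊗ C) n ⟩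
  R n + (sign (suc k) ⊗ C) n
    ≡⟨ cong (λ x → R n + x) (sign-coefficient (suc k) C n) ⟩
  R n + (-1ℤ ^ suc k) *ℤ C n
    ≡⟨ cong₂ (λ x y → x + (-1ℤ ^ suc k) *ℤ y)
         (count (progression 2 1 refl) sumOfSquares (≤-sumOfSquares ∘ All.map proj₁) (RSet-finite (suc k) n))
         (count (progression 4 3 refl) cyclicSum (≤-cyclicSum ∘ All.map proj₁) (CSet-finite 3 (suc k) n)) ⟩
  + r (suc k) n + (-1ℤ ^ suc k) *ℤ (+ c 3 (suc k) n) ∎
  where
  open ≡-Reasoning
  R = VecSum (suc n) (suc k) (λ v → mono (sumOfSquares (Vec.map (λ l → 2 ℕ.* l ℕ.+ 1) v)))
  C = VecSum (suc n) (suc k) (λ v → mono (cyclicSum (Vec.map 4i+3 v)))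
  A↑-admitted : Admitted (entry (A ↑ suc k))
  A↑-admitted = admitted-resp (≅-sym (↑≅^ᴹ A (suc k))) (^ᴹ-admitted A a-admitted (suc k) k≥1)
  B↑-admitted : Admitted (entry (B ↑ suc k))
  B↑-admitted = admitted-resp (≅-sym (↑≅^ᴹ B (suc k))) (^ᴹ-admitted B b-admitted (suc k) k≥1)

mainTheorem1 : (∃[ X ] (Invertible X × X · B ≋ A · X))
    × (∀ (k : ℕ) (k≥1 : k ≥ 1) →
    tr (A ^ᴹ k) (^ᴹ-admitted A a-admitted k k≥1)
    ≈ tr (B ^ᴹ k) (^ᴹ-admitted B b-admitted k k≥1))
    × (∀ (n k : ℕ) → n ≥ 1 → k ≥ 1 →
    + c 1 k n ≡ + r k n + (-1ℤ ^ k) *ℤ (+ c 3 k n))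
mainTheorem1 = similar⇒conjugate similar-B , tr-powers , λ n k _ → counting n k
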